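{- Let $\Delta$ be a resource bound. If $\nu$ is a $\Delta$-probability measure on $\mathbf{C}$, then for each $w\in\{0,1\}^*$ the cylinder $\mathbf{C}_w$ is $\Delta$-$\nu$-measurable, with $\nu_\Delta(\mathbf{C}_w)=\nu(w)$.
   Context: Functionals. A type-two functional maps tuples $(\vec f,\vec x)$ of functions $f_j:\{0,1\}^*\to\{0,1\}^*$ and strings $x_j$ to strings. Functional composition: $F(\vec f,\vec x)=H(\vec f,G_1(\vec f,\vec x),\dots,G_l(\vec f,\vec x))$. Expansion: $F(\vec f,\vec g,\vec x,\vec y)=G(\vec f,\vec x)$. Limited recursion on notation: $F(\vec f,\vec x,\lambda)=G(\vec f,\vec x)$, $F(\vec f,\vec x,wb)=H(\vec f,\vec x,wb,F(\vec f,\vec x,w))$ for $b\in\{0,1\}$, with $|F(\vec f,\vec x,w)|\le|K(\vec f,\vec x,w)|$. $\mathrm{BFF}(X)$ is the smallest class of functionals containing $X$, all polynomial-time type-one functions and $\mathrm{Ap}(f,x)=f(x)$, and closed under these three operations. A resource bound is a class $\Delta$ of functionals of type at most $2$ with $\mathrm{BFF}(\Delta)=\Delta$. Cantor space. $\mathbf{C}=\{0,1\}^\infty$; $\mathbf{C}_w$ is the set of $S\in\mathbf{C}$ with prefix $w$; $A[0..n-1]$ is the $n$-bit prefix of $A$; $\lambda$ is the empty string. A probability measure on $\mathbf{C}$ is $\nu:\{0,1\}^*\to[0,1]$ with $\nu(\lambda)=1$ and $\nu(w)=\nu(w0)+\nu(w1)$ for all $w$. A $\nu$-martingale is $d:\{0,1\}^*\to[0,\infty)$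 with $d(w)\nu(w)=d(w0)\nu(w0)+d(w1)\nu(w1)$ for all $w$; $\mathcal{D}_\nu$ is the set of $\nu$-martingales; $\mathbf{1}$ is the constant martingale $1$. $S^1[d]=\{A\in\mathbf{C}: d(A[0..n-1])\ge 1\text{ for some }n\}$. Computability. A computation of $f:D\to\mathbb{R}$ ($D$ discrete) is $\hat f:\mathbb{N}\times D\to\mathbb{Q}$ with $|\hat f(r,x)-f(x)|\le 2^{ -r}$; it is canonical if every $\hat f(r,x)$ is an integer multiple of $2^{ -r}$. $f$ is $\Delta$-computable if it has a computation in $\Delta$. A functional on martingales is $\Delta$-computable if there is a functional in $\Delta$ which, given canonical computations of the martingale arguments as function inputs, the remaining arguments, a precision $r$ and a string $w$, outputs the value of each output martingale at $w$ within $2^{ -r}$. Natural numbers (precision, indices, arguments and values of $l$ below) are presented in unary. A $\Delta$-probability measure is a probability measure $\nu$ that is $\Delta$-computable and for which there is a $\Delta$-computable $l:\mathbb{N}\to\mathbb{N}$ such that for all $w\in\{0,1\}^*$, $\nu(w)=0$ or $\nu(w)\ge 2^{ -l(|w|)}$. Measure. For disjoint $X^+,X^-\subseteq\mathbf{C}$, a $\nu$-splitting operator for $(X^+,X^-)$ is $\Phi:\mathbb{N}\times\mathcal{D}_\nu\to\mathcal{D}_\nu\times\mathcal{D}_\nu$, $\Phi(r,d)=(\Phi^+_r(d),\Phi^-_r(d))$, such that for all $r,d$: $X^+\cap S^1[d]\subseteq S^1[\Phi^+_r(d)]$; $X^-\cap S^1[d]\subseteq S^1[\Phi^-_r(d)]$;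 $\Phi^+_r(d)(\lambda)+\Phi^-_r(d)(\lambda)\le d(\lambda)+2^{ -r}$. A $\Delta$-$\nu$-measurement of $X\subseteq\mathbf{C}$ is a $\Delta$-computable $\nu$-splitting operator for $(X,\mathbf{C}\setminus X)$. $X$ is $\Delta$-$\nu$-measurable if it has a $\Delta$-$\nu$-measurement $\Phi$, and then $\nu_\Delta(X)=\inf_{r}\Phi^+_r(\mathbf{1})(\lambda)$ (which does not depend on the choice of $\Phi$). -}

module Defs where

open import Level using (Level; 0ℓ) renaming (suc to lsuc)
open import Function.Bundles using (_⇔_)
open import Data.Bool.Base using (Bool; true; false; if_then_else_)
open import Data.Empty using (⊥-elim)
open import Data.Fin.Base using (Fin; zero; _↑ʳ_)
open import Data.Integer.Base as ℤ using (ℤ)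
open import Data.List.Base as List using (List; []; _∷_; _∷ʳ_; length)
open import Data.Maybe.Base using (Maybe; just; nothing)
open import Data.Nat.Base as ℕ using (ℕ; zero; suc)
import Data.Nat.Properties as ℕₚ
import Data.Integer.Properties as ℤₚ
import Data.Rational.Unnormalised.Base as ℚᵘ
import Data.Rational.Unnormalised.Properties as ℚᵘₚ
open import Data.Product.Base using (Σ; _×_; _,_; proj₁; proj₂; ∃; ∃₂)
open import Data.Rational.Base as ℚ using (ℚ; 0ℚ; 1ℚ; ½)
import Data.Rational.Properties as ℚₚ
open import Data.Rational.Solver using (module +-*-Solver)
open import Data.Sign.Base as Sign using (Sign)
open import Data.Sum.Base using (_⊎_; inj₁; inj₂)
open import Data.Vec.Base as Vec using (Vec; []; _∷_)
open import Relation.Binary.PropositionalEquality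
  using (_≡_; refl; sym; trans; cong; cong₂; subst; subst₂)
open import Relation.Nullary using (yes; no)
open import Relation.Unary using (Pred; _∩_; _⊆_; ∁; Empty)

2^-_ : ℕ → ℚ
2^- zero  = 1ℚ
2^- suc n = ½ ℚ.* (2^- n)

2^+_ : ℕ → ℚ
2^+ zero  = 1ℚ
2^+ suc n = (2^+ n) ℚ.+ (2^+ n)

2ℚ : ℚ
2ℚ = 1ℚ ℚ.+ 1ℚ

open +-*-Solver

halves : ∀ n → (2^- suc n) ℚ.+ (2^- suc n) ≡ 2^- n
halves n = trans
  (solve 1 (λ h → con ½ :* h :+ con ½ :* h := con 1ℚ :* h) refl (2^- n))
  (ℚₚ.*-identityˡ (2^- n))

2^-pos : ∀ n → 0ℚ ℚ.< 2^- n
2^-pos zero    = ℚₚ.positive⁻¹ 1ℚ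
2^-pos (suc n) = subst (ℚ._< ½ ℚ.* (2^- n)) (ℚₚ.*-zeroʳ ½)
  (ℚₚ.*-monoʳ-<-pos ½ (2^-pos n))

2^+≥1 : ∀ n → 1ℚ ℚ.≤ 2^+ n
2^+≥1 zero    = ℚₚ.≤-refl
2^+≥1 (suc n) = ℚₚ.≤-trans (2^+≥1 n)
  (subst (ℚ._≤ (2^+ n) ℚ.+ (2^+ n)) (ℚₚ.+-identityʳ (2^+ n))
    (ℚₚ.+-monoʳ-≤ (2^+ n) (ℚₚ.≤-trans (ℚₚ.nonNegative⁻¹ 1ℚ) (2^+≥1 n))))

2^+*2^- : ∀ n → (2^+ n) ℚ.* (2^- n) ≡ 1ℚ
2^+*2^- zero    = refl
2^+*2^- (suc n) = trans
  (solve 2 (λ p h → (p :+ p) :* (con ½ :* h) := p :* h) refl (2^+ n) (2^- n))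
  (2^+*2^- n)

2^-+ : ∀ m n → 2^- (m ℕ.+ n) ≡ (2^- m) ℚ.* (2^- n)
2^-+ zero    n = sym (ℚₚ.*-identityˡ _)
2^-+ (suc m) n = trans (cong (½ ℚ.*_) (2^-+ m n)) (sym (ℚₚ.*-assoc ½ (2^- m) (2^- n)))

2^-≤1 : ∀ n → 2^- n ℚ.≤ 1ℚ
2^-≤1 zero    = ℚₚ.≤-refl
2^-≤1 (suc n) = ℚₚ.≤-trans
  (subst₂ ℚ._≤_ (ℚₚ.+-identityʳ (2^- suc n)) (halves n)
    (ℚₚ.+-monoʳ-≤ (2^- suc n) (ℚₚ.<⇒≤ (2^-pos (suc n)))))
  (2^-≤1 n)

2^-anti : ∀ m n → 2^- (n ℕ.+ m) ℚ.≤ 2^- n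
2^-anti m n = subst₂ ℚ._≤_ (sym (2^-+ n m)) (ℚₚ.*-identityʳ (2^- n))
  (ℚₚ.*-monoˡ-≤-nonNeg (2^- n) {{ℚ.nonNegative (ℚₚ.<⇒≤ (2^-pos n))}} (2^-≤1 m))

fromℕ : ℕ → ℚ
fromℕ zero    = 0ℚ
fromℕ (suc n) = 1ℚ ℚ.+ fromℕ n

fromℕ<2^+ : ∀ n → fromℕ n ℚ.< 2^+ n
fromℕ<2^+ zero    = ℚₚ.positive⁻¹ 1ℚ
fromℕ<2^+ (suc n) = ℚₚ.+-mono-≤-< (2^+≥1 n) (fromℕ<2^+ n)

triangle : ∀ p q r → ℚ.∣ p ℚ.- r ∣ ℚ.≤ ℚ.∣ p ℚ.- q ∣ ℚ.+ ℚ.∣ q ℚ.- r ∣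
triangle p q r = subst (λ z → ℚ.∣ z ∣ ℚ.≤ ℚ.∣ p ℚ.- q ∣ ℚ.+ ℚ.∣ q ℚ.- r ∣)
  (solve 3 (λ p q r → (p :- q) :+ (q :- r) := p :- r) refl p q r)
  (ℚₚ.∣p+q∣≤∣p∣+∣q∣ (p ℚ.- q) (q ℚ.- r))

dist-sym : ∀ p q → ℚ.∣ p ℚ.- q ∣ ≡ ℚ.∣ q ℚ.- p ∣
dist-sym p q = trans (sym (ℚₚ.∣-p∣≡∣p∣ (p ℚ.- q)))
  (cong ℚ.∣_∣ (solve 2 (λ p q → :- (p :- q) := q :- p) refl p q))

fromℕᵘ : ∀ n → ℚ.toℚᵘ (fromℕ n) ℚᵘ.≃ ℚᵘ.mkℚᵘ (ℤ.+ n) 0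
fromℕᵘ zero    = ℚᵘₚ.≃-refl
fromℕᵘ (suc n) = ℚᵘₚ.≃-trans (ℚₚ.toℚᵘ-homo-+ 1ℚ (fromℕ n))
  (ℚᵘₚ.≃-trans (ℚᵘₚ.+-congʳ ℚᵘ.1ℚᵘ (fromℕᵘ n))
    (ℚᵘ.*≡* (cong (λ z → (ℤ.+ 1 ℤ.+ z) ℤ.* ℤ.+ 1) (ℤₚ.*-identityʳ (ℤ.+ n)))))

∣p∣≤fromℕ∣↥p∣ : ∀ p → ℚ.∣ p ∣ ℚ.≤ fromℕ ℤ.∣ ℚ.↥ p ∣
∣p∣≤fromℕ∣↥p∣ p@record{} = ℚₚ.toℚᵘ-cancel-≤
  (ℚᵘₚ.≤-respʳ-≃ (ℚᵘₚ.≃-sym (fromℕᵘ ℤ.∣ ℚ.↥ p ∣))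
    (ℚᵘₚ.≤-respˡ-≃ (ℚᵘₚ.≃-sym (ℚₚ.toℚᵘ-homo-∣-∣ p))
      (ℚᵘ.*≤* (ℤₚ.*-monoˡ-≤-nonNeg (ℤ.+ ℤ.∣ ℚ.↥ p ∣) (ℤ.+≤+ (ℕ.s≤s ℕ.z≤n))))))

archimedean : ∀ p → 0ℚ ℚ.< p → ∃ λ n → 2^- n ℚ.< p
archimedean p@(ℚ.mkℚ (ℤ.+_ zero)  d _) 0<p = ⊥-elim (ℚₚ.<-irrefl (sym (ℚₚ.↥p≡0⇒p≡0 p refl)) 0<p)
archimedean p@(ℚ.mkℚ ℤ.-[1+ n ]   d _) (ℚ.*<* ())
archimedean p@(ℚ.mkℚ (ℤ.+_ (suc n)) d _) 0<p = m , subst₂ ℚ._<_ (ℚₚ.*-identityˡ (2^- m)) eq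
    (ℚₚ.*-monoˡ-<-pos (2^- m) {{ℚ.positive (2^-pos m)}} (ℚₚ.≤-<-trans 1≤ (ℚₚ.*-monoʳ-<-pos p (fromℕ<2^+ m))))
  where
  m = suc d
  eq : (p ℚ.* (2^+ m)) ℚ.* (2^- m) ≡ p
  eq = trans (ℚₚ.*-assoc p (2^+ m) (2^- m)) (trans (cong (p ℚ.*_) (2^+*2^- m)) (ℚₚ.*-identityʳ p))
  1≤ : 1ℚ ℚ.≤ p ℚ.* fromℕ m
  1≤ = ℚₚ.toℚᵘ-cancel-≤ (ℚᵘₚ.≤-respʳ-≃
    (ℚᵘₚ.≃-sym (ℚᵘₚ.≃-trans (ℚₚ.toℚᵘ-homo-* p (fromℕ m)) (ℚᵘₚ.*-congˡ {ℚ.toℚᵘ p} (fromℕᵘ m))))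
    (ℚᵘ.*≤* (ℤ.+≤+ lem)))
    where
    lem : 1 ℕ.* (suc d ℕ.* 1) ℕ.≤ suc n ℕ.* suc d ℕ.* 1
    lem = subst₂ ℕ._≤_ (sym (trans (ℕₚ.*-identityˡ _) (ℕₚ.*-identityʳ _))) (sym (ℕₚ.*-identityʳ _))
      (ℕₚ.m≤m+n (suc d) (n ℕ.* suc d))

≤-limit : ∀ p q → (∀ m → p ℚ.≤ q ℚ.+ (2^- m)) → p ℚ.≤ q
≤-limit p q h with p ℚₚ.≤? q
... | yes p≤q = p≤q
... | no  p≰q with archimedean (p ℚ.- q) (subst (ℚ._< p ℚ.- q) (ℚₚ.+-inverseʳ q) (ℚₚ.+-monoˡ-< (ℚ.- q) (ℚₚ.≰⇒> p≰q)))
...   | m , 2^-m< = ⊥-elim (ℚₚ.<-irrefl refl (ℚₚ.≤-<-trans (h m)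
          (subst (q ℚ.+ (2^- m) ℚ.<_) (solve 2 (λ p q → q :+ (p :- q) := p) refl p q)
            (ℚₚ.+-monoʳ-< q 2^-m<))))

-- A real number is a regular Cauchy sequence of rationals, as in Bishop.

record ℝ : Set where
  constructor mkℝ
  field
    seq     : ℕ → ℚ
    regular : ∀ m n → ℚ.∣ seq m ℚ.- seq n ∣ ℚ.≤ (2^- m) ℚ.+ (2^- n)

open ℝ public

infix  4 _≈ᵣ_ _≤ᵣ_
infixl 6 _+ᵣ_ _-ᵣ_
infixl 7 _*ᵣ_

_≈ᵣ_ : ℝ → ℝ → Set
x ≈ᵣ y = ∀ n → ℚ.∣ seq x n ℚ.- seq y n ∣ ℚ.≤ (2^- n) ℚ.+ (2^- n)

_≤ᵣ_ : ℝ → ℝ → Set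
x ≤ᵣ y = ∀ n → seq x n ℚ.≤ seq y n ℚ.+ ((2^- n) ℚ.+ (2^- n))

fromℚ : ℚ → ℝ
seq     (fromℚ q) _   = q
regular (fromℚ q) m n = subst (ℚ._≤ (2^- m) ℚ.+ (2^- n)) (sym (cong ℚ.∣_∣ (ℚₚ.+-inverseʳ q)))
  (ℚₚ.+-mono-≤ (ℚₚ.<⇒≤ (2^-pos m)) (ℚₚ.<⇒≤ (2^-pos n)))

0ᵣ 1ᵣ : ℝ
0ᵣ = fromℚ 0ℚ
1ᵣ = fromℚ 1ℚ

dist-+ : ∀ a b c d → ℚ.∣ (a ℚ.+ b) ℚ.- (c ℚ.+ d) ∣ ℚ.≤ ℚ.∣ a ℚ.- c ∣ ℚ.+ ℚ.∣ b ℚ.- d ∣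
dist-+ a b c d = subst (λ z → ℚ.∣ z ∣ ℚ.≤ ℚ.∣ a ℚ.- c ∣ ℚ.+ ℚ.∣ b ℚ.- d ∣)
  (solve 4 (λ a b c d → (a :- c) :+ (b :- d) := (a :+ b) :- (c :+ d)) refl a b c d)
  (ℚₚ.∣p+q∣≤∣p∣+∣q∣ (a ℚ.- c) (b ℚ.- d))

regroup-halves : ∀ m n → ((2^- suc m) ℚ.+ (2^- suc n)) ℚ.+ ((2^- suc m) ℚ.+ (2^- suc n)) ≡ (2^- m) ℚ.+ (2^- n)
regroup-halves m n = trans
  (solve 2 (λ a b → (a :+ b) :+ (a :+ b) := (a :+ a) :+ (b :+ b)) refl (2^- suc m) (2^- suc n))
  (cong₂ ℚ._+_ (halves m) (halves n))

_+ᵣ_ : ℝ → ℝ → ℝ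
seq     (x +ᵣ y) n   = seq x (suc n) ℚ.+ seq y (suc n)
regular (x +ᵣ y) m n = ℚₚ.≤-trans
  (dist-+ (seq x (suc m)) (seq y (suc m)) (seq x (suc n)) (seq y (suc n)))
  (subst (ℚ.∣ seq x (suc m) ℚ.- seq x (suc n) ∣ ℚ.+ ℚ.∣ seq y (suc m) ℚ.- seq y (suc n) ∣ ℚ.≤_)
    (regroup-halves m n)
    (ℚₚ.+-mono-≤ (regular x (suc m) (suc n)) (regular y (suc m) (suc n))))

-ᵣ_ : ℝ → ℝ
seq     (-ᵣ x) n   = ℚ.- seq x n
regular (-ᵣ x) m n = subst (ℚ._≤ (2^- m) ℚ.+ (2^- n))
  (trans (sym (ℚₚ.∣-p∣≡∣p∣ (seq x m ℚ.- seq x n)))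
    (cong ℚ.∣_∣ (solve 2 (λ p q → :- (p :- q) := (:- p) :- (:- q)) refl (seq x m) (seq x n))))
  (regular x m n)

_-ᵣ_ : ℝ → ℝ → ℝ
x -ᵣ y = x +ᵣ (-ᵣ y)

∣p∣≤∣p-q∣+∣q∣ : ∀ p q → ℚ.∣ p ∣ ℚ.≤ ℚ.∣ p ℚ.- q ∣ ℚ.+ ℚ.∣ q ∣
∣p∣≤∣p-q∣+∣q∣ p q = subst (λ z → ℚ.∣ z ∣ ℚ.≤ ℚ.∣ p ℚ.- q ∣ ℚ.+ ℚ.∣ q ∣)
  (solve 2 (λ p q → (p :- q) :+ q := p) refl p q)
  (ℚₚ.∣p+q∣≤∣p∣+∣q∣ (p ℚ.- q) q)

∣p∣-∣q∣≤∣p-q∣ : ∀ p q → ℚ.∣ p ∣ ℚ.- ℚ.∣ q ∣ ℚ.≤ ℚ.∣ p ℚ.- q ∣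
∣p∣-∣q∣≤∣p-q∣ p q = subst (ℚ.∣ p ∣ ℚ.- ℚ.∣ q ∣ ℚ.≤_)
  (solve 2 (λ d q → (d :+ q) :- q := d) refl ℚ.∣ p ℚ.- q ∣ ℚ.∣ q ∣)
  (ℚₚ.+-monoˡ-≤ (ℚ.- ℚ.∣ q ∣) (∣p∣≤∣p-q∣+∣q∣ p q))

∣∣p∣-∣q∣∣≤∣p-q∣ : ∀ p q → ℚ.∣ ℚ.∣ p ∣ ℚ.- ℚ.∣ q ∣ ∣ ℚ.≤ ℚ.∣ p ℚ.- q ∣
∣∣p∣-∣q∣∣≤∣p-q∣ p q with ℚₚ.∣p∣≡p∨∣p∣≡-p (ℚ.∣ p ∣ ℚ.- ℚ.∣ q ∣)
... | inj₁ e = subst (ℚ._≤ ℚ.∣ p ℚ.- q ∣) (sym e) (∣p∣-∣q∣≤∣p-q∣ p q)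
... | inj₂ e = subst₂ ℚ._≤_
  (trans (solve 2 (λ a b → b :- a := :- (a :- b)) refl ℚ.∣ p ∣ ℚ.∣ q ∣) (sym e))
  (dist-sym q p) (∣p∣-∣q∣≤∣p-q∣ q p)

∣_∣ᵣ : ℝ → ℝ
seq     ∣ x ∣ᵣ n   = ℚ.∣ seq x n ∣
regular ∣ x ∣ᵣ m n = ℚₚ.≤-trans (∣∣p∣-∣q∣∣≤∣p-q∣ (seq x m) (seq x n)) (regular x m n)

-- 2^ (magnitude x) bounds every term of the sequence of x.

magnitude : ℝ → ℕ
magnitude x = ℤ.∣ ℚ.↥ seq x 0 ∣ ℕ.+ 2

2^++2 : ∀ n → 2ℚ ℚ.+ fromℕ n ℚ.≤ 2^+ (n ℕ.+ 2)
2^++2 zero    = ℚ.*≤* (ℤ.+≤+ (ℕ.s≤s (ℕ.s≤s ℕ.z≤n)))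
2^++2 (suc n) = subst (ℚ._≤ 2^+ (suc n ℕ.+ 2))
  (solve 2 (λ o f → o :+ ((o :+ o) :+ f) := (o :+ o) :+ (o :+ f)) refl 1ℚ (fromℕ n))
  (ℚₚ.+-mono-≤ (2^+≥1 (n ℕ.+ 2)) (2^++2 n))

2^+-mono : ∀ m n → 2^+ m ℚ.≤ 2^+ (n ℕ.+ m)
2^+-mono m zero    = ℚₚ.≤-refl
2^+-mono m (suc n) = ℚₚ.≤-trans (2^+-mono m n)
  (subst (ℚ._≤ 2^+ (suc n ℕ.+ m)) (ℚₚ.+-identityʳ (2^+ (n ℕ.+ m)))
    (ℚₚ.+-monoʳ-≤ (2^+ (n ℕ.+ m)) (ℚₚ.≤-trans (ℚₚ.nonNegative⁻¹ 1ℚ) (2^+≥1 (n ℕ.+ m)))))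

magnitude-bound : ∀ x n → ℚ.∣ seq x n ∣ ℚ.≤ 2^+ magnitude x
magnitude-bound x n = ℚₚ.≤-trans (∣p∣≤∣p-q∣+∣q∣ (seq x n) (seq x 0))
  (ℚₚ.≤-trans
    (ℚₚ.+-mono-≤ (ℚₚ.≤-trans (regular x n 0) (ℚₚ.+-monoˡ-≤ 1ℚ (2^-≤1 n))) (∣p∣≤fromℕ∣↥p∣ (seq x 0)))
    (2^++2 ℤ.∣ ℚ.↥ seq x 0 ∣))

shift : ℝ → ℝ → ℕ
shift x y = suc (magnitude x ℕ.+ magnitude y)

dist-* : ∀ B a b c d → ℚ.∣ a ∣ ℚ.≤ B → ℚ.∣ d ∣ ℚ.≤ B →
         ℚ.∣ a ℚ.* b ℚ.- c ℚ.* d ∣ ℚ.≤ B ℚ.* (ℚ.∣ b ℚ.- d ∣ ℚ.+ ℚ.∣ a ℚ.- c ∣)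
dist-* B a b c d ∣a∣≤B ∣d∣≤B = ℚₚ.≤-trans
  (triangle (a ℚ.* b) (a ℚ.* d) (c ℚ.* d))
  (subst₂ ℚ._≤_
    (cong₂ ℚ._+_
      (trans (sym (ℚₚ.∣p*q∣≡∣p∣*∣q∣ a (b ℚ.- d)))
        (cong ℚ.∣_∣ (solve 3 (λ a b d → a :* (b :- d) := a :* b :- a :* d) refl a b d)))
      (trans (sym (ℚₚ.∣p*q∣≡∣p∣*∣q∣ d (a ℚ.- c)))
        (cong ℚ.∣_∣ (solve 3 (λ a c d → d :* (a :- c) := a :* d :- c :* d) refl a c d))))
    (sym (ℚₚ.*-distribˡ-+ B ℚ.∣ b ℚ.- d ∣ ℚ.∣ a ℚ.- c ∣))
    (ℚₚ.+-mono-≤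
      (ℚₚ.*-monoʳ-≤-nonNeg ℚ.∣ b ℚ.- d ∣ {{ℚₚ.∣-∣-nonNeg (b ℚ.- d)}} ∣a∣≤B)
      (ℚₚ.*-monoʳ-≤-nonNeg ℚ.∣ a ℚ.- c ∣ {{ℚₚ.∣-∣-nonNeg (a ℚ.- c)}} ∣d∣≤B)))

_*ᵣ_ : ℝ → ℝ → ℝ
seq     (x *ᵣ y) n   = seq x (shift x y ℕ.+ n) ℚ.* seq y (shift x y ℕ.+ n)
regular (x *ᵣ y) m n = ℚₚ.≤-trans
  (dist-* B (seq x m′) (seq y m′) (seq x n′) (seq y n′) ∣x∣≤B ∣y∣≤B)
  (subst (B ℚ.* (ℚ.∣ seq y m′ ℚ.- seq y n′ ∣ ℚ.+ ℚ.∣ seq x m′ ℚ.- seq x n′ ∣) ℚ.≤_)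
    scale
    (ℚₚ.*-monoˡ-≤-nonNeg B {{ℚ.nonNegative 0≤B}}
      (ℚₚ.+-mono-≤ (regular y m′ n′) (regular x m′ n′))))
  where
  k m′ n′ : ℕ
  k  = magnitude x ℕ.+ magnitude y
  m′ = suc k ℕ.+ m
  n′ = suc k ℕ.+ n
  B : ℚ
  B = 2^+ k
  0≤B : 0ℚ ℚ.≤ B
  0≤B = ℚₚ.≤-trans (ℚₚ.nonNegative⁻¹ 1ℚ) (2^+≥1 k)
  ∣x∣≤B : ℚ.∣ seq x m′ ∣ ℚ.≤ B
  ∣x∣≤B = ℚₚ.≤-trans (magnitude-bound x m′)
    (subst (λ j → 2^+ magnitude x ℚ.≤ 2^+ j) (ℕₚ.+-comm (magnitude y) (magnitude x))
      (2^+-mono (magnitude x) (magnitude y)))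
  ∣y∣≤B : ℚ.∣ seq y n′ ∣ ℚ.≤ B
  ∣y∣≤B = ℚₚ.≤-trans (magnitude-bound y n′) (2^+-mono (magnitude y) (magnitude x))
  scale : B ℚ.* (((2^- m′) ℚ.+ (2^- n′)) ℚ.+ ((2^- m′) ℚ.+ (2^- n′))) ≡ (2^- m) ℚ.+ (2^- n)
  scale = trans
    (cong (B ℚ.*_) (trans (regroup-halves (k ℕ.+ m) (k ℕ.+ n)) (cong₂ ℚ._+_ (2^-+ k m) (2^-+ k n))))
    (trans
      (solve 4 (λ b h s t → b :* (h :* s :+ h :* t) := (b :* h) :* (s :+ t)) refl B (2^- k) (2^- m) (2^- n))
      (trans (cong (ℚ._* ((2^- m) ℚ.+ (2^- n))) (2^+*2^- k)) (ℚₚ.*-identityˡ _)))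

≈ᵣ-sym : ∀ x y → x ≈ᵣ y → y ≈ᵣ x
≈ᵣ-sym x y x≈y n = subst (ℚ._≤ (2^- n) ℚ.+ (2^- n)) (dist-sym (seq x n) (seq y n)) (x≈y n)

≈ᵣ-trans : ∀ x y z → x ≈ᵣ y → y ≈ᵣ z → x ≈ᵣ z
≈ᵣ-trans x y z x≈y y≈z n = ≤-limit _ _ λ m →
  let j = 3 ℕ.+ m
      h = 2^- m
      step = ℚₚ.≤-trans (triangle (seq x n) (seq x j) (seq z n))
        (ℚₚ.+-mono-≤ (regular x n j)
          (ℚₚ.≤-trans (triangle (seq x j) (seq y j) (seq z n))
            (ℚₚ.+-mono-≤ (x≈y j)
              (ℚₚ.≤-trans (triangle (seq y j) (seq z j) (seq z n))
                (ℚₚ.+-mono-≤ (y≈z j) (regular z j n))))))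
      pad = ℚₚ.+-monoʳ-≤
        (((2^- n) ℚ.+ (2^- j)) ℚ.+ (((2^- j) ℚ.+ (2^- j)) ℚ.+ (((2^- j) ℚ.+ (2^- j)) ℚ.+ ((2^- j) ℚ.+ (2^- n)))))
        (ℚₚ.+-mono-≤ (ℚₚ.<⇒≤ (2^-pos j)) (ℚₚ.<⇒≤ (2^-pos j)))
  in ℚₚ.≤-trans step
       (subst₂ ℚ._≤_ (ℚₚ.+-identityʳ _)
         (solve 2 (λ t h →
             ((t :+ con ½ :* (con ½ :* (con ½ :* h)))
               :+ ((con ½ :* (con ½ :* (con ½ :* h)) :+ con ½ :* (con ½ :* (con ½ :* h)))
               :+ ((con ½ :* (con ½ :* (con ½ :* h)) :+ con ½ :* (con ½ :* (con ½ :* h)))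
               :+ (con ½ :* (con ½ :* (con ½ :* h)) :+ t))))
               :+ (con ½ :* (con ½ :* (con ½ :* h)) :+ con ½ :* (con ½ :* (con ½ :* h)))
             := (t :+ t) :+ h) refl (2^- n) h)
         pad)

+ᵣ-cong : ∀ x x′ y y′ → x ≈ᵣ x′ → y ≈ᵣ y′ → x +ᵣ y ≈ᵣ x′ +ᵣ y′
+ᵣ-cong x x′ y y′ x≈x′ y≈y′ n = ℚₚ.≤-trans
  (dist-+ (seq x (suc n)) (seq y (suc n)) (seq x′ (suc n)) (seq y′ (suc n)))
  (subst (ℚ.∣ seq x (suc n) ℚ.- seq x′ (suc n) ∣ ℚ.+ ℚ.∣ seq y (suc n) ℚ.- seq y′ (suc n) ∣ ℚ.≤_)
    (regroup-halves n n)
    (ℚₚ.+-mono-≤ (x≈x′ (suc n)) (y≈y′ (suc n))))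

*ᵣ-identityˡ : ∀ x → 1ᵣ *ᵣ x ≈ᵣ x
*ᵣ-identityˡ x n = subst (λ z → ℚ.∣ z ℚ.- seq x n ∣ ℚ.≤ (2^- n) ℚ.+ (2^- n))
  (sym (ℚₚ.*-identityˡ (seq x n′)))
  (ℚₚ.≤-trans (regular x n′ n)
    (ℚₚ.+-monoˡ-≤ (2^- n) (subst (λ j → 2^- j ℚ.≤ 2^- n) (ℕₚ.+-comm n (shift 1ᵣ x)) (2^-anti (shift 1ᵣ x) n))))
  where n′ = shift 1ᵣ x ℕ.+ n

IsInfimum : (ℕ → ℝ) → ℝ → Set
IsInfimum a v = (∀ r → v ≤ᵣ a r) × (∀ b → (∀ r → b ≤ᵣ a r) → b ≤ᵣ v)

Str : Set
Str = List Bool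

unary : ℕ → Str
unary n = List.replicate n true

-- A self-delimiting pairing: 0^|x| 1 x y.

⟨_,_⟩ : Str → Str → Str
⟨ x , y ⟩ = List.replicate (length x) false List.++ true ∷ x List.++ y

-- Binary numerals, most significant bit first; leading zeros are allowed.

numeral : Str → ℕ
numeral = List.foldl (λ n b → 2 ℕ.* n ℕ.+ (if b then 1 else 0)) 0

-- Rationals are written as a sign bit followed by a pair of numerals, not
-- necessarily in lowest terms.

record Denotes (x : Str) (q : ℚ) : Set where
  field
    negative    : Bool
    num den     : Str
    {{den-≢0}}  : ℕ.NonZero (numeral den)
    form        : x ≡ negative ∷ ⟨ num , den ⟩
    value       : q ≡ ((if negative then Sign.- else Sign.+) ℤ.◃ numeral num) ℚ./ numeral den

-- Polynomial time is measured on deterministic multitape Turing machines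
-- over {0, 1, blank} with two-way infinite tapes.

Symbol : Set
Symbol = Maybe Bool

pattern blank = nothing

data Move : Set where
  leftwards stay rightwards : Move

record Tape : Set where
  constructor tape
  field
    left  : List Symbol      -- nearest cell first; blank beyond the end
    head  : Symbol
    right : List Symbol      -- nearest cell first; blank beyond the end

write : Symbol → Tape → Tape
write a (tape ls _ rs) = tape ls a rs

move : Move → Tape → Tape
move leftwards  (tape []       a rs)       = tape [] blank (a ∷ rs)
move leftwards  (tape (l ∷ ls) a rs)       = tape ls l (a ∷ rs)
move stay       t                          = t
move rightwards (tape ls       a [])       = tape (a ∷ ls) blank []
move rightwards (tape ls       a (r ∷ rs)) = tape (a ∷ ls) r rs

load : Str → Tape
load []      = tape [] blank []
load (b ∷ w) = tape [] (just b) (List.map just w)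

-- The non-blank symbols from left to right, wherever the head is.

inscription : Tape → Str
inscription (tape ls a rs) = List.catMaybes (List.reverse ls List.++ a ∷ rs)

-- l input tapes, one output tape and some work tapes.  The transition
-- function returns nothing in order to halt.

record Machine (l : ℕ) : Set where
  field
    states : ℕ
    work   : ℕ
  State : Set
  State = Fin (suc states)
  tapes : ℕ
  tapes = l ℕ.+ suc work
  field
    δ : State → Vec Symbol tapes → Maybe (State × Vec (Symbol × Move) tapes)

module _ {l : ℕ} (M : Machine l) where
  open Machine M

  Config : Set
  Config = State × Vec Tape tapes

  initial : Vec Str l → Config
  initial x = zero , Vec.map load x Vec.++ Vec.replicate (suc work) (load [])

  output : Config → Str
  output (_ , ts) = inscription (Vec.lookup ts (l ↑ʳ zero))

  step : Config → Maybe Config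
  step (s , ts) with δ s (Vec.map Tape.head ts)
  ... | nothing           = nothing
  ... | just (s′ , acts)  = just (s′ , Vec.zipWith (λ (a , m) t → move m (write a t)) acts ts)

  data _⇓[_]_ : Config → ℕ → Str → Set where
    halt : ∀ {c} → step c ≡ nothing → c ⇓[ 0 ] output c
    next : ∀ {c c′ n y} → step c ≡ just c′ → c′ ⇓[ n ] y → c ⇓[ suc n ] y

size : ∀ {l} → Vec Str l → ℕ
size x = Vec.sum (Vec.map length x)

PolynomialTime : ∀ {l} → (Vec Str l → Str) → Set
PolynomialTime {l} f = Σ (Machine l) λ M → ∃₂ λ c k → ∀ x →
  ∃ λ n → (n ℕ.≤ c ℕ.* size x ℕ.^ k ℕ.+ c) × (_⇓[_]_ M (initial M x) n (f x))

Functional : ℕ → ℕ → Set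
Functional k l = Vec (Str → Str) k → Vec Str l → Str

Class : (ℓ : Level) → Set (lsuc ℓ)
Class ℓ = ∀ {k l} → Functional k l → Set ℓ

Ap : Functional 1 1
Ap (f ∷ []) (x ∷ []) = f x

-- Schemes hold pointwise, so BFF X is closed under extensional equality.

data BFF {ℓ} (X : ∀ {k l} → Functional k l → Set ℓ) : ∀ {k l} → Functional k l → Set ℓ where

  base : ∀ {k l} {F : Functional k l} → X F → BFF X F

  polytime : ∀ {l} {f : Vec Str l → Str} → PolynomialTime f → BFF X {0} {l} (λ _ → f)

  ap : BFF X Ap

  composition : ∀ {k l m} {F : Functional k m} {H : Functional k l} {G : Fin l → Functional k m} →
    BFF X H → (∀ i → BFF X (G i)) →
    (∀ f x → F f x ≡ H f (Vec.tabulate λ i → G i f x)) →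
    BFF X F

  expansion : ∀ {k k′ l l′} {F : Functional (k ℕ.+ k′) (l ℕ.+ l′)} {G : Functional k l} →
    BFF X G →
    (∀ f g x y → F (f Vec.++ g) (x Vec.++ y) ≡ G f x) →
    BFF X F

  limited-recursion : ∀ {k l} {F : Functional k (l ℕ.+ 1)} {G : Functional k l}
    {H : Functional k (l ℕ.+ 2)} {K : Functional k (l ℕ.+ 1)} →
    BFF X G → BFF X H → BFF X K →
    (∀ f x → F f (x Vec.++ [] ∷ []) ≡ G f x) →
    (∀ f x w b → F f (x Vec.++ (w ∷ʳ b) ∷ []) ≡ H f (x Vec.++ (w ∷ʳ b) ∷ F f (x Vec.++ w ∷ []) ∷ [])) →
    (∀ f x w → length (F f (x Vec.++ w ∷ [])) ℕ.≤ length (K f (x Vec.++ w ∷ []))) →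
    BFF X F

IsResourceBound : ∀ {ℓ} → Class ℓ → Set ℓ
IsResourceBound Δ = ∀ {k l} {F : Functional k l} → BFF Δ F ⇔ Δ F

_isWithin2^-_of_ : ℚ → ℕ → ℝ → Set
q isWithin2^- r of x = ∣ fromℚ q -ᵣ x ∣ᵣ ≤ᵣ fromℚ (2^- r)

record Computation {D : Set} (f : D → ℝ) : Set where
  field
    approx   : ℕ → D → ℚ
    accurate : ∀ r x → approx r x isWithin2^- r of f x

open Computation public

Canonical : ∀ {D : Set} {f : D → ℝ} → Computation f → Set
Canonical c = ∀ r x → ∃ λ (z : ℤ) → approx c r x ≡ (z ℚ./ 1) ℚ.* (2^- r)

Computable : ∀ {ℓ} → Class ℓ → (Str → ℝ) → Set ℓ
Computable Δ f = Σ (Computation f) λ c → Σ (Functional 0 2) λ F → Δ F ×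
  (∀ r w → Denotes (F [] (unary r ∷ w ∷ [])) (approx c r w))

Computableℕ : ∀ {ℓ} → Class ℓ → (ℕ → ℕ) → Set ℓ
Computableℕ Δ l = Σ (Functional 0 1) λ F → Δ F × (∀ n → F [] (unary n ∷ []) ≡ unary (l n))

-- A computation as a function input: the two arguments are paired into one string.

_Presents_ : {f : Str → ℝ} → (Str → Str) → Computation f → Set
g Presents c = ∀ r w → Denotes (g ⟨ unary r , w ⟩) (approx c r w)

Cantor : Set
Cantor = ℕ → Bool

_↾_ : Cantor → ℕ → Str
A ↾ n = List.applyUpTo A n

Cylinder : Str → Pred Cantor 0ℓ
Cylinder w A = A ↾ length w ≡ w

record ProbabilityMeasure : Set where
  field
    prob     : Str → ℝ
    nonneg   : ∀ w → 0ᵣ ≤ᵣ prob w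
    ≤1       : ∀ w → prob w ≤ᵣ 1ᵣ
    total    : prob [] ≈ᵣ 1ᵣ
    additive : ∀ w → prob w ≈ᵣ prob (w ∷ʳ false) +ᵣ prob (w ∷ʳ true)

open ProbabilityMeasure public using (prob)

record Martingale (ν : ProbabilityMeasure) : Set where
  field
    capital : Str → ℝ
    nonneg  : ∀ w → 0ᵣ ≤ᵣ capital w
    fair    : ∀ w → capital w *ᵣ prob ν w ≈ᵣ
                    capital (w ∷ʳ false) *ᵣ prob ν (w ∷ʳ false) +ᵣ capital (w ∷ʳ true) *ᵣ prob ν (w ∷ʳ true)

open Martingale public using (capital)

_≈ₘ_ : ∀ {ν} → Martingale ν → Martingale ν → Set
d ≈ₘ d′ = ∀ w → capital d w ≈ᵣ capital d′ w

𝟏 : ∀ {ν} → Martingale ν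
Martingale.capital 𝟏 _ = 1ᵣ
Martingale.nonneg  𝟏 _ n = ℚₚ.≤-trans (ℚₚ.nonNegative⁻¹ 1ℚ)
  (subst (ℚ._≤ 1ℚ ℚ.+ ((2^- n) ℚ.+ (2^- n))) (ℚₚ.+-identityʳ 1ℚ)
    (ℚₚ.+-monoʳ-≤ 1ℚ (ℚₚ.+-mono-≤ (ℚₚ.<⇒≤ (2^-pos n)) (ℚₚ.<⇒≤ (2^-pos n)))))
Martingale.fair (𝟏 {ν}) w =
  ≈ᵣ-trans (1ᵣ *ᵣ p) p (1ᵣ *ᵣ p₀ +ᵣ 1ᵣ *ᵣ p₁) (*ᵣ-identityˡ p)
    (≈ᵣ-trans p (p₀ +ᵣ p₁) (1ᵣ *ᵣ p₀ +ᵣ 1ᵣ *ᵣ p₁) (ProbabilityMeasure.additive ν w)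
      (+ᵣ-cong p₀ (1ᵣ *ᵣ p₀) p₁ (1ᵣ *ᵣ p₁)
        (≈ᵣ-sym (1ᵣ *ᵣ p₀) p₀ (*ᵣ-identityˡ p₀))
        (≈ᵣ-sym (1ᵣ *ᵣ p₁) p₁ (*ᵣ-identityˡ p₁))))
  where
  p p₀ p₁ : ℝ
  p  = prob ν w
  p₀ = prob ν (w ∷ʳ false)
  p₁ = prob ν (w ∷ʳ true)

S¹[_] : ∀ {ν} → Martingale ν → Pred Cantor 0ℓ
S¹[ d ] A = ∃ λ n → 1ᵣ ≤ᵣ capital d (A ↾ n)

record IsΔProbabilityMeasure {ℓ} (Δ : Class ℓ) (ν : ProbabilityMeasure) : Set ℓ where
  field
    computable   : Computable Δ (prob ν)
    l            : ℕ → ℕ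
    l-computable : Computableℕ Δ l
    zero-or-≥    : ∀ w → (prob ν w ≈ᵣ 0ᵣ) ⊎ (fromℚ (2^- l (length w)) ≤ᵣ prob ν w)

record SplittingOperator (ν : ProbabilityMeasure) (X⁺ X⁻ : Pred Cantor 0ℓ) : Set where
  field
    disjoint : Empty (X⁺ ∩ X⁻)
    Φ        : ℕ → Martingale ν → Martingale ν × Martingale ν

  Φ⁺ : ℕ → Martingale ν → Martingale ν
  Φ⁺ r d = proj₁ (Φ r d)
  Φ⁻ : ℕ → Martingale ν → Martingale ν
  Φ⁻ r d = proj₂ (Φ r d)

  field
    -- Φ is a function of martingales as real-valued functions.
    Φ⁺-cong : ∀ r {d d′} → d ≈ₘ d′ → Φ⁺ r d ≈ₘ Φ⁺ r d′
    Φ⁻-cong : ∀ r {d d′} → d ≈ₘ d′ → Φ⁻ r d ≈ₘ Φ⁻ r d′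
    covers⁺ : ∀ r d → X⁺ ∩ S¹[ d ] ⊆ S¹[ Φ⁺ r d ]
    covers⁻ : ∀ r d → X⁻ ∩ S¹[ d ] ⊆ S¹[ Φ⁻ r d ]
    cost    : ∀ r d → capital (Φ⁺ r d) [] +ᵣ capital (Φ⁻ r d) [] ≤ᵣ capital d [] +ᵣ fromℚ (2^- r)

OperatorComputable : ∀ {ℓ} → Class ℓ → {ν : ProbabilityMeasure} → (ℕ → Martingale ν → Martingale ν) → Set ℓ
OperatorComputable Δ {ν} Ψ = Σ (Functional 1 3) λ F → Δ F ×
  (∀ (d : Martingale ν) (c : Computation (capital d)) → Canonical c → ∀ g → g Presents c →
   ∀ i r w → ∃ λ q → Denotes (F (g ∷ []) (unary i ∷ unary r ∷ w ∷ [])) q × q isWithin2^- r of capital (Ψ i d) w)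

record Measurement {ℓ} (Δ : Class ℓ) (ν : ProbabilityMeasure) (X : Pred Cantor 0ℓ) : Set ℓ where
  field
    splitting : SplittingOperator ν X (∁ X)
  open SplittingOperator splitting public
  field
    -- One functional for each output martingale.
    Φ⁺-computable : OperatorComputable Δ Φ⁺
    Φ⁻-computable : OperatorComputable Δ Φ⁻

Measurable : ∀ {ℓ} → Class ℓ → ProbabilityMeasure → Pred Cantor 0ℓ → Set ℓ
Measurable Δ ν X = Measurement Δ ν X

-- v is the infimum that defines the measure of X, for whichever measurement of X.

MeasureIs : ∀ {ℓ} → Class ℓ → ProbabilityMeasure → Pred Cantor 0ℓ → ℝ → Set ℓ
MeasureIs Δ ν X v = ∀ (Φ : Measurement Δ ν X) →
  IsInfimum (λ r → capital (Measurement.Φ⁺ Φ r 𝟏) []) v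

{-# OPTIONS --safe #-}

-- Given a martingale d, stop it softly along w: with ε = 2^-i, a fraction of the
-- capital is frozen that grows from 0 to 1 as the capital grows from 1 − ε to 1.
-- Started with an additional ε, the stopped martingale reaches 1 below every
-- point at which d has reached 1, it depends on d continuously, and it costs
-- d(λ) + ε.  Cutting it off outside and inside C_w and averaging back along w
-- gives the two output martingales, whose initial capitals add up to d(λ) + ε.
-- Off the proper prefixes of w their values are 0 or a + b d(v), with a and b
-- computed from d along w; at the prefixes only finitely many values of ν enter,
-- and the divisors are positive constants.  So a fixed formula, evaluated in
-- fractions of binary numerals, computes them.
--
-- For the value of the measure: if a martingale d has d(λ) < ν(C_w), then
-- v ↦ ν(C_v ∩ C_w) − d(v) ν(v) is additive and positive at λ, hence positive
-- along some A, which then lies in C_w while d stays below 1 on it.  The same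
-- argument with the complement bounds Φ⁻ from below and so Φ⁺ from above.

module Submission where

open import Defs
open import Algebra.Bundles using (CommutativeRing)
import Algebra.Solver.Ring
import Algebra.Solver.Ring.AlmostCommutativeRing as ACR
open import Algebra.Structures using (IsCommutativeRing)
open import Data.Bool.Base using (Bool; true; false; not; if_then_else_; _∧_; _xor_; _∨_)
import Data.Bool.Properties as Boolₚ
open import Data.Empty using (⊥-elim)
open import Data.Fin.Base using (Fin; zero; suc; _↑ʳ_)
import Data.Integer.Base as ℤ
import Data.Integer.Properties as ℤₚ
open import Data.List.Base as List using (List; []; _∷_; _∷ʳ_; length; _++_; reverse; replicate)
import Data.List.Properties as Listₚ
open import Data.Maybe.Base as Maybe using (Maybe; just; nothing)
open import Data.Nat.Base as ℕ using (ℕ; zero; suc)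
import Data.Nat.Properties as ℕₚ
import Data.Nat.Solver as ℕSolver
open import Data.Product.Base using (_×_; _,_; proj₁; proj₂; ∃; ∃₂)
open import Data.Rational.Base as ℚ using (ℚ; 0ℚ; 1ℚ; ½)
import Data.Rational.Properties as ℚₚ
import Data.Rational.Solver as ℚSolver
import Data.Rational.Unnormalised.Base as ℚᵘ
import Data.Rational.Unnormalised.Properties as ℚᵘₚ
open import Data.Sign.Base as Sign using (Sign)
open import Data.Sum.Base as Sum using (_⊎_; inj₁; inj₂; [_,_]′)
open import Data.Vec.Base as Vec using (Vec; []; _∷_)
import Data.Vec.Properties as Vecₚ
open import Function.Bundles using (Equivalence)
open import Level using (0ℓ)
open import Relation.Binary.PropositionalEquality as ≡
  using (_≡_; refl; cong; cong₂; subst; subst₂)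
open import Relation.Nullary using (¬_; Dec; yes; no)
open import Relation.Nullary.Decidable.Core using (dec⇒maybe)
open import Relation.Unary using (Pred; ∁)

-- Rational estimates

-- Stopping is needed because `d` may reach 1 at a proper prefix of `w` and lose that capital before
-- `w`: cutting off `d` itself would fail on sequences that `d` has already covered. A hard stop
-- would have to decide whether a real number is at least 1, while the operator sees `d` only
-- through approximations. Softly stopped, the martingale along `w` always has the form `a + b d`,
-- with `a` frozen and `b` the fraction still invested. Nothing is frozen at a capital below
-- `1 − ε`, so `a + b (1 − ε) ≥ 1` is invariant; the initial ε makes it true at the start. From `w`
-- on, and off its path, following `a + b d` suffices, as the value 1 has to be reached only once.
-- Fairness is weighted by `ν`, so a null cylinder leaves the averaged value free, and 0 can serve
-- as the reciprocal there. Everything is built from sums, products, truncated differences and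
-- reciprocals of nonnegative reals; hence the arithmetic runs on natural numerals without signs.
-- Since reals cannot be compared, positivity carries a rational witness `2^- m`, and paths are
-- chosen by comparing rational terms. The relation `≤` is stable under double negation, which
-- permits the argument by contradiction.

module Q = ℚSolver.+-*-Solver

infix 4 _≤_ _≈_

-- `_≤ᵣ_` unfolds to a statement about terms, from which unification cannot recover the two reals.
-- The record keeps them as parameters, so they can stay implicit.
record _≤_ (x y : ℝ) : Set where
  constructor ≤-wrap
  field ≤-unwrap : x ≤ᵣ y
open _≤_ public

record _≈_ (x y : ℝ) : Set where
  constructor ≈-wrap
  field ≈-unwrap : x ≈ᵣ y
open _≈_ public

0≤2^- : ∀ n → 0ℚ ℚ.≤ 2^- n
0≤2^- n = ℚₚ.<⇒≤ (2^-pos n)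

0≤2^+ : ∀ n → 0ℚ ℚ.≤ 2^+ n
0≤2^+ n = ℚₚ.≤-trans (ℚₚ.nonNegative⁻¹ 1ℚ) (2^+≥1 n)

nonNeg-* : ∀ {p q} → 0ℚ ℚ.≤ p → 0ℚ ℚ.≤ q → 0ℚ ℚ.≤ p ℚ.* q
nonNeg-* {p} {q} 0≤p 0≤q = subst (ℚ._≤ p ℚ.* q) (ℚₚ.*-zeroʳ p)
  (ℚₚ.*-monoˡ-≤-nonNeg p {{ℚ.nonNegative 0≤p}} 0≤q)

nonNeg-+ : ∀ {p q} → 0ℚ ℚ.≤ p → 0ℚ ℚ.≤ q → 0ℚ ℚ.≤ p ℚ.+ q
nonNeg-+ {p} {q} 0≤p 0≤q = subst (ℚ._≤ p ℚ.+ q) (ℚₚ.+-identityˡ 0ℚ) (ℚₚ.+-mono-≤ 0≤p 0≤q)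

≤-by-diff : ∀ {p q} d → 0ℚ ℚ.≤ d → q ≡ p ℚ.+ d → p ℚ.≤ q
≤-by-diff {p} d 0≤d refl = subst (ℚ._≤ p ℚ.+ d) (ℚₚ.+-identityʳ p) (ℚₚ.+-monoʳ-≤ p 0≤d)

diff-nonNeg : ∀ {p q} → p ℚ.≤ q → 0ℚ ℚ.≤ q ℚ.- p
diff-nonNeg {p} {q} p≤q = subst (ℚ._≤ q ℚ.- p) (ℚₚ.+-inverseʳ p) (ℚₚ.+-monoˡ-≤ (ℚ.- p) p≤q)

p≤∣p∣ : ∀ p → p ℚ.≤ ℚ.∣ p ∣
p≤∣p∣ p with ℚₚ.≤-total 0ℚ p
... | inj₁ 0≤p = ℚₚ.≤-reflexive (≡.sym (ℚₚ.0≤p⇒∣p∣≡p 0≤p))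
... | inj₂ p≤0 = ℚₚ.≤-trans p≤0 (ℚₚ.0≤∣p∣ p)

∣-∣≤⇒≤+ : ∀ p q {e} → ℚ.∣ p ℚ.- q ∣ ℚ.≤ e → p ℚ.≤ q ℚ.+ e
∣-∣≤⇒≤+ p q {e} h = subst (ℚ._≤ q ℚ.+ e) (Q.solve 2 (λ p q → q Q.:+ (p Q.:- q) Q.:= p) refl p q)
  (ℚₚ.+-monoʳ-≤ q (ℚₚ.≤-trans (p≤∣p∣ (p ℚ.- q)) h))

≤+⇒∣-∣≤ : ∀ p q {e} → p ℚ.≤ q ℚ.+ e → q ℚ.≤ p ℚ.+ e → ℚ.∣ p ℚ.- q ∣ ℚ.≤ e
≤+⇒∣-∣≤ p q {e} h h′ with ℚₚ.∣p∣≡p∨∣p∣≡-p (p ℚ.- q)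
... | inj₁ eq = subst₂ ℚ._≤_ (≡.sym eq)
  (Q.solve 2 (λ q e → q Q.:+ e Q.:- q Q.:= e) refl q e) (ℚₚ.+-monoˡ-≤ (ℚ.- q) h)
... | inj₂ eq = subst₂ ℚ._≤_
  (≡.trans (Q.solve 2 (λ p q → q Q.:- p Q.:= Q.:- (p Q.:- q)) refl p q) (≡.sym eq))
  (Q.solve 2 (λ q e → q Q.:+ e Q.:- q Q.:= e) refl p e) (ℚₚ.+-monoˡ-≤ (ℚ.- p) h′)

≤2^+ : ∀ p → ∃ λ k → p ℚ.≤ 2^+ k
≤2^+ p = ℤ.∣ ℚ.↥ p ∣ , ℚₚ.≤-trans (p≤∣p∣ p)
  (ℚₚ.≤-trans (∣p∣≤fromℕ∣↥p∣ p) (ℚₚ.<⇒≤ (fromℕ<2^+ ℤ.∣ ℚ.↥ p ∣)))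

*2^-≤ : ∀ C k m → C ℚ.≤ 2^+ k → C ℚ.* (2^- (k ℕ.+ m)) ℚ.≤ 2^- m
*2^-≤ C k m C≤ = ℚₚ.≤-trans
  (ℚₚ.*-monoʳ-≤-nonNeg (2^- (k ℕ.+ m)) {{ℚ.nonNegative (0≤2^- (k ℕ.+ m))}} C≤)
  (ℚₚ.≤-reflexive (≡.trans (cong ((2^+ k) ℚ.*_) (2^-+ k m))
    (≡.trans (≡.sym (ℚₚ.*-assoc (2^+ k) (2^- k) (2^- m)))
      (≡.trans (cong (ℚ._* (2^- m)) (2^+*2^- k)) (ℚₚ.*-identityˡ (2^- m))))))

≤-limit-* : ∀ p q C → (∀ k → p ℚ.≤ q ℚ.+ C ℚ.* (2^- k)) → p ℚ.≤ q
≤-limit-* p q C h with ≤2^+ C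
... | K , C≤ = ≤-limit p q λ m → ℚₚ.≤-trans (h (K ℕ.+ m)) (ℚₚ.+-monoʳ-≤ q (*2^-≤ C K m C≤))

-- Geometric convergence: every operation on ℝ is computed termwise up to it.

infix 3 _⟶_

record _⟶_ (s : ℕ → ℚ) (x : ℝ) : Set where
  constructor converges
  field
    rate  : ℚ
    close : ∀ n → ℚ.∣ s n ℚ.- seq x n ∣ ℚ.≤ rate ℚ.* (2^- n)
open _⟶_

rate≥0 : ∀ {s x} (l : s ⟶ x) → 0ℚ ℚ.≤ rate l
rate≥0 {s} {x} l = subst (0ℚ ℚ.≤_) (ℚₚ.*-identityʳ (rate l))
  (ℚₚ.≤-trans (ℚₚ.0≤∣p∣ (s 0 ℚ.- seq x 0)) (close l 0))

-- Sums and products read their arguments at later indices. By regularity a shift costs at most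
-- `2 · 2^-n`, whatever `k` is.
close-shifted : ∀ {s x} (l : s ⟶ x) k n →
  ℚ.∣ s n ℚ.- seq x (k ℕ.+ n) ∣ ℚ.≤ (rate l ℚ.+ 2ℚ) ℚ.* (2^- n)
close-shifted {s} {x} l k n = ℚₚ.≤-trans (triangle (s n) (seq x n) (seq x (k ℕ.+ n)))
  (ℚₚ.≤-trans (ℚₚ.+-mono-≤ (close l n) (ℚₚ.≤-trans (regular x n (k ℕ.+ n))
    (ℚₚ.+-monoʳ-≤ (2^- n) (subst (λ j → 2^- j ℚ.≤ 2^- n) (ℕₚ.+-comm n k) (2^-anti k n)))))
   (ℚₚ.≤-reflexive (Q.solve 2 (λ c e → c Q.:* e Q.:+ (e Q.:+ e) Q.:= (c Q.:+ Q.con 2ℚ) Q.:* e)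
      refl (rate l) (2^- n))))

⟶-seq : ∀ x → seq x ⟶ x
⟶-seq x = converges 0ℚ λ n → ℚₚ.≤-reflexive
  (≡.trans (cong ℚ.∣_∣ (ℚₚ.+-inverseʳ (seq x n))) (≡.sym (ℚₚ.*-zeroˡ (2^- n))))

⟶-resp : ∀ {s t x} → (∀ n → s n ≡ t n) → s ⟶ x → t ⟶ x
⟶-resp {x = x} eq (converges C c) = converges C λ n →
  subst (λ z → ℚ.∣ z ℚ.- seq x n ∣ ℚ.≤ C ℚ.* (2^- n)) (eq n) (c n)

infixl 6 _+ₛ_
infixl 7 _*ₛ_

-- The operations are opaque so that unification compares their arguments
-- instead of unfolding them.

opaque
  _+ₛ_ _*ₛ_ : (ℕ → ℚ) → (ℕ → ℚ) → ℕ → ℚ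
  (s +ₛ t) n = s n ℚ.+ t n
  (s *ₛ t) n = s n ℚ.* t n

  -ₛ_ ∣_∣ₛ : (ℕ → ℚ) → ℕ → ℚ
  (-ₛ s) n = ℚ.- s n
  ∣ s ∣ₛ n = ℚ.∣ s n ∣

  constₛ : ℚ → ℕ → ℚ
  constₛ q _ = q

infixl 6 _+_ _-_
infixl 7 _*_
infix  8 -_

opaque
  _+_ _*_ : ℝ → ℝ → ℝ
  _+_ = _+ᵣ_
  _*_ = _*ᵣ_

  -_ ∣_∣ : ℝ → ℝ
  -_ = -ᵣ_
  ∣_∣ = ∣_∣ᵣ

  ι : ℚ → ℝ
  ι = fromℚ

_-_ : ℝ → ℝ → ℝ
x - y = x + - y

opaque
  unfolding _+_

  seq-+ : ∀ x y n → seq (x + y) n ≡ seq x (suc n) ℚ.+ seq y (suc n)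
  seq-+ x y n = refl

  seq-neg : ∀ x n → seq (- x) n ≡ ℚ.- seq x n
  seq-neg x n = refl

  seq-ι : ∀ q n → seq (ι q) n ≡ q
  seq-ι q n = refl

opaque
  unfolding _+ₛ_ _+_

  ⟶-const : ∀ q → constₛ q ⟶ ι q
  ⟶-const q = converges 0ℚ (close (⟶-seq (fromℚ q)))

  ⟶-+ : ∀ {s t x y} → s ⟶ x → t ⟶ y → s +ₛ t ⟶ x + y
  ⟶-+ {s} {t} {x} {y} l l′ = converges ((rate l ℚ.+ 2ℚ) ℚ.+ (rate l′ ℚ.+ 2ℚ)) λ n →
    ℚₚ.≤-trans (dist-+ (s n) (t n) (seq x (suc n)) (seq y (suc n)))
      (subst (ℚ.∣ s n ℚ.- seq x (suc n) ∣ ℚ.+ ℚ.∣ t n ℚ.- seq y (suc n) ∣ ℚ.≤_) (≡.sym (ℚₚ.*-distribʳ-+ (2^- n) (rate l ℚ.+ 2ℚ) (rate l′ ℚ.+ 2ℚ)))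
        (ℚₚ.+-mono-≤ (close-shifted l 1 n) (close-shifted l′ 1 n)))

  ⟶-neg : ∀ {s x} → s ⟶ x → -ₛ s ⟶ - x
  ⟶-neg {s} {x} l = converges (rate l) λ n → subst (ℚ._≤ rate l ℚ.* (2^- n))
    (≡.trans (dist-sym (s n) (seq x n))
      (cong ℚ.∣_∣ (Q.solve 2 (λ p q → q Q.:- p Q.:= (Q.:- p) Q.:- (Q.:- q)) refl (s n) (seq x n))))
    (close l n)

  ⟶-abs : ∀ {s x} → s ⟶ x → ∣ s ∣ₛ ⟶ ∣ x ∣
  ⟶-abs {s} {x} l = converges (rate l) λ n →
    ℚₚ.≤-trans (∣∣p∣-∣q∣∣≤∣p-q∣ (s n) (seq x n)) (close l n)

  ⟶-* : ∀ {s t x y} → s ⟶ x → t ⟶ y → s *ₛ t ⟶ x * y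
  ⟶-* {s} {t} {x} {y} l l′ = converges (B ℚ.* ((rate l′ ℚ.+ 2ℚ) ℚ.+ (rate l ℚ.+ 2ℚ))) λ n →
    ℚₚ.≤-trans (dist-* B (s n) (t n) (seq x (k ℕ.+ n)) (seq y (k ℕ.+ n)) (s≤B n) (y≤B (k ℕ.+ n)))
      (subst (B ℚ.* (ℚ.∣ t n ℚ.- seq y (k ℕ.+ n) ∣ ℚ.+ ℚ.∣ s n ℚ.- seq x (k ℕ.+ n) ∣) ℚ.≤_)
        (≡.trans (cong (B ℚ.*_) (≡.sym (ℚₚ.*-distribʳ-+ (2^- n) (rate l′ ℚ.+ 2ℚ) (rate l ℚ.+ 2ℚ))))
          (≡.sym (ℚₚ.*-assoc B ((rate l′ ℚ.+ 2ℚ) ℚ.+ (rate l ℚ.+ 2ℚ)) (2^- n))))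
        (ℚₚ.*-monoˡ-≤-nonNeg B {{ℚ.nonNegative 0≤B}}
          (ℚₚ.+-mono-≤ (close-shifted l′ k n) (close-shifted l k n))))
    where
    k : ℕ
    k = shift x y
    X Y B : ℚ
    X = 2^+ magnitude x
    Y = 2^+ magnitude y
    -- `dist-*` needs one bound for both `s n` and the terms of `y`: the former stay within `rate l`
    -- of the terms of `x`.
    B = (rate l ℚ.+ X) ℚ.+ Y
    0≤B : 0ℚ ℚ.≤ B
    0≤B = nonNeg-+ (nonNeg-+ (rate≥0 l) (0≤2^+ (magnitude x))) (0≤2^+ (magnitude y))
    s≤B : ∀ n → ℚ.∣ s n ∣ ℚ.≤ B
    s≤B n = ℚₚ.≤-trans (∣p∣≤∣p-q∣+∣q∣ (s n) (seq x n))
      (ℚₚ.≤-trans (ℚₚ.+-mono-≤ (ℚₚ.≤-trans (close l n)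
          (subst (rate l ℚ.* (2^- n) ℚ.≤_) (ℚₚ.*-identityʳ (rate l))
            (ℚₚ.*-monoˡ-≤-nonNeg (rate l) {{ℚ.nonNegative (rate≥0 l)}} (2^-≤1 n))))
          (magnitude-bound x n))
        (≤-by-diff Y (0≤2^+ (magnitude y)) refl))
    y≤B : ∀ n → ℚ.∣ seq y n ∣ ℚ.≤ B
    y≤B n = ℚₚ.≤-trans (magnitude-bound y n)
      (≤-by-diff (rate l ℚ.+ X) (nonNeg-+ (rate≥0 l) (0≤2^+ (magnitude x))) (ℚₚ.+-comm (rate l ℚ.+ X) Y))

-- The constant in front of the error does not matter: passing from index `n` to `k` and back costs
-- what `≤ᵣ` allows at `n` plus a multiple of `2^-k`, which vanishes as `k` grows.
≤-from-bound : ∀ {x y} C → (∀ n → seq x n ℚ.≤ seq y n ℚ.+ C ℚ.* (2^- n)) → x ≤ y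
≤-from-bound {x} {y} C h = ≤-wrap λ n → ≤-limit-* _ _ (C ℚ.+ 2ℚ) λ k → ℚₚ.≤-trans
  (∣-∣≤⇒≤+ (seq x n) (seq x k) (regular x n k))
  (ℚₚ.≤-trans (ℚₚ.+-monoˡ-≤ ((2^- n) ℚ.+ (2^- k)) (ℚₚ.≤-trans (h k)
     (ℚₚ.+-monoˡ-≤ (C ℚ.* (2^- k)) (∣-∣≤⇒≤+ (seq y k) (seq y n) (regular y k n)))))
   (ℚₚ.≤-reflexive (Q.solve 4 (λ y c e f →
       y Q.:+ (f Q.:+ e) Q.:+ c Q.:* f Q.:+ (e Q.:+ f) Q.:= (y Q.:+ (e Q.:+ e)) Q.:+ (c Q.:+ Q.con 2ℚ) Q.:* f)
     refl (seq y n) C (2^- n) (2^- k))))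

⟶-≤-bound : ∀ {s t x y} C → s ⟶ x → t ⟶ y → (∀ n → s n ℚ.≤ t n ℚ.+ C ℚ.* (2^- n)) → x ≤ y
⟶-≤-bound {s} {t} {x} {y} C l l′ h = ≤-from-bound (rate l ℚ.+ (C ℚ.+ rate l′)) λ n →
  ℚₚ.≤-trans (∣-∣≤⇒≤+ (seq x n) (s n) (subst (ℚ._≤ rate l ℚ.* (2^- n)) (dist-sym (s n) (seq x n)) (close l n)))
    (ℚₚ.≤-trans (ℚₚ.+-monoˡ-≤ (rate l ℚ.* (2^- n))
        (ℚₚ.≤-trans (h n) (ℚₚ.+-monoˡ-≤ (C ℚ.* (2^- n)) (∣-∣≤⇒≤+ (t n) (seq y n) (close l′ n)))))
      (ℚₚ.≤-reflexive (Q.solve 5 (λ y r c r′ e →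
         y Q.:+ r′ Q.:* e Q.:+ c Q.:* e Q.:+ r Q.:* e Q.:= y Q.:+ (r Q.:+ (c Q.:+ r′)) Q.:* e)
         refl (seq y n) (rate l) C (rate l′) (2^- n))))

⟶-≤ : ∀ {s t x y} → s ⟶ x → t ⟶ y → (∀ n → s n ℚ.≤ t n) → x ≤ y
⟶-≤ {t = t} l l′ h = ⟶-≤-bound 0ℚ l l′ λ n → subst (_ ℚ.≤_)
  (Q.solve 2 (λ t e → t Q.:= t Q.:+ Q.con 0ℚ Q.:* e) refl (t n) (2^- n)) (h n)

≤-antisym : ∀ {x y} → x ≤ y → y ≤ x → x ≈ y
≤-antisym {x} {y} (≤-wrap h) (≤-wrap h′) = ≈-wrap λ n → ≤+⇒∣-∣≤ (seq x n) (seq y n) (h n) (h′ n)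

⟶-unique : ∀ {s x y} → s ⟶ x → s ⟶ y → x ≈ y
⟶-unique l l′ = ≤-antisym (⟶-≤ l l′ (λ _ → ℚₚ.≤-refl)) (⟶-≤ l′ l (λ _ → ℚₚ.≤-refl))

2*2^- : ∀ n → (2^- n) ℚ.+ (2^- n) ≡ 2ℚ ℚ.* (2^- n)
2*2^- n = Q.solve 1 (λ e → e Q.:+ e Q.:= Q.con 2ℚ Q.:* e) refl (2^- n)

≤⇒bound : ∀ {x y} → x ≤ y → ∀ n → seq x n ℚ.≤ seq y n ℚ.+ 2ℚ ℚ.* (2^- n)
≤⇒bound {x} {y} (≤-wrap h) n = subst (λ z → seq x n ℚ.≤ seq y n ℚ.+ z) (2*2^- n) (h n)

≈⇒⟶ : ∀ {x y} → x ≈ y → seq x ⟶ y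
≈⇒⟶ {x} {y} (≈-wrap h) = converges 2ℚ λ n → subst (ℚ.∣ seq x n ℚ.- seq y n ∣ ℚ.≤_) (2*2^- n) (h n)

≈⇒≤ : ∀ {x y} → x ≈ y → x ≤ y
≈⇒≤ {x} h = ⟶-≤ (⟶-seq x) (≈⇒⟶ h) (λ _ → ℚₚ.≤-refl)

≈-refl : ∀ {x} → x ≈ x
≈-refl {x} = ⟶-unique (⟶-seq x) (⟶-seq x)

≈-reflexive : ∀ {x y} → x ≡ y → x ≈ y
≈-reflexive refl = ≈-refl

≈-sym : ∀ {x y} → x ≈ y → y ≈ x
≈-sym {x} {y} (≈-wrap h) = ≈-wrap (≈ᵣ-sym x y h)

≈-trans : ∀ {x y z} → x ≈ y → y ≈ z → x ≈ z
≈-trans {x} {y} {z} (≈-wrap h) (≈-wrap h′) = ≈-wrap (≈ᵣ-trans x y z h h′)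

≤-trans : ∀ {x y z} → x ≤ y → y ≤ z → x ≤ z
≤-trans {x} {y} {z} h h′ = ≤-from-bound (2ℚ ℚ.+ 2ℚ) λ n → ℚₚ.≤-trans (≤⇒bound h n)
  (ℚₚ.≤-trans (ℚₚ.+-monoˡ-≤ _ (≤⇒bound h′ n))
    (ℚₚ.≤-reflexive (Q.solve 2 (λ z e → z Q.:+ Q.con 2ℚ Q.:* e Q.:+ Q.con 2ℚ Q.:* e
      Q.:= z Q.:+ Q.con (2ℚ ℚ.+ 2ℚ) Q.:* e) refl (seq z n) (2^- n))))

-- The ordered ring of real numbers

opaque
  unfolding _+ₛ_

  -- Reduces the ring laws to those of ℚ: both sides are limits of rational sequences that agree
  -- term by term, although their regular representatives use different indices.
  ⟶-≡ : ∀ {s t x y} → s ⟶ x → t ⟶ y → (∀ n → s n ≡ t n) → x ≈ y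
  ⟶-≡ l l′ eq = ⟶-unique (⟶-resp eq l) l′

  +-cong : ∀ {x y u v} → x ≈ y → u ≈ v → x + u ≈ y + v
  +-cong {x} {y} {u} {v} h h′ = ⟶-≡ (⟶-+ (⟶-seq x) (⟶-seq u)) (⟶-+ (≈⇒⟶ h) (≈⇒⟶ h′)) (λ _ → refl)

  *-cong : ∀ {x y u v} → x ≈ y → u ≈ v → x * u ≈ y * v
  *-cong {x} {y} {u} {v} h h′ = ⟶-≡ (⟶-* (⟶-seq x) (⟶-seq u)) (⟶-* (≈⇒⟶ h) (≈⇒⟶ h′)) (λ _ → refl)

  -‿cong : ∀ {x y} → x ≈ y → - x ≈ - y
  -‿cong {x} h = ⟶-≡ (⟶-neg (⟶-seq x)) (⟶-neg (≈⇒⟶ h)) (λ _ → refl)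

  +-assoc : ∀ x y z → (x + y) + z ≈ x + (y + z)
  +-assoc x y z = ⟶-≡ (⟶-+ (⟶-+ (⟶-seq x) (⟶-seq y)) (⟶-seq z))
    (⟶-+ (⟶-seq x) (⟶-+ (⟶-seq y) (⟶-seq z))) (λ n → ℚₚ.+-assoc (seq x n) (seq y n) (seq z n))

  +-comm : ∀ x y → x + y ≈ y + x
  +-comm x y = ⟶-≡ (⟶-+ (⟶-seq x) (⟶-seq y)) (⟶-+ (⟶-seq y) (⟶-seq x)) (λ n → ℚₚ.+-comm (seq x n) (seq y n))

  +-identityˡ : ∀ x → ι 0ℚ + x ≈ x
  +-identityˡ x = ⟶-≡ (⟶-+ (⟶-const 0ℚ) (⟶-seq x)) (⟶-seq x) (λ n → ℚₚ.+-identityˡ (seq x n))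

  +-inverseˡ : ∀ x → (- x) + x ≈ ι 0ℚ
  +-inverseˡ x = ⟶-≡ (⟶-+ (⟶-neg (⟶-seq x)) (⟶-seq x)) (⟶-const 0ℚ) (λ n → ℚₚ.+-inverseˡ (seq x n))

  *-assoc : ∀ x y z → (x * y) * z ≈ x * (y * z)
  *-assoc x y z = ⟶-≡ (⟶-* (⟶-* (⟶-seq x) (⟶-seq y)) (⟶-seq z))
    (⟶-* (⟶-seq x) (⟶-* (⟶-seq y) (⟶-seq z))) (λ n → ℚₚ.*-assoc (seq x n) (seq y n) (seq z n))

  *-comm : ∀ x y → x * y ≈ y * x
  *-comm x y = ⟶-≡ (⟶-* (⟶-seq x) (⟶-seq y)) (⟶-* (⟶-seq y) (⟶-seq x)) (λ n → ℚₚ.*-comm (seq x n) (seq y n))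

  *-identityˡ : ∀ x → ι 1ℚ * x ≈ x
  *-identityˡ x = ⟶-≡ (⟶-* (⟶-const 1ℚ) (⟶-seq x)) (⟶-seq x) (λ n → ℚₚ.*-identityˡ (seq x n))

  *-distribˡ-+ : ∀ x y z → x * (y + z) ≈ x * y + x * z
  *-distribˡ-+ x y z = ⟶-≡ (⟶-* (⟶-seq x) (⟶-+ (⟶-seq y) (⟶-seq z)))
    (⟶-+ (⟶-* (⟶-seq x) (⟶-seq y)) (⟶-* (⟶-seq x) (⟶-seq z)))
    (λ n → ℚₚ.*-distribˡ-+ (seq x n) (seq y n) (seq z n))

+-identityʳ : ∀ x → x + ι 0ℚ ≈ x
+-identityʳ x = ≈-trans (+-comm x (ι 0ℚ)) (+-identityˡ x)

+-inverseʳ : ∀ x → x - x ≈ ι 0ℚ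
+-inverseʳ x = ≈-trans (+-comm x (- x)) (+-inverseˡ x)

*-identityʳ : ∀ x → x * ι 1ℚ ≈ x
*-identityʳ x = ≈-trans (*-comm x (ι 1ℚ)) (*-identityˡ x)

*-distribʳ-+ : ∀ x y z → (y + z) * x ≈ y * x + z * x
*-distribʳ-+ x y z = ≈-trans (*-comm (y + z) x)
  (≈-trans (*-distribˡ-+ x y z) (+-cong (*-comm x y) (*-comm x z)))

isCommutativeRing : IsCommutativeRing _≈_ _+_ _*_ -_ (ι 0ℚ) (ι 1ℚ)
isCommutativeRing = record
  { isRing = record
    { +-isAbelianGroup = record
      { isGroup = record
        { isMonoid = record
          { isSemigroup = record
            { isMagma = record
              { isEquivalence = record { refl = ≈-refl ; sym = ≈-sym ; trans = ≈-trans }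
              ; ∙-cong = +-cong }
            ; assoc = +-assoc }
          ; identity = +-identityˡ , +-identityʳ }
        ; inverse = +-inverseˡ , +-inverseʳ
        ; ⁻¹-cong = -‿cong }
      ; comm = +-comm }
    ; *-cong = *-cong
    ; *-assoc = *-assoc
    ; *-identity = *-identityˡ , *-identityʳ
    ; distrib = *-distribˡ-+ , *-distribʳ-+ }
  ; *-comm = *-comm }

ℝ-commutativeRing : CommutativeRing 0ℓ 0ℓ
ℝ-commutativeRing = record { isCommutativeRing = isCommutativeRing }

open CommutativeRing ℝ-commutativeRing public
  using (+-congˡ; +-congʳ; *-congˡ; *-congʳ; zeroˡ; zeroʳ)

opaque
  unfolding _+ₛ_

  ι-+ : ∀ p q → ι (p ℚ.+ q) ≈ ι p + ι q
  ι-+ p q = ⟶-≡ (⟶-const (p ℚ.+ q)) (⟶-+ (⟶-const p) (⟶-const q)) (λ _ → refl)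
  ι-* : ∀ p q → ι (p ℚ.* q) ≈ ι p * ι q
  ι-* p q = ⟶-≡ (⟶-const (p ℚ.* q)) (⟶-* (⟶-const p) (⟶-const q)) (λ _ → refl)
  ι-neg : ∀ p → ι (ℚ.- p) ≈ - ι p
  ι-neg p = ⟶-≡ (⟶-const (ℚ.- p)) (⟶-neg (⟶-const p)) (λ _ → refl)

-- A ring solver compares coefficients, and equality of reals cannot be decided; coefficients are
-- therefore rationals.
ι-morphism : CommutativeRing.rawRing ℚₚ.+-*-commutativeRing ACR.-Raw-AlmostCommutative⟶
             ACR.fromCommutativeRing ℝ-commutativeRing
ι-morphism = record
  { ⟦_⟧    = ι
  ; +-homo = ι-+
  ; *-homo = ι-*
  ; -‿homo = ι-neg
  ; 0-homo = ≈-refl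
  ; 1-homo = ≈-refl
  }

ι-weaklyDecidable : ∀ p q → Maybe (ι p ≈ ι q)
ι-weaklyDecidable p q = Maybe.map (λ { refl → ≈-refl }) (dec⇒maybe (p ℚₚ.≟ q))

module S = Algebra.Solver.Ring (CommutativeRing.rawRing ℚₚ.+-*-commutativeRing)
  (ACR.fromCommutativeRing ℝ-commutativeRing) ι-morphism ι-weaklyDecidable

≤-refl : ∀ {x} → x ≤ x
≤-refl = ≈⇒≤ ≈-refl

0r 1r : ℝ
0r = ι 0ℚ
1r = ι 1ℚ

seq≤ι : ∀ x n → ι (seq x n ℚ.- (2^- n)) ≤ x
seq≤ι x n = ⟶-≤-bound 1ℚ (⟶-const q) (⟶-seq x) λ k → subst (ℚ._≤ seq x k ℚ.+ 1ℚ ℚ.* (2^- k)) (const≡ k)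
  (subst (seq x n ℚ.- (2^- n) ℚ.≤_)
    (Q.solve 3 (λ y e f → y Q.:+ (e Q.:+ f) Q.:- e Q.:= y Q.:+ Q.con 1ℚ Q.:* f) refl (seq x k) (2^- n) (2^- k))
    (ℚₚ.+-monoˡ-≤ (ℚ.- (2^- n)) (∣-∣≤⇒≤+ (seq x n) (seq x k) (regular x n k))))
  where
  q : ℚ
  q = seq x n ℚ.- (2^- n)
  opaque
    unfolding constₛ
    const≡ : ∀ k → q ≡ constₛ q k
    const≡ k = refl

opaque
  unfolding _+ₛ_

  ι-mono : ∀ {p q} → p ℚ.≤ q → ι p ≤ ι q
  ι-mono {p} {q} h = ⟶-≤ (⟶-const p) (⟶-const q) (λ _ → h)

  +-mono : ∀ {x y u v} → x ≤ y → u ≤ v → x + u ≤ y + v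
  +-mono {x} {y} {u} {v} h h′ = ⟶-≤-bound (2ℚ ℚ.+ 2ℚ) (⟶-+ (⟶-seq x) (⟶-seq u)) (⟶-+ (⟶-seq y) (⟶-seq v))
    λ n → subst (seq x n ℚ.+ seq u n ℚ.≤_)
      (Q.solve 3 (λ y v e → (y Q.:+ Q.con 2ℚ Q.:* e) Q.:+ (v Q.:+ Q.con 2ℚ Q.:* e)
        Q.:= y Q.:+ v Q.:+ Q.con (2ℚ ℚ.+ 2ℚ) Q.:* e) refl (seq y n) (seq v n) (2^- n))
      (ℚₚ.+-mono-≤ (≤⇒bound h n) (≤⇒bound h′ n))

  -- The rational gap between x and y at a failing index survives in the limit.
  ≤-stable : ∀ {x y} → (∀ m → ¬ (ι (2^- m) ≤ x - y)) → x ≤ y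
  ≤-stable {x} {y} h = ≤-wrap λ n → at n (seq x n ℚₚ.≤? seq y n ℚ.+ ((2^- n) ℚ.+ (2^- n)))
    where
    at : ∀ n → Dec (seq x n ℚ.≤ seq y n ℚ.+ ((2^- n) ℚ.+ (2^- n))) →
         seq x n ℚ.≤ seq y n ℚ.+ ((2^- n) ℚ.+ (2^- n))
    at n (yes p) = p
    at n (no ¬p) with archimedean (seq x n ℚ.- (seq y n ℚ.+ ((2^- n) ℚ.+ (2^- n))))
      (subst (ℚ._< seq x n ℚ.- (seq y n ℚ.+ ((2^- n) ℚ.+ (2^- n)))) (ℚₚ.+-inverseʳ (seq y n ℚ.+ ((2^- n) ℚ.+ (2^- n))))
        (ℚₚ.+-monoˡ-< (ℚ.- (seq y n ℚ.+ ((2^- n) ℚ.+ (2^- n)))) (ℚₚ.≰⇒> ¬p)))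
    ... | m , m< = ⊥-elim (h m (⟶-≤-bound 2ℚ (⟶-const (2^- m)) (⟶-+ (⟶-seq x) (⟶-neg (⟶-seq y)))
      λ k → ≤-by-diff
        ((seq x n ℚ.- (seq y n ℚ.+ ((2^- n) ℚ.+ (2^- n))) ℚ.- (2^- m))
          ℚ.+ (seq x k ℚ.+ ((2^- n) ℚ.+ (2^- k)) ℚ.- seq x n)
          ℚ.+ (seq y n ℚ.+ ((2^- k) ℚ.+ (2^- n)) ℚ.- seq y k))
        (nonNeg-+ (nonNeg-+ (diff-nonNeg (ℚₚ.<⇒≤ m<))
            (diff-nonNeg (∣-∣≤⇒≤+ (seq x n) (seq x k) (regular x n k))))
          (diff-nonNeg (∣-∣≤⇒≤+ (seq y k) (seq y n) (regular y k n))))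
        (Q.solve 7 (λ xn yn xk yk e f g →
            xk Q.:- yk Q.:+ Q.con 2ℚ Q.:* f Q.:=
            g Q.:+ ((xn Q.:- (yn Q.:+ (e Q.:+ e)) Q.:- g) Q.:+ (xk Q.:+ (e Q.:+ f) Q.:- xn)
              Q.:+ (yn Q.:+ (f Q.:+ e) Q.:- yk)))
          refl (seq x n) (seq y n) (seq x k) (seq y k) (2^- n) (2^- k) (2^- m))))

  ∣+∣≤ : ∀ x y → ∣ x + y ∣ ≤ ∣ x ∣ + ∣ y ∣
  ∣+∣≤ x y = ⟶-≤ (⟶-abs (⟶-+ (⟶-seq x) (⟶-seq y))) (⟶-+ (⟶-abs (⟶-seq x)) (⟶-abs (⟶-seq y)))
    (λ n → ℚₚ.∣p+q∣≤∣p∣+∣q∣ (seq x n) (seq y n))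

  ∣*∣≈ : ∀ x y → ∣ x * y ∣ ≈ ∣ x ∣ * ∣ y ∣
  ∣*∣≈ x y = ⟶-≡ (⟶-abs (⟶-* (⟶-seq x) (⟶-seq y))) (⟶-* (⟶-abs (⟶-seq x)) (⟶-abs (⟶-seq y)))
    (λ n → ℚₚ.∣p*q∣≡∣p∣*∣q∣ (seq x n) (seq y n))

  ∣-∣-sym : ∀ x → ∣ - x ∣ ≈ ∣ x ∣
  ∣-∣-sym x = ⟶-≡ (⟶-abs (⟶-neg (⟶-seq x))) (⟶-abs (⟶-seq x)) (λ n → ℚₚ.∣-p∣≡∣p∣ (seq x n))

  ∣∣-cong : ∀ {x y} → x ≈ y → ∣ x ∣ ≈ ∣ y ∣
  ∣∣-cong {x} h = ⟶-≡ (⟶-abs (⟶-seq x)) (⟶-abs (≈⇒⟶ h)) (λ _ → refl)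

  x≤∣x∣ : ∀ x → x ≤ ∣ x ∣
  x≤∣x∣ x = ⟶-≤ (⟶-seq x) (⟶-abs (⟶-seq x)) (λ n → p≤∣p∣ (seq x n))

  0≤∣x∣ : ∀ x → 0r ≤ ∣ x ∣
  0≤∣x∣ x = ⟶-≤ (⟶-const 0ℚ) (⟶-abs (⟶-seq x)) (λ n → ℚₚ.0≤∣p∣ (seq x n))

  ∣∣-lub : ∀ {x e} → x ≤ e → - x ≤ e → ∣ x ∣ ≤ e
  ∣∣-lub {x} {e} h h′ = ⟶-≤-bound 2ℚ (⟶-abs (⟶-seq x)) (⟶-seq e) λ n → at n (ℚₚ.∣p∣≡p∨∣p∣≡-p (seq x n))
    where
    neg-bound : ∀ n → ℚ.- seq x n ℚ.≤ seq e n ℚ.+ 2ℚ ℚ.* (2^- n)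
    neg-bound n = subst (ℚ._≤ seq e n ℚ.+ 2ℚ ℚ.* (2^- n)) (seq-neg x n) (≤⇒bound h′ n)
    at : ∀ n → ℚ.∣ seq x n ∣ ≡ seq x n ⊎ ℚ.∣ seq x n ∣ ≡ ℚ.- seq x n → ℚ.∣ seq x n ∣ ℚ.≤ seq e n ℚ.+ 2ℚ ℚ.* (2^- n)
    at n (inj₁ eq) = subst (ℚ._≤ seq e n ℚ.+ 2ℚ ℚ.* (2^- n)) (≡.sym eq) (≤⇒bound h n)
    at n (inj₂ eq) = subst (ℚ._≤ seq e n ℚ.+ 2ℚ ℚ.* (2^- n)) (≡.sym eq) (neg-bound n)

-- The positive part, and sums and products of inequalities

⊔-lipschitz : ∀ h p q → ℚ.∣ (h ℚ.⊔ p) ℚ.- (h ℚ.⊔ q) ∣ ℚ.≤ ℚ.∣ p ℚ.- q ∣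
⊔-lipschitz h p q = ≤+⇒∣-∣≤ (h ℚ.⊔ p) (h ℚ.⊔ q) (half p q)
  (subst (λ z → h ℚ.⊔ q ℚ.≤ h ℚ.⊔ p ℚ.+ z) (dist-sym q p) (half q p))
  where
  half : ∀ p q → h ℚ.⊔ p ℚ.≤ h ℚ.⊔ q ℚ.+ ℚ.∣ p ℚ.- q ∣
  half p q = ℚₚ.⊔-lub
    (ℚₚ.≤-trans (ℚₚ.p≤p⊔q h q) (≤-by-diff ℚ.∣ p ℚ.- q ∣ (ℚₚ.0≤∣p∣ (p ℚ.- q)) refl))
    (ℚₚ.≤-trans (∣-∣≤⇒≤+ p q ℚₚ.≤-refl) (ℚₚ.+-monoˡ-≤ ℚ.∣ p ℚ.- q ∣ (ℚₚ.p≤q⊔p h q)))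

opaque
  unfolding _+ₛ_

  pos : ℝ → ℝ
  seq (pos x) n = 0ℚ ℚ.⊔ seq x n
  regular (pos x) m n = ℚₚ.≤-trans (⊔-lipschitz 0ℚ (seq x m) (seq x n)) (regular x m n)

  posₛ : (ℕ → ℚ) → ℕ → ℚ
  posₛ s n = 0ℚ ℚ.⊔ s n

  ⟶-pos : ∀ {s x} → s ⟶ x → posₛ s ⟶ pos x
  ⟶-pos {s} {x} (converges C c) = converges C λ n → ℚₚ.≤-trans (⊔-lipschitz 0ℚ (s n) (seq x n)) (c n)

  ι-pos : ∀ q → pos (ι q) ≈ ι (0ℚ ℚ.⊔ q)
  ι-pos q = ⟶-≡ (⟶-pos (⟶-const q)) (⟶-const (0ℚ ℚ.⊔ q)) (λ _ → refl)

  pos-cong : ∀ {x y} → x ≈ y → pos x ≈ pos y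
  pos-cong {x} h = ⟶-≡ (⟶-pos (⟶-seq x)) (⟶-pos (≈⇒⟶ h)) (λ _ → refl)

  0≤pos : ∀ x → 0r ≤ pos x
  0≤pos x = ⟶-≤ (⟶-const 0ℚ) (⟶-pos (⟶-seq x)) (λ n → ℚₚ.p≤p⊔q 0ℚ (seq x n))

  x≤pos : ∀ x → x ≤ pos x
  x≤pos x = ⟶-≤ (⟶-seq x) (⟶-pos (⟶-seq x)) (λ n → ℚₚ.p≤q⊔p 0ℚ (seq x n))

  pos-lub : ∀ {x y} → 0r ≤ y → x ≤ y → pos x ≤ y
  pos-lub {x} {y} h h′ = ⟶-≤-bound 2ℚ (⟶-pos (⟶-seq x)) (⟶-seq y)
    λ n → ℚₚ.⊔-lub (subst (ℚ._≤ seq y n ℚ.+ 2ℚ ℚ.* (2^- n)) (seq-ι 0ℚ n) (≤⇒bound h n)) (≤⇒bound h′ n)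

  -- Termwise, either the first factor vanishes or both are nonnegative. This stands in for a case
  -- distinction on the sign of a real number.
  0≤pos*x : ∀ x → 0r ≤ pos x * x
  0≤pos*x x = ⟶-≤ (⟶-const 0ℚ) (⟶-* (⟶-pos (⟶-seq x)) (⟶-seq x)) λ n → at (seq x n) (ℚₚ.≤-total 0ℚ (seq x n))
    where
    at : ∀ q → 0ℚ ℚ.≤ q ⊎ q ℚ.≤ 0ℚ → 0ℚ ℚ.≤ (0ℚ ℚ.⊔ q) ℚ.* q
    at q (inj₁ 0≤q) = nonNeg-* (ℚₚ.p≤p⊔q 0ℚ q) 0≤q
    at q (inj₂ q≤0) = ℚₚ.≤-reflexive (≡.sym (≡.trans (cong (ℚ._* q) (ℚₚ.p≥q⇒p⊔q≡p q≤0)) (ℚₚ.*-zeroˡ q)))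

  ∣pos-pos∣≤ : ∀ x y → ∣ pos x - pos y ∣ ≤ ∣ x - y ∣
  ∣pos-pos∣≤ x y = ⟶-≤ (⟶-abs (⟶-+ (⟶-pos (⟶-seq x)) (⟶-neg (⟶-pos (⟶-seq y)))))
    (⟶-abs (⟶-+ (⟶-seq x) (⟶-neg (⟶-seq y)))) (λ n → ⊔-lipschitz 0ℚ (seq x n) (seq y n))

  -- A nonnegative real may have negative terms, but `pos` has none, so the product is nonnegative
  -- termwise. `*-nonneg` follows because `pos` fixes nonnegative reals.
  0≤pos*pos : ∀ x y → 0r ≤ pos x * pos y
  0≤pos*pos x y = ⟶-≤ (⟶-const 0ℚ) (⟶-* (⟶-pos (⟶-seq x)) (⟶-pos (⟶-seq y)))
    λ n → nonNeg-* (ℚₚ.p≤p⊔q 0ℚ (seq x n)) (ℚₚ.p≤p⊔q 0ℚ (seq y n))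

  neg-mono : ∀ {x y} → x ≤ y → - y ≤ - x
  neg-mono {x} {y} h = ⟶-≤-bound 2ℚ (⟶-neg (⟶-seq y)) (⟶-neg (⟶-seq x)) λ n →
    subst₂ ℚ._≤_
      (Q.solve 2 (λ x y → x Q.:+ (Q.:- x Q.:- y) Q.:= Q.:- y) refl (seq x n) (seq y n))
      (Q.solve 3 (λ x y e → (y Q.:+ e) Q.:+ (Q.:- x Q.:- y) Q.:= Q.:- x Q.:+ e) refl (seq x n) (seq y n) (2ℚ ℚ.* (2^- n)))
      (ℚₚ.+-monoˡ-≤ (ℚ.- seq x n ℚ.- seq y n) (≤⇒bound h n))

  sum-gap : ∀ {x y} m → ι (2^- m) ≤ x + y →
    ∀ n → 2^- m ℚ.≤ (seq x (suc n) ℚ.+ seq y (suc n)) ℚ.+ 2ℚ ℚ.* (2^- n)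
  sum-gap {x} {y} m h n = subst₂ (λ p q → p ℚ.≤ q ℚ.+ 2ℚ ℚ.* (2^- n)) (seq-ι (2^- m) n) (seq-+ x y n) (≤⇒bound h n)

pos-of-nonneg : ∀ {x} → 0r ≤ x → pos x ≈ x
pos-of-nonneg h = ≤-antisym (pos-lub h ≤-refl) (x≤pos _)

pos-of-nonpos : ∀ {x} → x ≤ 0r → pos x ≈ 0r
pos-of-nonpos h = ≤-antisym (pos-lub ≤-refl h) (0≤pos _)

*-nonneg : ∀ {x y} → 0r ≤ x → 0r ≤ y → 0r ≤ x * y
*-nonneg h h′ = ≤-trans (0≤pos*pos _ _) (≈⇒≤ (*-cong (pos-of-nonneg h) (pos-of-nonneg h′)))

+-nonneg : ∀ {x y} → 0r ≤ x → 0r ≤ y → 0r ≤ x + y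
+-nonneg h h′ = ≤-trans (≈⇒≤ (≈-sym (+-identityˡ 0r))) (+-mono h h′)

sub-nonneg : ∀ {x y} → x ≤ y → 0r ≤ y - x
sub-nonneg {x} h = ≤-trans (≈⇒≤ (≈-sym (+-inverseʳ x))) (+-mono h ≤-refl)

≤-from-sub : ∀ {x y} d → 0r ≤ d → y ≈ x + d → x ≤ y
≤-from-sub {x} d h e = ≤-trans (≈⇒≤ (≈-sym (+-identityʳ x))) (≤-trans (+-mono ≤-refl h) (≈⇒≤ (≈-sym e)))

*-monoˡ : ∀ {z x y} → 0r ≤ z → x ≤ y → z * x ≤ z * y
*-monoˡ {z} {x} {y} h h′ = ≤-from-sub (z * (y - x)) (*-nonneg h (sub-nonneg h′))
  (S.solve 3 (λ x y z → z S.:* y S.:= z S.:* x S.:+ z S.:* (y S.:- x)) ≈-refl x y z)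

*-monoʳ : ∀ {z x y} → 0r ≤ z → x ≤ y → x * z ≤ y * z
*-monoʳ h h′ = ≤-trans (≈⇒≤ (*-comm _ _)) (≤-trans (*-monoˡ h h′) (≈⇒≤ (*-comm _ _)))

*-mono : ∀ {x y u v} → 0r ≤ u → 0r ≤ y → x ≤ y → u ≤ v → x * u ≤ y * v
*-mono 0≤u 0≤y h h′ = ≤-trans (*-monoʳ 0≤u h) (*-monoˡ 0≤y h′)

+-monoˡ : ∀ {z x y} → x ≤ y → z + x ≤ z + y
+-monoˡ = +-mono ≤-refl

+-monoʳ : ∀ {z x y} → x ≤ y → x + z ≤ y + z
+-monoʳ h = +-mono h ≤-refl

0≤ι2^- : ∀ n → 0r ≤ ι (2^- n)
0≤ι2^- n = ι-mono (0≤2^- n)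

0≤1 : 0r ≤ 1r
0≤1 = 0≤ι2^- 0

ι2^-≰0 : ∀ {n} → ¬ (ι (2^- n) ≤ 0r)
ι2^-≰0 {n} h = ℚₚ.<-irrefl refl (ℚₚ.<-≤-trans (2^-pos n) (≤-limit-* (2^- n) 0ℚ 2ℚ λ k →
  subst₂ (λ p q → p ℚ.≤ q ℚ.+ 2ℚ ℚ.* (2^- k)) (seq-ι (2^- n) k) (seq-ι 0ℚ k) (≤⇒bound h k)))

≤-limitᵣ : ∀ {x y} → (∀ k → x ≤ y + ι (2^- k)) → x ≤ y
≤-limitᵣ {x} {y} h = ≤-stable λ m 2^-m≤ → ι2^-≰0 {suc m} (
  ≤-trans (≈⇒≤ (S.solve 1 (λ a → a S.:= (a S.:+ a) S.:- a) ≈-refl (ι (2^- suc m))))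
  (≤-trans (+-monoʳ (≤-trans (≈⇒≤ (≈-sym (ι-+ _ _))) (≤-trans (ι-mono (ℚₚ.≤-reflexive (halves m)))
     (≤-trans 2^-m≤ (+-monoʳ (h (suc m)))))))
   (≈⇒≤ (S.solve 2 (λ y a → ((y S.:+ a) S.:- y) S.:- a S.:= S.con 0ℚ) ≈-refl y (ι (2^- suc m))))))

-- The choice is made by one rational comparison at index `3 + m`. There the two terms add up to at
-- least `2^-(1+m)`, so one of them is at least `2^-(2+m)`, which is twice the error of the index;
-- half of it survives.
positive-summand : ∀ {x y} m → ι (2^- m) ≤ x + y → (∃ λ k → ι (2^- k) ≤ x) ⊎ (∃ λ k → ι (2^- k) ≤ y)
positive-summand {x} {y} m h = go (ℚₚ.≤-total (seq x N) (2^- (2 ℕ.+ m)))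
  where
  N : ℕ
  N = 3 ℕ.+ m
  sum≥ : 2^- suc m ℚ.≤ seq x N ℚ.+ seq y N
  sum≥ = ≤-by-diff _ (diff-nonNeg (sum-gap {x} {y} m h (2 ℕ.+ m)))
    (Q.solve 3 (λ x y e → x Q.:+ y Q.:= Q.con ½ Q.:* e Q.:+ ((x Q.:+ y) Q.:+ Q.con 2ℚ Q.:* (Q.con ½ Q.:* (Q.con ½ Q.:* e)) Q.:- e))
       refl (seq x N) (seq y N) (2^- m))
  from-index : ∀ z → 2^- (2 ℕ.+ m) ℚ.≤ seq z N → ∃ λ k → ι (2^- k) ≤ z
  from-index z h = N , ≤-trans (ι-mono (subst (ℚ._≤ seq z N ℚ.- (2^- N))
    (Q.solve 1 (λ e → e Q.:- Q.con ½ Q.:* e Q.:= Q.con ½ Q.:* e) refl (2^- (2 ℕ.+ m)))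
    (ℚₚ.+-monoˡ-≤ (ℚ.- (2^- N)) h))) (seq≤ι z N)
  go : _ → _
  go (inj₂ h′) = inj₁ (from-index x h′)
  go (inj₁ h′) = inj₂ (from-index y (subst₂ ℚ._≤_
    (Q.solve 1 (λ e → e Q.:- Q.con ½ Q.:* e Q.:= Q.con ½ Q.:* e) refl (2^- suc m))
    (Q.solve 2 (λ x y → (x Q.:+ y) Q.:- x Q.:= y) refl (seq x N) (seq y N))
    (ℚₚ.≤-trans (ℚₚ.+-monoʳ-≤ (2^- suc m) (ℚₚ.neg-antimono-≤ h′)) (ℚₚ.+-monoˡ-≤ (ℚ.- seq x N) sum≥))))

-- Reciprocals

opaque
  unfolding ι

  fold-≤ : ∀ {q x} → fromℚ q ≤ᵣ x → ι q ≤ x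
  fold-≤ = ≤-wrap

  unfold-≤ : ∀ {q x} → ι q ≤ x → fromℚ q ≤ᵣ x
  unfold-≤ = ≤-unwrap

  fold-≈ : ∀ {q x} → x ≈ᵣ fromℚ q → x ≈ ι q
  fold-≈ = ≈-wrap

opaque
  unfolding _+_

  fold-+ : ∀ {x y z} → x ≈ᵣ y +ᵣ z → x ≈ y + z
  fold-+ = ≈-wrap

  fold-fair : ∀ {x p y q z r} → x *ᵣ p ≈ᵣ y *ᵣ q +ᵣ z *ᵣ r → x * p ≈ y * q + z * r
  fold-fair = ≈-wrap

  unfold-fair : ∀ {x p y q z r} → x * p ≈ y * q + z * r → x *ᵣ p ≈ᵣ y *ᵣ q +ᵣ z *ᵣ r
  unfold-fair = ≈-unwrap

  fold-cost : ∀ {x y z q} → x +ᵣ y ≤ᵣ z +ᵣ fromℚ q → x + y ≤ z + ι q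
  fold-cost = ≤-wrap

  unfold-cost : ∀ {x y z q} → x + y ≤ z + ι q → x +ᵣ y ≤ᵣ z +ᵣ fromℚ q
  unfold-cost = ≤-unwrap

  fold-within : ∀ {q r x} → q isWithin2^- r of x → ∣ ι q - x ∣ ≤ ι (2^- r)
  fold-within = ≤-wrap

  unfold-within : ∀ {q r x} → ∣ ι q - x ∣ ≤ ι (2^- r) → q isWithin2^- r of x
  unfold-within = ≤-unwrap

module _ (p : ℚ) (0<p : 0ℚ ℚ.< p) where
  private instance
    p-positive : ℚ.Positive p
    p-positive = ℚ.positive 0<p

  opaque
    recip : ℚ
    recip = (ℚ.1/ p) {{ℚₚ.pos⇒nonZero p}}

    *-recip : p ℚ.* recip ≡ 1ℚ
    *-recip = ℚₚ.*-inverseʳ p {{ℚₚ.pos⇒nonZero p}}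

    0≤recip : 0ℚ ℚ.≤ recip
    0≤recip = ℚₚ.<⇒≤ (ℚₚ.positive⁻¹ recip {{ℚₚ.1/pos⇒pos p}})

recip-bound : ∀ l {p} (h : 0ℚ ℚ.< p) → 2^- l ℚ.≤ p → recip p h ℚ.≤ 2^+ l
recip-bound l {p} h l≤ = subst₂ ℚ._≤_
  (≡.trans (Q.solve 3 (λ a b c → a Q.:* (b Q.:* c) Q.:= (a Q.:* b) Q.:* c) refl (2^+ l) (2^- l) (recip p h))
    (≡.trans (cong (ℚ._* recip p h) (2^+*2^- l)) (ℚₚ.*-identityˡ (recip p h))))
  (≡.trans (cong ((2^+ l) ℚ.*_) (*-recip p h)) (ℚₚ.*-identityʳ (2^+ l)))
  (ℚₚ.*-monoˡ-≤-nonNeg (2^+ l) {{ℚ.nonNegative (0≤2^+ l)}}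
    (ℚₚ.*-monoʳ-≤-nonNeg (recip p h) {{ℚ.nonNegative (0≤recip p h)}} l≤))

recip-diff : ∀ {a b} (0<a : 0ℚ ℚ.< a) (0<b : 0ℚ ℚ.< b) →
  recip a 0<a ℚ.- recip b 0<b ≡ recip a 0<a ℚ.* recip b 0<b ℚ.* (b ℚ.- a)
recip-diff {a} {b} 0<a 0<b = ≡.sym (≡.trans
  (Q.solve 4 (λ a b r s → r Q.:* s Q.:* (b Q.:- a) Q.:= r Q.:* (b Q.:* s) Q.:- s Q.:* (a Q.:* r)) refl a b r s)
  (≡.trans (cong₂ (λ u v → r ℚ.* u ℚ.- s ℚ.* v) (*-recip b 0<b) (*-recip a 0<a))
    (cong₂ ℚ._-_ (ℚₚ.*-identityʳ r) (ℚₚ.*-identityʳ s))))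
  where
  r s : ℚ
  r = recip a 0<a
  s = recip b 0<b

clamp-positive : ∀ l q → 0ℚ ℚ.< (2^- l) ℚ.⊔ q
clamp-positive l q = ℚₚ.<-≤-trans (2^-pos l) (ℚₚ.p≤p⊔q (2^- l) q)

-- inv l x is the reciprocal of x only if 2^- l ≤ x.

module _ (l : ℕ) (x : ℝ) where

  -- Clamping makes every term invertible. Above `2^-l` the reciprocal has Lipschitz constant
  -- `2^l · 2^l`, hence the index `l + (l + n)`.
  clamped : ℕ → ℚ
  clamped n = (2^- l) ℚ.⊔ seq x (l ℕ.+ (l ℕ.+ n))

  recip-clamped : ℕ → ℚ
  recip-clamped n = recip (clamped n) (clamp-positive l (seq x (l ℕ.+ (l ℕ.+ n))))

  recip-clamped≤ : ∀ n → recip-clamped n ℚ.≤ 2^+ l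
  recip-clamped≤ n = recip-bound l _ (ℚₚ.p≤p⊔q (2^- l) _)

  0≤recip-clamped : ∀ n → 0ℚ ℚ.≤ recip-clamped n
  0≤recip-clamped n = 0≤recip (clamped n) (clamp-positive l (seq x (l ℕ.+ (l ℕ.+ n))))

  recip-regular : ∀ m n → ℚ.∣ recip-clamped m ℚ.- recip-clamped n ∣ ℚ.≤ (2^- m) ℚ.+ (2^- n)
  recip-regular m n = ℚₚ.≤-trans (ℚₚ.≤-reflexive abs-diff) (ℚₚ.≤-trans
    (ℚₚ.≤-trans
      (ℚₚ.*-monoˡ-≤-nonNeg (r ℚ.* s) {{ℚ.nonNegative 0≤rs}} diff≤)
      (ℚₚ.*-monoʳ-≤-nonNeg D {{ℚ.nonNegative 0≤D}} rs≤))
    (ℚₚ.≤-reflexive scale))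
    where
    r s D : ℚ
    r = recip-clamped m
    s = recip-clamped n
    D = (2^- (l ℕ.+ (l ℕ.+ n))) ℚ.+ (2^- (l ℕ.+ (l ℕ.+ m)))
    0≤D : 0ℚ ℚ.≤ D
    0≤D = nonNeg-+ (0≤2^- (l ℕ.+ (l ℕ.+ n))) (0≤2^- (l ℕ.+ (l ℕ.+ m)))
    0≤rs : 0ℚ ℚ.≤ r ℚ.* s
    0≤rs = nonNeg-* (0≤recip-clamped m) (0≤recip-clamped n)
    rs≤ : r ℚ.* s ℚ.≤ (2^+ l) ℚ.* (2^+ l)
    rs≤ = ℚₚ.≤-trans
      (ℚₚ.*-monoˡ-≤-nonNeg r {{ℚ.nonNegative (0≤recip-clamped m)}} (recip-clamped≤ n))
      (ℚₚ.*-monoʳ-≤-nonNeg (2^+ l) {{ℚ.nonNegative (0≤2^+ l)}} (recip-clamped≤ m))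
    diff≤ : ℚ.∣ clamped n ℚ.- clamped m ∣ ℚ.≤ D
    diff≤ = ℚₚ.≤-trans
      (⊔-lipschitz (2^- l) (seq x (l ℕ.+ (l ℕ.+ n))) (seq x (l ℕ.+ (l ℕ.+ m))))
      (regular x (l ℕ.+ (l ℕ.+ n)) (l ℕ.+ (l ℕ.+ m)))
    abs-diff : ℚ.∣ r ℚ.- s ∣ ≡ r ℚ.* s ℚ.* ℚ.∣ clamped n ℚ.- clamped m ∣
    abs-diff = ≡.trans (cong ℚ.∣_∣ (recip-diff (clamp-positive l _) (clamp-positive l _)))
      (≡.trans (ℚₚ.∣p*q∣≡∣p∣*∣q∣ (r ℚ.* s) (clamped n ℚ.- clamped m))
        (cong (ℚ._* ℚ.∣ clamped n ℚ.- clamped m ∣) (ℚₚ.0≤p⇒∣p∣≡p 0≤rs)))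
    scale : (2^+ l) ℚ.* (2^+ l) ℚ.* D ≡ (2^- m) ℚ.+ (2^- n)
    scale = ≡.trans
      (cong₂ (λ u v → (2^+ l) ℚ.* (2^+ l) ℚ.* (u ℚ.+ v))
        (≡.trans (2^-+ l (l ℕ.+ n)) (cong ((2^- l) ℚ.*_) (2^-+ l n)))
        (≡.trans (2^-+ l (l ℕ.+ m)) (cong ((2^- l) ℚ.*_) (2^-+ l m))))
      (≡.trans
        (Q.solve 4 (λ p h e f → p Q.:* p Q.:* (h Q.:* (h Q.:* e) Q.:+ h Q.:* (h Q.:* f)) Q.:=
            (p Q.:* h) Q.:* (p Q.:* h) Q.:* (f Q.:+ e)) refl (2^+ l) (2^- l) (2^- n) (2^- m))
        (≡.trans (cong (λ u → u ℚ.* u ℚ.* ((2^- m) ℚ.+ (2^- n))) (2^+*2^- l))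
          (ℚₚ.*-identityˡ ((2^- m) ℚ.+ (2^- n)))))

  opaque
    inv : ℝ
    seq inv = recip-clamped
    regular inv = recip-regular

  opaque
    unfolding inv _+ₛ_

    0≤inv : 0r ≤ inv
    0≤inv = ⟶-≤ (⟶-const 0ℚ) (⟶-seq inv) 0≤recip-clamped

    *-inv : ι (2^- l) ≤ x → x * inv ≈ 1r
    *-inv h = ≤-antisym
      (⟶-≤-bound ((2ℚ ℚ.+ 2ℚ) ℚ.* (2^+ l)) (⟶-* (⟶-seq x) (⟶-seq inv)) (⟶-const 1ℚ) λ n → ∣-∣≤⇒≤+ _ 1ℚ (near n))
      (⟶-≤-bound ((2ℚ ℚ.+ 2ℚ) ℚ.* (2^+ l)) (⟶-const 1ℚ) (⟶-* (⟶-seq x) (⟶-seq inv)) λ n →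
        ∣-∣≤⇒≤+ 1ℚ (seq x n ℚ.* recip-clamped n)
          (subst (ℚ._≤ (2ℚ ℚ.+ 2ℚ) ℚ.* (2^+ l) ℚ.* (2^- n)) (dist-sym (seq x n ℚ.* recip-clamped n) 1ℚ) (near n)))
      where
      later : ℕ → ℕ
      later n = l ℕ.+ (l ℕ.+ n)
      later≤ : ∀ n → 2^- later n ℚ.≤ 2^- n
      later≤ n = subst (λ j → 2^- j ℚ.≤ 2^- n)
        (≡.trans (ℕₚ.+-comm n (l ℕ.+ l)) (ℕₚ.+-assoc l l n)) (2^-anti (l ℕ.+ l) n)
      x-clamped : ∀ n → ℚ.∣ seq x (later n) ℚ.- clamped n ∣ ℚ.≤ 2ℚ ℚ.* (2^- later n)
      x-clamped n = ≤+⇒∣-∣≤ (seq x (later n)) (clamped n)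
        (ℚₚ.≤-trans (ℚₚ.p≤q⊔p (2^- l) (seq x (later n))) (≤-by-diff _ 0≤2e refl))
        (ℚₚ.⊔-lub (subst (ℚ._≤ seq x (later n) ℚ.+ 2ℚ ℚ.* (2^- later n)) (seq-ι (2^- l) (later n)) (≤⇒bound h (later n))) (≤-by-diff _ 0≤2e refl))
        where
        0≤2e : 0ℚ ℚ.≤ 2ℚ ℚ.* (2^- later n)
        0≤2e = nonNeg-* (ℚₚ.nonNegative⁻¹ 2ℚ) (0≤2^- (later n))
      x-clamped′ : ∀ n → ℚ.∣ seq x n ℚ.- clamped n ∣ ℚ.≤ (2ℚ ℚ.+ 2ℚ) ℚ.* (2^- n)
      x-clamped′ n = ℚₚ.≤-trans (triangle (seq x n) (seq x (later n)) (clamped n))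
        (ℚₚ.≤-trans (ℚₚ.+-mono-≤
            (ℚₚ.≤-trans (regular x n (later n)) (ℚₚ.+-monoʳ-≤ (2^- n) (later≤ n)))
            (ℚₚ.≤-trans (x-clamped n) (ℚₚ.*-monoˡ-≤-nonNeg 2ℚ (later≤ n))))
          (ℚₚ.≤-reflexive (Q.solve 1 (λ e → (e Q.:+ e) Q.:+ Q.con 2ℚ Q.:* e Q.:= Q.con (2ℚ ℚ.+ 2ℚ) Q.:* e) refl (2^- n))))
      near : ∀ n → ℚ.∣ seq x n ℚ.* recip-clamped n ℚ.- 1ℚ ∣ ℚ.≤ (2ℚ ℚ.+ 2ℚ) ℚ.* (2^+ l) ℚ.* (2^- n)
      near n = ℚₚ.≤-trans
        (ℚₚ.≤-reflexive (≡.trans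
          (cong ℚ.∣_∣ (≡.trans (cong (λ u → seq x n ℚ.* r ℚ.- u) (≡.sym (*-recip (clamped n) (clamp-positive l _))))
            (Q.solve 3 (λ a b r → a Q.:* r Q.:- b Q.:* r Q.:= r Q.:* (a Q.:- b)) refl (seq x n) (clamped n) r)))
          (≡.trans (ℚₚ.∣p*q∣≡∣p∣*∣q∣ r (seq x n ℚ.- clamped n))
            (cong (ℚ._* ℚ.∣ seq x n ℚ.- clamped n ∣) (ℚₚ.0≤p⇒∣p∣≡p (0≤recip-clamped n))))))
        (ℚₚ.≤-trans (ℚₚ.*-monoˡ-≤-nonNeg r {{ℚ.nonNegative (0≤recip-clamped n)}} (x-clamped′ n))
          (ℚₚ.≤-trans (ℚₚ.*-monoʳ-≤-nonNeg ((2ℚ ℚ.+ 2ℚ) ℚ.* (2^- n))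
              {{ℚ.nonNegative (nonNeg-* (ℚₚ.nonNegative⁻¹ (2ℚ ℚ.+ 2ℚ)) (0≤2^- n))}} (recip-clamped≤ n))
            (ℚₚ.≤-reflexive (Q.solve 3 (λ p f e → p Q.:* (f Q.:* e) Q.:= f Q.:* p Q.:* e) refl (2^+ l) (2ℚ ℚ.+ 2ℚ) (2^- n)))))
        where
        r : ℚ
        r = recip-clamped n

-- Rational approximations

Near : ℚ → ℕ → ℝ → Set
Near q r x = ∣ ι q - x ∣ ≤ ι (2^- r)

∣∣≤-cong : ∀ {x y e} → x ≈ y → ∣ x ∣ ≤ e → ∣ y ∣ ≤ e
∣∣≤-cong h h′ = ≤-trans (≈⇒≤ (∣∣-cong (≈-sym h))) h′

-‿congˡ : ∀ {x y z} → x ≈ y → z - x ≈ z - y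
-‿congˡ h = +-congˡ (-‿cong h)

ι-sub : ∀ p q → ι (p ℚ.- q) ≈ ι p - ι q
ι-sub p q = ≈-trans (ι-+ p (ℚ.- q)) (+-congˡ (ι-neg q))

ι-≤-halves : ∀ r → ι (2^- suc r) + ι (2^- suc r) ≤ ι (2^- r)
ι-≤-halves r = ≈⇒≤ (≈-trans (≈-sym (ι-+ (2^- suc r) (2^- suc r))) (≈-reflexive (cong ι (halves r))))

∣-∣-+ : ∀ {u v d e} → ∣ u ∣ ≤ d → ∣ v ∣ ≤ e → ∣ u + v ∣ ≤ d + e
∣-∣-+ h h′ = ≤-trans (∣+∣≤ _ _) (+-mono h h′)

near-+ : ∀ {p q r x y} → Near p (suc r) x → Near q (suc r) y → Near (p ℚ.+ q) r (x + y)
near-+ {p} {q} {r} {x} {y} h h′ = ≤-trans (∣∣≤-cong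
  (≈-trans (S.solve 4 (λ a b x y → (a S.:- x) S.:+ (b S.:- y) S.:= (a S.:+ b) S.:- (x S.:+ y)) ≈-refl (ι p) (ι q) x y)
    (+-congʳ (≈-sym (ι-+ p q))))
  (∣-∣-+ h h′)) (ι-≤-halves r)

near-∸ : ∀ {p q r x y} → Near p (suc r) x → Near q (suc r) y → Near (0ℚ ℚ.⊔ (p ℚ.- q)) r (pos (x - y))
near-∸ {p} {q} {r} {x} {y} h h′ = ≤-trans
  (∣∣≤-cong (+-congʳ (ι-pos (p ℚ.- q))) (≤-trans (∣pos-pos∣≤ (ι (p ℚ.- q)) (x - y))
    (∣∣≤-cong
      (≈-trans (S.solve 4 (λ a b x y → (a S.:- x) S.:+ (S.:- (b S.:- y)) S.:= (a S.:- b) S.:- (x S.:- y)) ≈-refl (ι p) (ι q) x y)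
        (+-congʳ (≈-sym (ι-sub p q))))
      (∣-∣-+ h (≤-trans (≈⇒≤ (∣-∣-sym (ι q - y))) h′)))))
  (ι-≤-halves r)

-- An approximation of a nonnegative real may be negative; truncating it costs no precision and
-- makes unsigned fractions sufficient.
near-pos : ∀ {q r x} → 0r ≤ x → Near q r x → Near (0ℚ ℚ.⊔ q) r x
near-pos {q} {r} {x} h h′ = ∣∣≤-cong (+-cong (ι-pos q) (-‿cong (pos-of-nonneg h)))
  (≤-trans (∣pos-pos∣≤ (ι q) x) h′)

near⇒≤ : ∀ {q r x} → Near q r x → x ≤ ι q + ι (2^- r)
near⇒≤ {q} {r} {x} h = ≤-trans (≈⇒≤ (S.solve 2 (λ q x → x S.:= q S.:- (q S.:- x)) ≈-refl (ι q) x))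
  (+-monoˡ (≤-trans (x≤∣x∣ _) (≤-trans (≈⇒≤ (∣-∣-sym _)) h)))

near⇒≥ : ∀ {q r x} → Near q r x → ι q ≤ x + ι (2^- r)
near⇒≥ {q} {r} {x} h = ≤-trans (≈⇒≤ (S.solve 2 (λ q x → q S.:= x S.:+ (q S.:- x)) ≈-refl (ι q) x))
  (+-monoˡ (≤-trans (x≤∣x∣ _) h))

∣∣-of-nonneg : ∀ {x} → 0r ≤ x → ∣ x ∣ ≈ x
∣∣-of-nonneg {x} h = ≤-antisym
  (∣∣-lub ≤-refl (≤-trans (neg-mono h) (≤-trans (≈⇒≤ (S.solve 0 (S.:- (S.con 0ℚ) S.:= S.con 0ℚ) ≈-refl)) h)))
  (x≤∣x∣ x)

-- The error is `q (p − x) + x (q − y)`, so bounds on the real `x` and on the approximation `q`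
-- suffice.
near-* : ∀ {p q δ B r x y} → 0r ≤ x → 0ℚ ℚ.≤ q → 0ℚ ℚ.≤ δ → x ≤ ι B → ι q ≤ ι B →
  (B ℚ.+ B) ℚ.* δ ℚ.≤ 2^- r → ∣ ι p - x ∣ ≤ ι δ → ∣ ι q - y ∣ ≤ ι δ → Near (p ℚ.* q) r (x * y)
near-* {p} {q} {δ} {B} {r} {x} {y} 0≤x 0≤q 0≤δ x≤ q≤ scale h h′ = ≤-trans (∣∣≤-cong
  (≈-trans (S.solve 4 (λ a b x y → b S.:* (a S.:- x) S.:+ x S.:* (b S.:- y) S.:= (a S.:* b) S.:- (x S.:* y)) ≈-refl (ι p) (ι q) x y)
    (+-congʳ (≈-sym (ι-* p q))))
  (∣-∣-+ (part (ι-mono 0≤q) q≤ h) (part 0≤x x≤ h′)))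
  (≤-trans (≈⇒≤ (≈-trans (S.solve 2 (λ B δ → B S.:* δ S.:+ B S.:* δ S.:= (B S.:+ B) S.:* δ) ≈-refl (ι B) (ι δ))
    (≈-sym (≈-trans (ι-* _ _) (*-congʳ (ι-+ B B)))))) (ι-mono scale))
  where
  part : ∀ {u v} → 0r ≤ u → u ≤ ι B → ∣ v ∣ ≤ ι δ → ∣ u * v ∣ ≤ ι B * ι δ
  part {u} {v} 0≤u u≤ v≤ = ≤-trans (≈⇒≤ (≈-trans (∣*∣≈ u v) (*-congʳ (∣∣-of-nonneg 0≤u))))
    (*-mono (0≤∣x∣ v) (≤-trans 0≤u u≤) u≤ v≤)

-- If p q = 1 and x y = 1 then q − y = q y (x − p).
near-inv : ∀ {p q l r x y} → p ℚ.* q ≡ 1ℚ → x * y ≈ 1r → 0ℚ ℚ.≤ q → q ℚ.≤ 2^+ suc l → 0r ≤ y → ι (2^- l) ≤ x →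
  Near p (suc l ℕ.+ (l ℕ.+ r)) x → Near q r y
near-inv {p} {q} {l} {r} {x} {y} pq xy 0≤q q≤ 0≤y x≥ h = ≤-trans (∣∣≤-cong
    (≈-trans (S.solve 4 (λ p q x y → q S.:* y S.:* (S.:- (p S.:- x)) S.:= q S.:* (x S.:* y) S.:- y S.:* (p S.:* q)) ≈-refl (ι p) (ι q) x y)
      (+-cong (≈-trans (*-congˡ xy) (*-identityʳ (ι q)))
        (-‿cong (≈-trans (*-congˡ (≈-trans (≈-sym (ι-* p q)) (≈-reflexive (cong ι pq)))) (*-identityʳ y)))))
    (≤-trans (≈⇒≤ (≈-trans (∣*∣≈ _ _) (*-cong (∣∣-of-nonneg 0≤qy) (∣-∣-sym (ι p - x)))))
      (*-mono (0≤∣x∣ _) (≤-trans 0≤qy qy≤) qy≤ h)))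
  (≈⇒≤ (≈-trans (*-congʳ (≈-sym (ι-* _ _))) (≈-trans (≈-sym (ι-* _ _)) (≈-reflexive (cong ι scale)))))
  where
  0≤qy : 0r ≤ ι q * y
  0≤qy = *-nonneg (ι-mono 0≤q) 0≤y
  y≤ : y ≤ ι (2^+ l)
  y≤ = ≤-trans (≈⇒≤ (≈-trans (≈-sym (*-identityʳ y))
        (≈-trans (*-congˡ (≈-trans (≈-reflexive (cong ι (≡.sym (2^+*2^- l)))) (ι-* _ _)))
          (S.solve 3 (λ a b y → y S.:* (a S.:* b) S.:= (a S.:* y) S.:* b) ≈-refl (ι (2^+ l)) (ι (2^- l)) y))))
    (≤-trans (*-monoˡ (*-nonneg (ι-mono (0≤2^+ l)) 0≤y) x≥)
      (≈⇒≤ (≈-trans (S.solve 3 (λ a x y → (a S.:* y) S.:* x S.:= a S.:* (x S.:* y)) ≈-refl (ι (2^+ l)) x y)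
        (≈-trans (*-congˡ xy) (*-identityʳ _)))))
  qy≤ : ι q * y ≤ ι (2^+ suc l) * ι (2^+ l)
  qy≤ = *-mono 0≤y (ι-mono (0≤2^+ (suc l))) (ι-mono q≤) y≤
  scale : (2^+ suc l) ℚ.* (2^+ l) ℚ.* (2^- (suc l ℕ.+ (l ℕ.+ r))) ≡ 2^- r
  scale = ≡.trans (cong ((2^+ suc l) ℚ.* (2^+ l) ℚ.*_) (≡.trans (2^-+ (suc l) (l ℕ.+ r)) (cong ((2^- suc l) ℚ.*_) (2^-+ l r))))
    (≡.trans (Q.solve 5 (λ a b c d e → a Q.:* b Q.:* (c Q.:* (d Q.:* e)) Q.:= (a Q.:* c) Q.:* (b Q.:* d) Q.:* e) refl
       (2^+ suc l) (2^+ l) (2^- suc l) (2^- l) (2^- r))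
      (≡.trans (cong₂ (λ u v → u ℚ.* v ℚ.* (2^- r)) (2^+*2^- (suc l)) (2^+*2^- l))
        (ℚₚ.*-identityˡ (2^- r))))

-- Splitting off a cylinder

infixl 9 _↓_

_↓_ : (Str → ℝ) → Bool → Str → ℝ
(f ↓ c) t = f (c ∷ t)

Additive : (Str → ℝ) → Set
Additive μ = ∀ t → μ t ≈ μ (t ∷ʳ false) + μ (t ∷ʳ true)

Fair : (d ν : Str → ℝ) → Set
Fair d ν = Additive (λ t → d t * ν t)

NonNeg : (Str → ℝ) → Set
NonNeg f = ∀ t → 0r ≤ f t

same : Bool → Bool → Bool
same true  b = b
same false b = not b

same-refl : ∀ b → same b b ≡ true
same-refl true  = refl
same-refl false = refl

same⇒≡ : ∀ b c → same b c ≡ true → b ≡ c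
same⇒≡ true  true  _ = refl
same⇒≡ false false _ = refl

same-≢ : ∀ {b c} → ¬ (b ≡ c) → same c b ≡ false
same-≢ {true}  {true}  b≢c = ⊥-elim (b≢c refl)
same-≢ {true}  {false} b≢c = refl
same-≢ {false} {true}  b≢c = refl
same-≢ {false} {false} b≢c = ⊥-elim (b≢c refl)

additive-cong : ∀ {μ μ′} → (∀ t → μ t ≈ μ′ t) → Additive μ → Additive μ′
additive-cong e h t = ≈-trans (≈-sym (e t)) (≈-trans (h t) (+-cong (e (t ∷ʳ false)) (e (t ∷ʳ true))))

additive-+ : ∀ {μ μ′} → Additive μ → Additive μ′ → Additive (λ t → μ t + μ′ t)
additive-+ {μ} {μ′} h h′ t = ≈-trans (+-cong (h t) (h′ t))
  (S.solve 4 (λ a b c d → (a S.:+ b) S.:+ (c S.:+ d) S.:= (a S.:+ c) S.:+ (b S.:+ d)) ≈-refl _ _ _ _)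

additive-scale : ∀ {μ} a → Additive μ → Additive (λ t → a * μ t)
additive-scale a h t = ≈-trans (*-congˡ (h t)) (*-distribˡ-+ a _ _)

additive-0 : Additive (λ _ → 0r)
additive-0 t = ≈-sym (+-identityˡ 0r)

additive-sub : ∀ {μ μ′} → Additive μ → Additive μ′ → Additive (λ t → μ t - μ′ t)
additive-sub {μ} {μ′} h h′ = additive-cong
  (λ t → S.solve 2 (λ a b → a S.:+ (S.con (ℚ.- 1ℚ)) S.:* b S.:= a S.:- b) ≈-refl (μ t) (μ′ t))
  (additive-+ h (additive-scale (ι (ℚ.- 1ℚ)) h′))

gate : Bool → ℝ → ℝ
gate true  x = x
gate false _ = 0r

gate-nonneg : ∀ β {x} → 0r ≤ x → 0r ≤ gate β x
gate-nonneg true  h = h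
gate-nonneg false h = ≤-refl

gate-cong : ∀ β {x y} → x ≈ y → gate β x ≈ gate β y
gate-cong true  h = h
gate-cong false h = ≈-refl

gate-split : ∀ β x → gate β x + gate (not β) x ≈ x
gate-split true  x = +-identityʳ x
gate-split false x = +-identityˡ x

affine-fair : ∀ {d ν} a b → Additive ν → Fair d ν → Fair (λ t → a + b * d t) ν
affine-fair {d} {ν} a b h h′ = additive-cong
  (λ t → S.solve 4 (λ a b d n → a S.:* n S.:+ b S.:* (d S.:* n) S.:= (a S.:+ b S.:* d) S.:* n) ≈-refl a b (d t) (ν t))
  (additive-+ (additive-scale a h) (additive-scale b h′))

gate-fair : ∀ β {f ν} → Fair f ν → Fair (λ t → gate β (f t)) ν
gate-fair true  h = h
gate-fair false {ν = ν} h = additive-cong (λ t → ≈-sym (zeroˡ (ν t))) additive-0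

-- A martingale is stopped at capital 1, softly: the stopped fraction grows
-- linearly from 0 to 1 while the capital grows from 1 − 2^-i to 1, which makes
-- it a function of real numbers.

module _ (i : ℕ) where

  stopped kept : ℝ → ℝ
  stopped x = pos (1r - ι (2^+ i) * pos (1r - x))
  kept    x = pos (1r - stopped x)

  stopped-cong : ∀ {x y} → x ≈ y → stopped x ≈ stopped y
  stopped-cong h = pos-cong (-‿congˡ (*-congˡ (pos-cong (-‿congˡ h))))

  kept-cong : ∀ {x y} → x ≈ y → kept x ≈ kept y
  kept-cong h = pos-cong (-‿congˡ (stopped-cong h))

  stopped≤1 : ∀ x → stopped x ≤ 1r
  stopped≤1 x = pos-lub 0≤1 (≤-from-sub (ι (2^+ i) * pos (1r - x))
    (*-nonneg (ι-mono (0≤2^+ i)) (0≤pos _))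
    (S.solve 2 (λ o p → o S.:= (o S.:- p) S.:+ p) ≈-refl 1r (ι (2^+ i) * pos (1r - x))))

  -- `kept` is defined with `pos` because only truncated subtraction is available to the computed
  -- fractions; as `stopped x` is at most 1, this agrees with the plain difference.
  kept≈ : ∀ x → kept x ≈ 1r - stopped x
  kept≈ x = pos-of-nonneg (sub-nonneg (stopped≤1 x))

  sub-nonpos : ∀ {x y} → y ≤ x → y - x ≤ 0r
  sub-nonpos {x} h = ≤-trans (+-monoʳ h) (≈⇒≤ (+-inverseʳ x))

  stopped-at-1 : ∀ {x} → 1r ≤ x → stopped x ≈ 1r
  stopped-at-1 {x} h = ≈-trans (pos-cong (≈-trans (-‿congˡ (*-congˡ (pos-of-nonpos (sub-nonpos h))))
      (S.solve 1 (λ p → S.con 1ℚ S.:- p S.:* S.con 0ℚ S.:= S.con 1ℚ) ≈-refl (ι (2^+ i)))))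
    (pos-of-nonneg 0≤1)

  ε : ℝ
  ε = ι (2^- i)

  -- Says without cases that capital is frozen only where `x` is at least `1 − ε`. For the argument
  -- `z` of the outer `pos`, `ε z = ε − pos (1 − x)` is at most `x − (1 − ε)`, and `pos z * z` is
  -- nonnegative.
  stopped-near-1 : ∀ x → stopped x * (1r - ε) ≤ stopped x * x
  stopped-near-1 x = ≤-from-sub (stopped x * (x - (1r - ε)))
    (≤-trans (*-nonneg (0≤ι2^- i) (0≤pos*x z))
      (≤-trans (≈⇒≤ (S.solve 3 (λ e s z → e S.:* (s S.:* z) S.:= s S.:* (e S.:* z)) ≈-refl ε (stopped x) z))
        (*-monoˡ (0≤pos z) ε*z≤)))
    (S.solve 3 (λ s x y → s S.:* x S.:= s S.:* y S.:+ s S.:* (x S.:- y)) ≈-refl (stopped x) x (1r - ε))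
    where
    z : ℝ
    z = 1r - ι (2^+ i) * pos (1r - x)
    ε*z≤ : ε * z ≤ x - (1r - ε)
    ε*z≤ = ≤-trans (≈⇒≤ (≈-trans
        (S.solve 3 (λ e p y → e S.:* (S.con 1ℚ S.:- p S.:* y) S.:= e S.:- (p S.:* e) S.:* y) ≈-refl ε (ι (2^+ i)) (pos (1r - x)))
        (-‿congˡ (≈-trans (*-congʳ (≈-trans (≈-sym (ι-* (2^+ i) (2^- i))) (≈-reflexive (cong ι (2^+*2^- i)))))
          (*-identityˡ _)))))
      (≤-trans (+-monoˡ (neg-mono (x≤pos (1r - x))))
        (≈⇒≤ (S.solve 2 (λ e x → e S.:- (S.con 1ℚ S.:- x) S.:= x S.:- (S.con 1ℚ S.:- e)) ≈-refl ε x)))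

  -- `a` is the capital frozen so far and `b` the fraction of `d` still held. At capital `x` the
  -- fraction `stopped x` of the holding moves into `a`.
  next-a : (a b x : ℝ) → ℝ
  next-a a b x = a + b * (stopped x * x)

  next-b : (b x : ℝ) → ℝ
  next-b b x = b * kept x

  next-a-cong : ∀ {a a′ b b′ x x′} → a ≈ a′ → b ≈ b′ → x ≈ x′ → next-a a b x ≈ next-a a′ b′ x′
  next-a-cong ha hb hx = +-cong ha (*-cong hb (*-cong (stopped-cong hx) hx))

  next-b-cong : ∀ {b b′ x x′} → b ≈ b′ → x ≈ x′ → next-b b x ≈ next-b b′ x′
  next-b-cong hb hx = *-cong hb (kept-cong hx)

  -- Freezing happens at the current price, so it does not change the present value.
  next-total : ∀ a b x → next-a a b x + next-b b x * x ≈ a + b * x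
  next-total a b x = ≈-trans (+-congˡ (*-congʳ (*-congˡ (kept≈ x))))
    (S.solve 4 (λ a b s x → a S.:+ b S.:* (s S.:* x) S.:+ b S.:* (S.con 1ℚ S.:- s) S.:* x S.:= a S.:+ b S.:* x)
      ≈-refl a b (stopped x) x)

  -- The last field is the total guaranteed if the remaining holding is frozen at the worst possible
  -- price, `1 − ε`.
  record Sufficient (a b : ℝ) : Set where
    field
      0≤a  : 0r ≤ a
      0≤b  : 0r ≤ b
      1≤   : 1r ≤ a + b * (1r - ε)

  open Sufficient

  sufficient-init : Sufficient ε 1r
  sufficient-init = record { 0≤a = 0≤ι2^- i ; 0≤b = 0≤1
    ; 1≤ = ≈⇒≤ (S.solve 1 (λ e → S.con 1ℚ S.:= e S.:+ S.con 1ℚ S.:* (S.con 1ℚ S.:- e)) ≈-refl ε) }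

  a≤next-a : ∀ {a b x} → Sufficient a b → 0r ≤ x → a ≤ next-a a b x
  a≤next-a p 0≤x = ≤-from-sub _ (*-nonneg (0≤b p) (*-nonneg (0≤pos _) 0≤x)) ≈-refl

  -- Split `b` into its stopped and its kept fraction: the kept one is still valued at `1 − ε`, and
  -- the stopped one has just been sold for at least that, by `stopped-near-1`.
  sufficient-next : ∀ {a b x} → Sufficient a b → 0r ≤ x → Sufficient (next-a a b x) (next-b b x)
  sufficient-next {a} {b} {x} p 0≤x = record
    { 0≤a = ≤-trans (0≤a p) (a≤next-a p 0≤x)
    ; 0≤b = *-nonneg (0≤b p) (0≤pos _)
    ; 1≤  = ≤-trans (1≤ p) (≤-trans
        (≈⇒≤ (≈-trans (S.solve 4 (λ a b s e → a S.:+ b S.:* e S.:=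
              (a S.:+ b S.:* (s S.:* e)) S.:+ b S.:* (S.con 1ℚ S.:- s) S.:* e) ≈-refl a b (stopped x) (1r - ε))
            (+-congˡ (*-congʳ (*-congˡ (≈-sym (kept≈ x)))))))
        (+-monoʳ (+-monoˡ (*-monoˡ (0≤b p) (stopped-near-1 x))))) }

  1≤affine : ∀ {a b x} → Sufficient a b → 1r ≤ x → 1r ≤ a + b * x
  1≤affine {a} {b} {x} p 1≤x = ≤-trans (1≤ p) (+-monoˡ (*-monoˡ (0≤b p) (≤-trans
    (≤-from-sub ε (0≤ι2^- i) (S.solve 1 (λ e → S.con 1ℚ S.:= S.con 1ℚ S.:- e S.:+ e) ≈-refl ε)) 1≤x)))

  -- At capital 1 the whole holding is frozen, so later losses of `d` no longer matter.
  1≤next-a : ∀ {a b x} → Sufficient a b → 1r ≤ x → 1r ≤ next-a a b x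
  1≤next-a {a} {b} {x} p 1≤x = ≤-trans (1≤affine p 1≤x)
    (≈⇒≤ (+-congˡ (*-congˡ (≈-sym (≈-trans (*-congʳ (stopped-at-1 1≤x)) (*-identityˡ x))))))

  -- The part of the stopped martingale a + b d above the cylinder of w (σ =
  -- true) or above its complement (σ = false); ρ is the reciprocal of ν.

  module _ (σ : Bool) where

    splitOff : (d ν ρ : Str → ℝ) (w : Str) (a b : ℝ) → Str → ℝ
    splitOff d ν ρ []      a b t       = gate σ (a + b * d t)
    splitOff d ν ρ (c ∷ w) a b []      = ρ [] *
      (ν (c ∷ []) * splitOff (d ↓ c) (ν ↓ c) (ρ ↓ c) w (next-a a b (d [])) (next-b b (d [])) [] +
       ν (not c ∷ []) * gate (not σ) (next-a a b (d []) + next-b b (d []) * d (not c ∷ [])))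
    splitOff d ν ρ (c ∷ w) a b (e ∷ t) = if same c e
      then splitOff (d ↓ c) (ν ↓ c) (ρ ↓ c) w (next-a a b (d [])) (next-b b (d [])) t
      else gate (not σ) (next-a a b (d []) + next-b b (d []) * d (e ∷ t))

nonneg-sum-0 : ∀ {x y} → 0r ≤ x → 0r ≤ y → x + y ≈ 0r → x ≈ 0r × y ≈ 0r
nonneg-sum-0 {x} {y} 0≤x 0≤y h = ≤-antisym x≤0 0≤x , ≤-antisym y≤0 0≤y
  where
  x≤0 : x ≤ 0r
  x≤0 = ≤-trans (≤-from-sub y 0≤y ≈-refl) (≈⇒≤ h)
  y≤0 : y ≤ 0r
  y≤0 = ≤-trans (≤-from-sub x 0≤x (+-comm x y)) (≈⇒≤ h)

*-zero : ∀ {x} y → x ≈ 0r → x * y ≈ 0r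
*-zero y h = ≈-trans (*-congʳ h) (zeroˡ y)

-- ρ is the reciprocal of ν where ν does not vanish.

record Gauge (ν ρ : Str → ℝ) : Set where
  field
    ν≥0        : NonNeg ν
    ν-additive : Additive ν
    ρ≥0        : NonNeg ρ
    reciprocal : ∀ t → ν t ≈ 0r ⊎ ν t * ρ t ≈ 1r

  children-0 : ∀ {t} → ν t ≈ 0r → ∀ c → ν (t ∷ʳ c) ≈ 0r
  children-0 {t} h false = proj₁ (nonneg-sum-0 (ν≥0 (t ∷ʳ false)) (ν≥0 (t ∷ʳ true)) (≈-trans (≈-sym (ν-additive t)) h))
  children-0 {t} h true  = proj₂ (nonneg-sum-0 (ν≥0 (t ∷ʳ false)) (ν≥0 (t ∷ʳ true)) (≈-trans (≈-sym (ν-additive t)) h))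

  -- Where ν vanishes so does each summand.
  reciprocal-cancel : ∀ {t} c y z → ρ t * (ν (t ∷ʳ c) * y + ν (t ∷ʳ not c) * z) * ν t ≈ ν (t ∷ʳ c) * y + ν (t ∷ʳ not c) * z
  reciprocal-cancel {t} c y z = [ vanishing , invertible ]′ (reciprocal t)
    where
    x : ℝ
    x = ν (t ∷ʳ c) * y + ν (t ∷ʳ not c) * z
    invertible : ν t * ρ t ≈ 1r → ρ t * x * ν t ≈ x
    invertible h = ≈-trans (S.solve 3 (λ r x n → r S.:* x S.:* n S.:= n S.:* r S.:* x) ≈-refl (ρ t) x (ν t))
      (≈-trans (*-congʳ h) (*-identityˡ x))
    vanishing : ν t ≈ 0r → ρ t * x * ν t ≈ x
    vanishing h = ≈-trans (≈-trans (*-comm (ρ t * x) (ν t)) (*-zero (ρ t * x) h))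
      (≈-sym (≈-trans (+-cong (*-zero y (children-0 {t} h c)) (*-zero z (children-0 {t} h (not c)))) (+-identityˡ 0r)))

open Gauge

gauge-↓ : ∀ {ν ρ} → Gauge ν ρ → ∀ c → Gauge (ν ↓ c) (ρ ↓ c)
gauge-↓ g c = record
  { ν≥0 = λ t → ν≥0 g (c ∷ t) ; ν-additive = λ t → ν-additive g (c ∷ t)
  ; ρ≥0 = λ t → ρ≥0 g (c ∷ t) ; reciprocal = λ t → reciprocal g (c ∷ t) }

module _ (i : ℕ) where

  open Sufficient

  module _ (σ : Bool) where

    splitOff-nonneg : ∀ {d ν ρ a b} w → NonNeg d → Gauge ν ρ → Sufficient i a b →
      NonNeg (splitOff i σ d ν ρ w a b)
    splitOff-nonneg [] d≥0 g p t = gate-nonneg σ (+-nonneg (0≤a p) (*-nonneg (0≤b p) (d≥0 t)))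
    splitOff-nonneg (c ∷ w) d≥0 g p [] = *-nonneg (ρ≥0 g []) (+-nonneg
      (*-nonneg (ν≥0 g (c ∷ [])) (splitOff-nonneg w (λ t → d≥0 (c ∷ t)) (gauge-↓ g c) (sufficient-next i p (d≥0 [])) []))
      (*-nonneg (ν≥0 g (not c ∷ [])) (gate-nonneg (not σ) (+-nonneg
        (0≤a (sufficient-next i p (d≥0 []))) (*-nonneg (0≤b (sufficient-next i p (d≥0 []))) (d≥0 (not c ∷ [])))))))
    splitOff-nonneg (c ∷ w) d≥0 g p (e ∷ t) with same c e
    ... | true  = splitOff-nonneg w (λ t → d≥0 (c ∷ t)) (gauge-↓ g c) (sufficient-next i p (d≥0 [])) t
    ... | false = gate-nonneg (not σ) (+-nonneg
        (0≤a (sufficient-next i p (d≥0 []))) (*-nonneg (0≤b (sufficient-next i p (d≥0 []))) (d≥0 (e ∷ t))))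

    splitOff-cong : ∀ {d d′ ν ρ a a′ b b′} w → (∀ t → d t ≈ d′ t) → a ≈ a′ → b ≈ b′ →
      ∀ t → splitOff i σ d ν ρ w a b t ≈ splitOff i σ d′ ν ρ w a′ b′ t
    splitOff-cong [] hd ha hb t = gate-cong σ (+-cong ha (*-cong hb (hd t)))
    splitOff-cong (c ∷ w) hd ha hb [] = *-congˡ (+-cong
      (*-congˡ (splitOff-cong w (λ t → hd (c ∷ t)) (next-a-cong i ha hb (hd [])) (next-b-cong i hb (hd [])) []))
      (*-congˡ (gate-cong (not σ) (+-cong (next-a-cong i ha hb (hd [])) (*-cong (next-b-cong i hb (hd [])) (hd (not c ∷ [])))))))
    splitOff-cong (c ∷ w) hd ha hb (e ∷ t) with same c e
    ... | true  = splitOff-cong w (λ t → hd (c ∷ t)) (next-a-cong i ha hb (hd [])) (next-b-cong i hb (hd [])) t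
    ... | false = gate-cong (not σ) (+-cong (next-a-cong i ha hb (hd [])) (*-cong (next-b-cong i hb (hd [])) (hd (e ∷ t))))

    -- At a proper prefix of `w` the value is by definition the `ν`-average of the two children, so
    -- only the cancellation of `ρ` against `ν` remains. Elsewhere the value is 0 or affine in `d`
    -- with fixed coefficients.
    splitOff-fair : ∀ {d ν ρ a b} w → Fair d ν → Gauge ν ρ → Fair (splitOff i σ d ν ρ w a b) ν
    splitOff-fair {a = a} {b} [] fair g = gate-fair σ (affine-fair a b (ν-additive g) fair)
    splitOff-fair (false ∷ w) fair g [] = ≈-trans (reciprocal-cancel g {[]} false _ _)
      (+-cong (*-comm _ _) (*-comm _ _))
    splitOff-fair (true  ∷ w) fair g [] = ≈-trans (reciprocal-cancel g {[]} true _ _)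
      (≈-trans (+-comm _ _) (+-cong (*-comm _ _) (*-comm _ _)))
    splitOff-fair {d} {a = a} {b} (c ∷ w) fair g (e ∷ t) with same c e in eq
    ... | true  with refl ← same⇒≡ c e eq = splitOff-fair w (λ t → fair (c ∷ t)) (gauge-↓ g c) t
    ... | false = gate-fair (not σ) (affine-fair (next-a i a b (d [])) (next-b i b (d [])) (ν-additive (gauge-↓ g e)) (λ t → fair (e ∷ t))) t

  -- Both parts are built with the same `a` and `b`, and at each leaf of the path exactly one of
  -- them is cut off, so they add up to the stopped martingale. The factor `ν []` has to stay: on a
  -- null cylinder the averages bear no relation to `d`.
  splitOff-cost : ∀ {d ν ρ a b} w → Fair d ν → Gauge ν ρ →
    (splitOff i true d ν ρ w a b [] + splitOff i false d ν ρ w a b []) * ν [] ≈ (a + b * d []) * ν []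
  splitOff-cost [] fair g = *-congʳ (+-identityʳ _)
  splitOff-cost {d} {ν} {ρ} {a} {b} (c ∷ w) fair g = ≈-trans
    (≈-trans (S.solve 8 (λ r n m n′ x y u v →
          (r S.:* (n S.:* x S.:+ n′ S.:* u) S.:+ r S.:* (n S.:* y S.:+ n′ S.:* v)) S.:* m
          S.:= r S.:* (n S.:* (x S.:+ y) S.:+ n′ S.:* (u S.:+ v)) S.:* m)
        ≈-refl (ρ []) (ν (c ∷ [])) (ν []) (ν (not c ∷ [])) _ _ _ _)
      (reciprocal-cancel g {[]} c _ _))
    (≈-trans (+-cong
        (≈-trans (*-comm _ _) (splitOff-cost w (λ t → fair (c ∷ t)) (gauge-↓ g c)))
        (≈-trans (*-congˡ (gate-split false _)) (*-comm _ _)))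
      (≈-trans (children c) (*-congʳ (next-total i a b (d [])))))
    where
    a′ b′ : ℝ
    a′ = next-a i a b (d [])
    b′ = next-b i b (d [])
    whole : (a′ + b′ * d []) * ν [] ≈ (a′ + b′ * d (false ∷ [])) * ν (false ∷ []) + (a′ + b′ * d (true ∷ [])) * ν (true ∷ [])
    whole = affine-fair a′ b′ (ν-additive g) fair []
    children : ∀ c → (a′ + b′ * d (c ∷ [])) * ν (c ∷ []) + (a′ + b′ * d (not c ∷ [])) * ν (not c ∷ []) ≈ (a′ + b′ * d []) * ν []
    children false = ≈-sym whole
    children true  = ≈-trans (+-comm _ _) (≈-sym whole)

  Reached : (Str → ℝ) → ℝ → Cantor → Set
  Reached d a A = 1r ≤ a ⊎ ∃ λ n → 1r ≤ d (A ↾ n)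

  tail : Cantor → Cantor
  tail A n = A (suc n)

  reached-next : ∀ {d a b} A → NonNeg d → Sufficient i a b → Reached d a A →
    Reached (d ↓ A 0) (next-a i a b (d [])) (tail A)
  reached-next A d≥0 p (inj₁ h)           = inj₁ (≤-trans h (a≤next-a i p (d≥0 [])))
  reached-next A d≥0 p (inj₂ (zero , h))  = inj₁ (1≤next-a i p h)
  reached-next A d≥0 p (inj₂ (suc n , h)) = inj₂ (n , h)

  reached-affine : ∀ {d a b A} → NonNeg d → Sufficient i a b → Reached d a A → ∃ λ n → 1r ≤ a + b * d (A ↾ n)
  reached-affine d≥0 p (inj₁ h)       = 0 , ≤-trans h (≤-from-sub _ (*-nonneg (0≤b p) (d≥0 [])) ≈-refl)
  reached-affine d≥0 p (inj₂ (n , h)) = n , 1≤affine i p h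

  splitOff-inside : ∀ {d ν ρ a b} w A → NonNeg d → Sufficient i a b → A ↾ length w ≡ w → Reached d a A →
    ∃ λ n → 1r ≤ splitOff i true d ν ρ w a b (A ↾ n)
  splitOff-inside [] A d≥0 p _ r = reached-affine d≥0 p r
  splitOff-inside {d} {ν} {ρ} (c ∷ w) A d≥0 p eq r with Listₚ.∷-injective eq
  ... | refl , eq′ with splitOff-inside {ν = ν ↓ c} {ρ ↓ c} w (tail A) (λ t → d≥0 (c ∷ t)) (sufficient-next i p (d≥0 [])) eq′ (reached-next A d≥0 p r)
  ...   | n , h = suc n , on-path
    where
    on-path : 1r ≤ splitOff i true d ν ρ (A 0 ∷ w) _ _ (A 0 ∷ tail A ↾ n)
    on-path rewrite same-refl (A 0) = h

  splitOff-outside : ∀ {d ν ρ a b} w A → NonNeg d → Sufficient i a b → ¬ (A ↾ length w ≡ w) → Reached d a A →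
    ∃ λ n → 1r ≤ splitOff i false d ν ρ w a b (A ↾ n)
  splitOff-outside [] A d≥0 p ≢w r = ⊥-elim (≢w refl)
  splitOff-outside {d} {ν} {ρ} {a} {b} (c ∷ w) A d≥0 p ≢w r with A 0 Boolₚ.≟ c
  ... | yes refl = suc (proj₁ rec) , on-path
    where
    rec : ∃ λ n → 1r ≤ splitOff i false (d ↓ A 0) (ν ↓ A 0) (ρ ↓ A 0) w (next-a i a b (d [])) (next-b i b (d [])) (tail A ↾ n)
    rec = splitOff-outside w (tail A) (λ t → d≥0 (c ∷ t)) (sufficient-next i p (d≥0 []))
      (λ e → ≢w (cong (A 0 ∷_) e)) (reached-next A d≥0 p r)
    on-path : 1r ≤ splitOff i false d ν ρ (A 0 ∷ w) a b (A 0 ∷ tail A ↾ proj₁ rec)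
    on-path rewrite same-refl (A 0) = proj₂ rec
  ... | no ≢c = suc (proj₁ here) , off-path
    where
    here : ∃ λ n → 1r ≤ next-a i a b (d []) + next-b i b (d []) * d (A 0 ∷ tail A ↾ n)
    here = reached-affine (λ t → d≥0 (A 0 ∷ t)) (sufficient-next i p (d≥0 [])) (reached-next A d≥0 p r)
    off-path : 1r ≤ splitOff i false d ν ρ (c ∷ w) a b (A 0 ∷ tail A ↾ proj₁ here)
    off-path rewrite same-≢ ≢c = proj₂ here

-- The capital needed to cover a cylinder

-- A rational witness of strict positivity: `positive-summand` computes from it at which child to
-- continue.
Positive : ℝ → Set
Positive x = ∃ λ m → ι (2^- m) ≤ x

positive⇒≰0 : ∀ {x} → Positive x → ¬ (x ≤ 0r)
positive⇒≰0 (m , p) h = ι2^-≰0 {m} (≤-trans p h)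

-- mass w ν t is the ν-measure of the intersection of the cylinders of w and t.

mass : Str → (Str → ℝ) → Str → ℝ
mass []      ν t       = ν t
mass (c ∷ w) ν []      = mass w (ν ↓ c) []
mass (c ∷ w) ν (e ∷ t) = if same c e then mass w (ν ↓ c) t else 0r

mass-[] : ∀ w ν → mass w ν [] ≡ ν w
mass-[] []      ν = refl
mass-[] (c ∷ w) ν = mass-[] w (ν ↓ c)

mass-additive : ∀ w {ν} → Additive ν → Additive (mass w ν)
mass-additive []          h t = h t
mass-additive (false ∷ w) h [] = ≈-sym (+-identityʳ _)
mass-additive (true  ∷ w) h [] = ≈-sym (+-identityˡ _)
mass-additive (c ∷ w)     h (e ∷ t) with same c e
... | true  = mass-additive w (λ t → h (c ∷ t)) t
... | false = additive-0 t

additive⇒child≤ : ∀ {ν} → Additive ν → NonNeg ν → ∀ c t → ν (t ∷ʳ c) ≤ ν t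
additive⇒child≤ {ν} h ν≥0 false t = ≤-from-sub (ν (t ∷ʳ true)) (ν≥0 _) (h t)
additive⇒child≤ {ν} h ν≥0 true  t = ≤-from-sub (ν (t ∷ʳ false)) (ν≥0 _) (≈-trans (h t) (+-comm _ _))

mass≤ : ∀ w {ν} → Additive ν → NonNeg ν → ∀ t → mass w ν t ≤ ν t
mass≤ []      h ν≥0 t  = ≤-refl
mass≤ (c ∷ w) h ν≥0 [] = ≤-trans (mass≤ w (λ t → h (c ∷ t)) (λ t → ν≥0 (c ∷ t)) []) (additive⇒child≤ h ν≥0 c [])
mass≤ (c ∷ w) h ν≥0 (e ∷ t) with same c e in eq
... | true with refl ← same⇒≡ c e eq = mass≤ w (λ t → h (c ∷ t)) (λ t → ν≥0 (c ∷ t)) t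
... | false = ν≥0 (e ∷ t)

mass≥0 : ∀ w {ν} → NonNeg ν → NonNeg (mass w ν)
mass≥0 []      ν≥0 t  = ν≥0 t
mass≥0 (c ∷ w) ν≥0 [] = mass≥0 w (λ t → ν≥0 (c ∷ t)) []
mass≥0 (c ∷ w) ν≥0 (e ∷ t) with same c e
... | true  = mass≥0 w (λ t → ν≥0 (c ∷ t)) t
... | false = ≤-refl

mass-inside : ∀ w ν → mass w ν w ≡ ν w
mass-inside []      ν = refl
mass-inside (c ∷ w) ν rewrite same-refl c = mass-inside w (ν ↓ c)

mass-outside : ∀ w ν A → ¬ (A ↾ length w ≡ w) → mass w ν (A ↾ length w) ≡ 0r
mass-outside []      ν A ≢w = ⊥-elim (≢w refl)
mass-outside (c ∷ w) ν A ≢w with same c (A 0) in eq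
... | false = refl
... | true  = mass-outside w (ν ↓ c) (λ n → A (suc n))
      (λ e → ≢w (≡.cong₂ _∷_ (≡.sym (same⇒≡ c (A 0) eq)) e))

positive-child : ∀ {h} → Additive h → Positive (h []) → ∃ λ c → Positive (h (c ∷ []))
positive-child add (m , p) = [ (false ,_) , (true ,_) ]′ (positive-summand m (≤-trans p (≈⇒≤ (add []))))

path : ∀ {h} → Additive h → Positive (h []) → Cantor
path add p zero    = proj₁ (positive-child add p)
path add p (suc n) = path (λ t → add (proj₁ (positive-child add p) ∷ t)) (proj₂ (positive-child add p)) n

path-positive : ∀ {h} (add : Additive h) (p : Positive (h [])) n → Positive (h (path add p ↾ n))
path-positive add p zero    = p
path-positive add p (suc n) = path-positive (λ t → add (proj₁ (positive-child add p) ∷ t)) (proj₂ (positive-child add p)) n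

positive-mono : ∀ {x y} → x ≤ y → Positive x → Positive y
positive-mono h (m , p) = m , ≤-trans p h

-- `μ` stands for the part of `ν` on the set to be covered; the set itself enters only through
-- `succeeds`, so a cylinder and its complement are treated alike. By `≤-stable` it is enough to
-- refute a rational gap between `μ []` and `d []`.
capital-bound : ∀ {d ν μ} → ν [] ≈ 1r → NonNeg ν → NonNeg d → Fair d ν →
  Additive μ → (∀ t → μ t ≤ ν t) →
  (∀ A → (∀ n → Positive (μ (A ↾ n))) → ∃ λ n → 1r ≤ d (A ↾ n)) →
  μ [] ≤ d []
capital-bound {d} {ν} {μ} total ν≥0 d≥0 fair μ-additive μ≤ν succeeds = ≤-stable λ m p →
  -- As `ν []` is 1, the gap is the value of `h` at the root.
  let q = m , ≤-trans p (-‿mono (≈-sym (≈-trans (*-congˡ total) (*-identityʳ _))))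
      A = path h-additive q
      (n , 1≤) = succeeds A (λ n → positive-mono (h≤μ (A ↾ n)) (path-positive h-additive q n))
  in positive⇒≰0 (path-positive h-additive q n) (h≤0 (A ↾ n) 1≤)
  where
  h : Str → ℝ
  h t = μ t - d t * ν t
  h-additive : Additive h
  h-additive = additive-sub μ-additive fair
  -‿mono : ∀ {x y z} → x ≈ y → z - x ≤ z - y
  -‿mono e = ≈⇒≤ (-‿congˡ e)
  h≤μ : ∀ t → h t ≤ μ t
  h≤μ t = ≤-from-sub (d t * ν t) (*-nonneg (d≥0 t) (ν≥0 t))
    (S.solve 2 (λ a b → a S.:= (a S.:- b) S.:+ b) ≈-refl (μ t) (d t * ν t))
  h≤0 : ∀ t → 1r ≤ d t → h t ≤ 0r
  h≤0 t 1≤ = ≤-trans (+-mono (μ≤ν t) (neg-mono (*-monoʳ (ν≥0 t) 1≤)))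
    (≈⇒≤ (S.solve 1 (λ a → a S.:- S.con 1ℚ S.:* a S.:= S.con 0ℚ) ≈-refl (ν t)))

-- Covering a cylinder and its complement

module _ (ν : ProbabilityMeasure) where

  prob-nonneg : NonNeg (prob ν)
  prob-nonneg t = fold-≤ (ProbabilityMeasure.nonneg ν t)

  prob-additive : Additive (prob ν)
  prob-additive t = fold-+ (ProbabilityMeasure.additive ν t)

  prob-total : prob ν [] ≈ 1r
  prob-total = fold-≈ (ProbabilityMeasure.total ν)

  capital-nonneg : (d : Martingale ν) → NonNeg (capital d)
  capital-nonneg d t = fold-≤ (Martingale.nonneg d t)

  capital-fair : (d : Martingale ν) → Fair (capital d) (prob ν)
  capital-fair d t = fold-fair (Martingale.fair d t)

  covering-capital : ∀ {μ} (X : Pred Cantor 0ℓ) (d : Martingale ν) → Additive μ → (∀ t → μ t ≤ prob ν t) →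
    (∀ A → (∀ n → Positive (μ (A ↾ n))) → X A) → (∀ {A} → X A → S¹[ d ] A) → μ [] ≤ capital d []
  covering-capital X d μ-additive μ≤ν supported covers =
    capital-bound prob-total prob-nonneg (capital-nonneg d) (capital-fair d) μ-additive μ≤ν
      λ A p → let (n , 1≤) = covers (supported A p) in n , fold-≤ 1≤

  module _ (w : Str) where

    inside-capital : (d : Martingale ν) → (∀ {A} → Cylinder w A → S¹[ d ] A) → prob ν w ≤ capital d []
    inside-capital d covers = ≤-trans (≈⇒≤ (≈-reflexive (≡.sym (mass-[] w (prob ν)))))
      (covering-capital (Cylinder w) d (mass-additive w prob-additive) (mass≤ w prob-additive prob-nonneg) supported covers)
      where
      supported : ∀ A → (∀ n → Positive (mass w (prob ν) (A ↾ n))) → Cylinder w A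
      supported A p with Listₚ.≡-dec Boolₚ._≟_ (A ↾ length w) w
      ... | yes e  = e
      ... | no  ≢w = ⊥-elim (positive⇒≰0 (p (length w)) (≈⇒≤ (≈-reflexive (mass-outside w (prob ν) A ≢w))))

    outside-capital : (d : Martingale ν) → (∀ {A} → ∁ (Cylinder w) A → S¹[ d ] A) → 1r - prob ν w ≤ capital d []
    outside-capital d covers = ≤-trans
      (≈⇒≤ (+-cong (≈-sym prob-total) (-‿cong (≈-reflexive (≡.sym (mass-[] w (prob ν)))))))
      (covering-capital (∁ (Cylinder w)) d (additive-sub prob-additive (mass-additive w prob-additive))
        (λ t → ≤-from-sub (mass w (prob ν) t) (mass≥0 w prob-nonneg t)
          (S.solve 2 (λ a b → a S.:= (a S.:- b) S.:+ b) ≈-refl (prob ν t) (mass w (prob ν) t)))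
        supported covers)
      where
      supported : ∀ A → (∀ n → Positive (prob ν (A ↾ n) - mass w (prob ν) (A ↾ n))) → ∁ (Cylinder w) A
      supported A p e = positive⇒≰0 (subst (λ t → Positive (prob ν t - mass w (prob ν) t)) e (p (length w)))
        (≈⇒≤ (≈-trans (-‿congˡ (≈-reflexive (mass-inside w (prob ν)))) (+-inverseʳ (prob ν w))))

  -- Covering and cost alone place `Φ⁺ r 𝟏` at the root between `ν(w)` and `ν(w) + 2^-r`. Hence the
  -- infimum is the same for every measurement.
  measure-of-cylinder : ∀ {ℓ} (Δ : Class ℓ) (w : Str) → MeasureIs Δ ν (Cylinder w) (prob ν w)
  measure-of-cylinder Δ w Φ = (λ r → ≤-unwrap (lower r)) , λ b b≤ → ≤-unwrap (≤-limitᵣ (λ r → upper b r (≤-wrap (b≤ r))))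
    where
    open Measurement Φ using (Φ⁺; Φ⁻; covers⁺; covers⁻; cost)
    in-S¹[𝟏] : ∀ {A} → S¹[ 𝟏 {ν} ] A
    in-S¹[𝟏] = 0 , unfold-1≤1
      where
      opaque
        unfolding ι
        unfold-1≤1 : 1ᵣ ≤ᵣ 1ᵣ
        unfold-1≤1 = ≤-unwrap (≤-refl {1r})
    lower : ∀ r → prob ν w ≤ capital (Φ⁺ r 𝟏) []
    lower r = inside-capital w (Φ⁺ r 𝟏) (λ {A} a∈ → covers⁺ r 𝟏 {A} (a∈ , in-S¹[𝟏] {A}))
    upper : ∀ b r → b ≤ capital (Φ⁺ r 𝟏) [] → b ≤ prob ν w + ι (2^- r)
    upper b r b≤ = ≤-trans b≤ (≤-trans
      (≈⇒≤ (S.solve 2 (λ x y → x S.:= (x S.:+ y) S.:- y) ≈-refl (capital (Φ⁺ r 𝟏) []) (capital (Φ⁻ r 𝟏) [])))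
      (≤-trans (+-mono (cost′ (fold-cost (cost r 𝟏)))
                       (neg-mono (outside-capital w (Φ⁻ r 𝟏) (λ {A} a∉ → covers⁻ r 𝟏 {A} (a∉ , in-S¹[𝟏] {A})))))
        (≈⇒≤ (S.solve 2 (λ e p → S.con 1ℚ S.:+ e S.:- (S.con 1ℚ S.:- p) S.:= p S.:+ e) ≈-refl (ι (2^- r)) (prob ν w)))))
      where
      opaque
        unfolding ι
        cost′ : ∀ {x y} → x + y ≤ 1ᵣ + ι (2^- r) → x + y ≤ 1r + ι (2^- r)
        cost′ h = h

-- The splitting operator

-- Whether `ν` vanishes at a string is given as data. The case is settled when the functional is
-- built, and no functional has to test a real for zero.
reciprocalOf : ∀ {x} → x ≈ᵣ 0ᵣ ⊎ (∃ λ l → fromℚ (2^- l) ≤ᵣ x) → ℝ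
reciprocalOf     (inj₁ _)       = 0r
reciprocalOf {x} (inj₂ (l , _)) = inv l x

reciprocalOf-nonneg : ∀ {x} c → 0r ≤ reciprocalOf {x} c
reciprocalOf-nonneg     (inj₁ _)       = ≤-refl
reciprocalOf-nonneg {x} (inj₂ (l , _)) = 0≤inv l x

reciprocalOf-* : ∀ {x} c → x ≈ 0r ⊎ x * reciprocalOf {x} c ≈ 1r
reciprocalOf-*     (inj₁ h)       = inj₁ (fold-≈ h)
reciprocalOf-* {x} (inj₂ (l , h)) = inj₂ (*-inv l x (fold-≤ h))

module _ (ν : ProbabilityMeasure)
         (zero-or-≥ : ∀ t → prob ν t ≈ᵣ 0ᵣ ⊎ (∃ λ l → fromℚ (2^- l) ≤ᵣ prob ν t)) where

  reciprocals : Str → ℝ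
  reciprocals t = reciprocalOf {prob ν t} (zero-or-≥ t)

  prob-gauge : Gauge (prob ν) reciprocals
  prob-gauge = record
    { ν≥0        = prob-nonneg ν
    ; ν-additive = prob-additive ν
    ; ρ≥0        = λ t → reciprocalOf-nonneg {prob ν t} (zero-or-≥ t)
    ; reciprocal = λ t → reciprocalOf-* {prob ν t} (zero-or-≥ t) }

  splitMartingale : Bool → Str → ℕ → Martingale ν → Martingale ν
  capital (splitMartingale σ w i d) = splitOff i σ (capital d) (prob ν) reciprocals w (ε i) 1r
  Martingale.nonneg (splitMartingale σ w i d) t =
    unfold-≤ (splitOff-nonneg i σ w (capital-nonneg ν d) prob-gauge (sufficient-init i) t)
  Martingale.fair (splitMartingale σ w i d) t =
    unfold-fair (splitOff-fair i σ w (capital-fair ν d) prob-gauge t)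

  split-cost : ∀ w i d →
    capital (splitMartingale true w i d) [] + capital (splitMartingale false w i d) [] ≤ capital d [] + ι (2^- i)
  split-cost w i d = ≈⇒≤ (≈-trans (≈-sym (*-identityʳ _)) (≈-trans (*-congˡ (≈-sym (prob-total ν)))
    (≈-trans (splitOff-cost i w (capital-fair ν d) prob-gauge) (≈-trans (*-congˡ (prob-total ν))
      (S.solve 2 (λ e x → (e S.:+ S.con 1ℚ S.:* x) S.:* S.con 1ℚ S.:= x S.:+ e) ≈-refl (ι (2^- i)) (capital d []))))))

  cylinderSplitting : ∀ w → SplittingOperator ν (Cylinder w) (∁ (Cylinder w))
  cylinderSplitting w = record
    { disjoint = λ _ (∈w , ∉w) → ∉w ∈w
    -- The permitted excess `2^-i` is spent on the initial frozen capital `ε`, so the index also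
    -- fixes the width of the soft stop.
    ; Φ        = λ i d → splitMartingale true w i d , splitMartingale false w i d
    ; Φ⁺-cong  = λ i h t → ≈-unwrap (splitOff-cong i true w (λ t → ≈-wrap (h t)) ≈-refl ≈-refl t)
    ; Φ⁻-cong  = λ i h t → ≈-unwrap (splitOff-cong i false w (λ t → ≈-wrap (h t)) ≈-refl ≈-refl t)
    ; covers⁺  = λ i d {A} (∈w , n , h) →
        let (m , h′) = splitOff-inside i w A (capital-nonneg ν d) (sufficient-init i) ∈w (inj₂ (n , fold-≤ h))
        in m , unfold-≤ h′
    ; covers⁻  = λ i d {A} (∉w , n , h) →
        let (m , h′) = splitOff-outside i w A (capital-nonneg ν d) (sufficient-init i) ∉w (inj₂ (n , fold-≤ h))
        in m , unfold-≤ h′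
    ; cost     = λ i d → unfold-cost (split-cost w i d) }

-- Transducers run in polynomial time

-- A transducer reads its inputs from left to right, each at its own speed, and
-- emits its output from left to right, or from right to left when reversed.

record Transducer (l : ℕ) : Set where
  field
    states   : ℕ
    reversed : Bool
    react    : Fin (suc states) → Vec Symbol l → Maybe (Fin (suc states) × Symbol × Vec Bool l)

current : Str → Symbol
current []      = blank
current (b ∷ x) = just b

advance : Bool → Str → Str
advance false x       = x
advance true  []      = []
advance true  (b ∷ x) = x

emit : Symbol → Str → Str
emit nothing  y = y
emit (just b) y = b ∷ y

module _ {l : ℕ} (T : Transducer l) where
  open Transducer T

  data Run : Fin (suc states) → Vec Str l → ℕ → Str → Set where
    stop : ∀ {s xs} → react s (Vec.map current xs) ≡ nothing → Run s xs 0 []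
    go   : ∀ {s s′ o adv xs n y} → react s (Vec.map current xs) ≡ just (s′ , o , adv) →
           Run s′ (Vec.zipWith advance adv xs) n y → Run s xs (suc n) (emit o y)

  headMove : Bool → Move
  headMove true  = rightwards
  headMove false = stay

  outputMove : Move
  outputMove = if reversed then leftwards else rightwards

  action : Vec Symbol l → Fin (suc states) × Symbol × Vec Bool l → Fin (suc states) × Vec (Symbol × Move) (l ℕ.+ 1)
  action heads (s , o , adv) = s , Vec.zipWith (λ h m → h , headMove m) heads adv Vec.++ (o , outputMove) ∷ []

  machine : Machine l
  machine = record
    { states = states
    ; work   = 0
    ; δ      = λ s heads → Maybe.map (action (Vec.take l heads)) (react s (Vec.take l heads)) }

  -- Only the unread part of an input is tracked: a head never moves back, so the cells to its left
  -- are arbitrary.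
  data At : Str → Tape → Set where
    atEnd  : ∀ {ls} → At [] (tape ls blank [])
    atCell : ∀ {ls b x} → At (b ∷ x) (tape ls (just b) (List.map just x))

  At-load : ∀ x → At x (load x)
  At-load []      = atEnd
  At-load (b ∷ x) = atCell

  At-head : ∀ {x t} → At x t → Tape.head t ≡ current x
  At-head atEnd  = refl
  At-head atCell = refl

  At-advance : ∀ {x t} → At x t → ∀ m → At (advance m x) (move (headMove m) (write (current x) t))
  At-advance atEnd                false = atEnd
  At-advance atEnd                true  = atEnd
  At-advance atCell               false = atCell
  At-advance (atCell {x = []})    true  = atEnd
  At-advance (atCell {x = _ ∷ _}) true  = atCell

  data Ats : ∀ {k} → Vec Str k → Vec Tape k → Set where
    []  : Ats [] []
    _∷_ : ∀ {k x t} {xs : Vec Str k} {ts} → At x t → Ats xs ts → Ats (x ∷ xs) (t ∷ ts)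

  Ats-load : ∀ {k} (xs : Vec Str k) → Ats xs (Vec.map load xs)
  Ats-load []       = []
  Ats-load (x ∷ xs) = At-load x ∷ Ats-load xs

  Ats-head : ∀ {k} {xs : Vec Str k} {ts} → Ats xs ts → Vec.map Tape.head ts ≡ Vec.map current xs
  Ats-head []       = refl
  Ats-head (a ∷ as) = cong₂ _∷_ (At-head a) (Ats-head as)

  perform : Symbol × Move → Tape → Tape
  perform (a , m) t = move m (write a t)

  Ats-advance : ∀ {k} {xs : Vec Str k} {ts} → Ats xs ts → ∀ ms →
    Ats (Vec.zipWith advance ms xs) (Vec.zipWith perform (Vec.zipWith (λ h m → h , headMove m) (Vec.map current xs) ms) ts)
  Ats-advance []       []       = []
  Ats-advance (a ∷ as) (m ∷ ms) = At-advance a m ∷ Ats-advance as ms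

  -- The written cells, nearest first.
  written : List Symbol → Tape
  written cs = if reversed then tape [] blank cs else tape cs blank []

  perform-output : ∀ o cs → perform (o , outputMove) (written cs) ≡ written (o ∷ cs)
  perform-output o cs with reversed
  ... | true  = refl
  ... | false = refl

  -- `inscription` always reads from left to right, so output emitted leftwards appears reversed and
  -- in front of what was written before.
  result : List Symbol → Str → Str
  result cs y = if reversed then reverse y ++ List.catMaybes cs else reverse (List.catMaybes cs) ++ y

  catMaybes-reverse : ∀ (cs : List Symbol) → List.catMaybes (reverse cs ++ blank ∷ []) ≡ reverse (List.catMaybes cs)
  catMaybes-reverse cs = ≡.trans (≡.trans (Listₚ.catMaybes-++ (reverse cs) (blank ∷ [])) (Listₚ.++-identityʳ _)) (lemma cs)
    where
    lemma : ∀ cs → List.catMaybes (reverse cs) ≡ reverse (List.catMaybes cs)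
    lemma []       = refl
    lemma (c ∷ cs) = ≡.trans (cong List.catMaybes (Listₚ.unfold-reverse c cs))
      (≡.trans (Listₚ.catMaybes-++ (reverse cs) (c ∷ []))
        (≡.trans (cong (_++ List.catMaybes (c ∷ [])) (lemma cs)) (last c)))
      where
      last : ∀ c → reverse (List.catMaybes cs) ++ List.catMaybes (c ∷ []) ≡ reverse (List.catMaybes (c ∷ cs))
      last nothing  = Listₚ.++-identityʳ _
      last (just b) = ≡.sym (Listₚ.unfold-reverse b (List.catMaybes cs))

  inscription-written : ∀ cs → inscription (written cs) ≡ result cs []
  inscription-written cs with reversed
  ... | true  = refl
  ... | false = ≡.trans (catMaybes-reverse cs) (≡.sym (Listₚ.++-identityʳ _))

  result-emit : ∀ o cs y → result (o ∷ cs) y ≡ result cs (emit o y)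
  result-emit nothing  cs y with reversed
  ... | true  = refl
  ... | false = refl
  result-emit (just b) cs y with reversed
  ... | true  = ≡.sym (≡.trans (cong (_++ List.catMaybes cs) (Listₚ.unfold-reverse b y))
                  (Listₚ.++-assoc (reverse y) (b ∷ []) (List.catMaybes cs)))
  ... | false = ≡.trans (cong (_++ y) (Listₚ.unfold-reverse b (List.catMaybes cs)))
                  (Listₚ.++-assoc (reverse (List.catMaybes cs)) (b ∷ []) y)

  take-++ : ∀ {A : Set} {k} (u : Vec A k) (v : Vec A 1) → Vec.take k (u Vec.++ v) ≡ u
  take-++ []      v = refl
  take-++ (x ∷ u) v = cong (x ∷_) (take-++ u v)

  heads-of : ∀ {xs ts} o → Ats xs ts → Vec.take l (Vec.map Tape.head (ts Vec.++ o ∷ [])) ≡ Vec.map current xs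
  heads-of {xs} {ts} o as = ≡.trans (cong (Vec.take l) (Vecₚ.map-++ Tape.head ts (o ∷ [])))
    (≡.trans (take-++ (Vec.map Tape.head ts) (Tape.head o ∷ [])) (Ats-head as))

  lookup-output : ∀ {k} (ts : Vec Tape k) o → Vec.lookup (ts Vec.++ o ∷ []) (k ↑ʳ zero) ≡ o
  lookup-output []       o = refl
  lookup-output (t ∷ ts) o = lookup-output ts o

  Halts : Config machine → ℕ → Str → Set
  Halts = _⇓[_]_ machine

  simulate : ∀ {s xs n y ts} cs → Ats xs ts → Run s xs n y → Halts (s , ts Vec.++ written cs ∷ []) n (result cs y)
  simulate {s} {xs} {ts = ts} cs as (stop eq) =
    subst (Halts (s , ts Vec.++ written cs ∷ []) 0)
      (≡.trans (cong inscription (lookup-output ts (written cs))) (inscription-written cs))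
      (halt halted)
    where
    halted : step machine (s , ts Vec.++ written cs ∷ []) ≡ nothing
    halted rewrite heads-of (written cs) as | eq = refl
  simulate {s} {xs} {ts = ts} cs as (go {s′ = s′} {o = o} {adv = adv} {n = n} {y = y} eq r) =
    subst (Halts (s , ts Vec.++ written cs ∷ []) (suc n)) (result-emit o cs y)
      (next stepped (simulate (o ∷ cs) (Ats-advance as adv) r))
    where
    acts : Vec (Symbol × Move) l
    acts = Vec.zipWith (λ h m → h , headMove m) (Vec.map current xs) adv
    performed : ∀ {k} (as : Vec (Symbol × Move) k) ts → Vec.zipWith perform (as Vec.++ (o , outputMove) ∷ []) (ts Vec.++ written cs ∷ [])
      ≡ Vec.zipWith perform as ts Vec.++ written (o ∷ cs) ∷ []
    performed []       []       = cong (_∷ []) (perform-output o cs)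
    performed (a ∷ as) (t ∷ ts) = cong (perform a t ∷_) (performed as ts)
    stepped : step machine (s , ts Vec.++ written cs ∷ []) ≡ just (s′ , Vec.zipWith perform acts ts Vec.++ written (o ∷ cs) ∷ [])
    stepped rewrite heads-of (written cs) as | eq = cong (λ v → just (s′ , v)) (performed acts ts)

  -- One pass over the inputs gives a linear bound. The step beyond the input size pays for a final
  -- carry, or for a constant bit when there is no input.
  transducer-polynomialTime : (f : Vec Str l → Str) →
    (∀ xs → ∃₂ λ n y → n ℕ.≤ suc (size xs) × Run zero xs n y × f xs ≡ result [] y) → PolynomialTime f
  transducer-polynomialTime f runs = machine , 1 , 1 , λ xs →
    let (n , y , n≤ , r , eq) = runs xs
    in n , subst (n ℕ.≤_) (linear (size xs)) n≤ ,
       subst₂ (λ t z → Halts (zero , Vec.map load xs Vec.++ t ∷ []) n z) empty-output (≡.sym eq) (simulate [] (Ats-load xs) r)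
    where
    linear : ∀ m → suc m ≡ 1 ℕ.* m ℕ.^ 1 ℕ.+ 1
    linear m = ≡.sym (≡.trans (cong (ℕ._+ 1) (≡.trans (ℕₚ.*-identityˡ (m ℕ.^ 1)) (ℕₚ.*-identityʳ m))) (ℕₚ.+-comm m 1))
    empty-output : written [] ≡ load []
    empty-output with reversed
    ... | true  = refl
    ... | false = refl

-- String functions computed by transducers

length≤size : ∀ {l} (xs : Vec Str l) i → length (Vec.lookup xs i) ℕ.≤ size xs
length≤size (x ∷ xs) zero    = ℕₚ.m≤m+n (length x) (size xs)
length≤size (x ∷ xs) (suc i) = ℕₚ.m≤n⇒m≤o+n (length x) (length≤size xs i)

module _ {l : ℕ} (i : Fin l) where

  projector : Transducer l
  projector = record { states = 0 ; reversed = false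
    ; react = λ _ hs → Maybe.map (λ b → zero , just b , Vec.replicate l true) (Vec.lookup hs i) }

  projector-run : ∀ x xs → Vec.lookup xs i ≡ x → Run projector zero xs (length x) x
  projector-run [] xs eq = stop (cong (Maybe.map _) (≡.trans (Vecₚ.lookup-map i current xs) (cong current eq)))
  projector-run (b ∷ x) xs eq = go (cong (Maybe.map _) (≡.trans (Vecₚ.lookup-map i current xs) (cong current eq)))
    (projector-run x _ (≡.trans (Vecₚ.lookup-zipWith advance i (Vec.replicate l true) xs)
      (cong₂ advance (Vecₚ.lookup-replicate i true) eq)))

  projection-polynomialTime : PolynomialTime (λ (xs : Vec Str l) → Vec.lookup xs i)
  projection-polynomialTime = transducer-polynomialTime projector _ λ xs →
    _ , _ , ℕₚ.m≤n⇒m≤1+n (length≤size xs i) , projector-run _ xs refl , refl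

bitWriter : Bool → Transducer 0
bitWriter b = record { states = 1 ; reversed = false
  ; react = λ { zero _ → just (suc zero , just b , []) ; (suc zero) _ → nothing } }

bit-polynomialTime : ∀ b → PolynomialTime {0} (λ _ → b ∷ [])
bit-polynomialTime b = transducer-polynomialTime (bitWriter b) _ λ { [] → 1 , _ , ℕ.s≤s ℕ.z≤n , go refl (stop refl) , refl }

map₁ : (Str → Str) → Vec Str 1 → Str
map₁ f (x ∷ []) = f x

map₂ : (Str → Str → Str) → Vec Str 2 → Str
map₂ f (x ∷ y ∷ []) = f x y

map₃ : (Str → Str → Str → Str) → Vec Str 3 → Str
map₃ f (x ∷ y ∷ z ∷ []) = f x y z

appender : Transducer 2
appender = record { states = 0 ; reversed = false ; react = λ _ → react }
  where
  react : Vec Symbol 2 → Maybe (Fin 1 × Symbol × Vec Bool 2)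
  react (just b  ∷ _      ∷ []) = just (zero , just b , true ∷ false ∷ [])
  react (nothing ∷ just b ∷ []) = just (zero , just b , false ∷ true ∷ [])
  react (nothing ∷ nothing ∷ []) = nothing

append-polynomialTime : PolynomialTime (map₂ _++_)
append-polynomialTime = transducer-polynomialTime appender _ λ { (x ∷ y ∷ []) →
  length x ℕ.+ length y , x ++ y , ℕₚ.m≤n⇒m≤1+n (ℕₚ.≤-reflexive (cong (length x ℕ.+_) (≡.sym (ℕₚ.+-identityʳ (length y))))) , run x y , refl }
  where
  run : ∀ x y → Run appender zero (x ∷ y ∷ []) (length x ℕ.+ length y) (x ++ y)
  run (b ∷ x) y       = go refl (run x y)
  run []      (b ∷ y) = go refl (run [] y)
  run []      []      = stop refl

mapper : Bool → (Bool → Bool) → Transducer 1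
mapper rev g = record { states = 0 ; reversed = rev
  ; react = λ { _ (h ∷ []) → Maybe.map (λ b → zero , just (g b) , true ∷ []) h } }

mapper-run : ∀ rev g x → Run (mapper rev g) zero (x ∷ []) (length x) (List.map g x)
mapper-run rev g []      = stop refl
mapper-run rev g (b ∷ x) = go refl (mapper-run rev g x)

reverse-polynomialTime : PolynomialTime (map₁ reverse)
reverse-polynomialTime = transducer-polynomialTime (mapper true (λ b → b)) _ λ { (x ∷ []) →
  _ , _ , ℕₚ.m≤n⇒m≤1+n (ℕₚ.m≤m+n (length x) 0) , mapper-run true (λ b → b) x ,
  ≡.trans (cong reverse (≡.sym (Listₚ.map-id x))) (≡.sym (Listₚ.++-identityʳ _)) }

repeat : Bool → Str → Str
repeat b x = replicate (length x) b

repeat-polynomialTime : ∀ b → PolynomialTime (map₁ (repeat b))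
repeat-polynomialTime b = transducer-polynomialTime (mapper false (λ _ → b)) _ λ { (x ∷ []) →
  _ , _ , ℕₚ.m≤n⇒m≤1+n (ℕₚ.m≤m+n (length x) 0) , mapper-run false (λ _ → b) x , map-const x }
  where
  map-const : ∀ x → repeat b x ≡ List.map (λ _ → b) x
  map-const []      = refl
  map-const (_ ∷ x) = cong (b ∷_) (map-const x)

isTrue : Symbol → Bool
isTrue (just b) = b
isTrue nothing  = false

-- An empty test counts as false. So `repeat true x` tests whether `x` is nonempty, and a pass that
-- emits nothing answers no.
choose : Str → Str → Str → Str
choose a x y = if isTrue (current a) then x else y

chooser : Transducer 3
chooser = record { states = 0 ; reversed = false ; react = λ { _ (a ∷ x ∷ y ∷ []) → react (isTrue a) x y } }
  where
  react : Bool → Symbol → Symbol → Maybe (Fin 1 × Symbol × Vec Bool 3)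
  react true  x y = Maybe.map (λ b → zero , just b , false ∷ true ∷ false ∷ []) x
  react false x y = Maybe.map (λ b → zero , just b , false ∷ false ∷ true ∷ []) y

choose-polynomialTime : PolynomialTime (map₃ choose)
choose-polynomialTime = transducer-polynomialTime chooser _ λ { (a ∷ x ∷ y ∷ []) → runs a x y }
  where
  run-true : ∀ a x y → isTrue (current a) ≡ true → Run chooser zero (a ∷ x ∷ y ∷ []) (length x) x
  run-true a []      y eq = stop (reacts eq)
    where
    reacts : isTrue (current a) ≡ true → Transducer.react chooser zero (current a ∷ nothing ∷ current y ∷ []) ≡ nothing
    reacts eq rewrite eq = refl
  run-true a (b ∷ x) y eq = go (reacts eq) (run-true a x y eq)
    where
    reacts : isTrue (current a) ≡ true → Transducer.react chooser zero (current a ∷ just b ∷ current y ∷ []) ≡ just (zero , just b , false ∷ true ∷ false ∷ [])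
    reacts eq rewrite eq = refl
  run-false : ∀ a x y → isTrue (current a) ≡ false → Run chooser zero (a ∷ x ∷ y ∷ []) (length y) y
  run-false a x []      eq = stop (reacts eq)
    where
    reacts : isTrue (current a) ≡ false → Transducer.react chooser zero (current a ∷ current x ∷ nothing ∷ []) ≡ nothing
    reacts eq rewrite eq = refl
  run-false a x (b ∷ y) eq = go (reacts eq) (run-false a x y eq)
    where
    reacts : isTrue (current a) ≡ false → Transducer.react chooser zero (current a ∷ current x ∷ just b ∷ []) ≡ just (zero , just b , false ∷ false ∷ true ∷ [])
    reacts eq rewrite eq = refl
  runs : ∀ a x y → ∃₂ λ n z → n ℕ.≤ suc (size (a ∷ x ∷ y ∷ [])) × Run chooser zero (a ∷ x ∷ y ∷ []) n z × choose a x y ≡ z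
  runs a x y with isTrue (current a) in eq
  ... | true  = _ , _ , ℕₚ.m≤n⇒m≤1+n (length≤size (a ∷ x ∷ y ∷ []) (suc zero)) , run-true a x y eq , refl
  ... | false = _ , _ , ℕₚ.m≤n⇒m≤1+n (length≤size (a ∷ x ∷ y ∷ []) (suc (suc zero))) , run-false a x y eq , refl

-- Blanks are read as zeros.

module Carrying (next : Bool → Bool → Bool → Bool) (out : Bool → Bool → Bool → Symbol) (final : Bool → Symbol) where

  carrying : Bool → Str → Str → Str
  carrying c []      []      = emit (final c) []
  carrying c (a ∷ x) []      = emit (out c a false) (carrying (next c a false) x [])
  carrying c []      (b ∷ y) = emit (out c false b) (carrying (next c false b) [] y)
  carrying c (a ∷ x) (b ∷ y) = emit (out c a b) (carrying (next c a b) x y)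

  -- The remaining state is entered after the final symbol and halts.
  code : Bool → Fin 3
  code false = zero
  code true  = suc zero

  reactTo : Bool → Symbol → Symbol → Maybe (Fin 3 × Symbol × Vec Bool 2)
  reactTo c nothing  nothing  = just (suc (suc zero) , final c , true ∷ true ∷ [])
  reactTo c (just a) nothing  = just (code (next c a false) , out c a false , true ∷ true ∷ [])
  reactTo c nothing  (just b) = just (code (next c false b) , out c false b , true ∷ true ∷ [])
  reactTo c (just a) (just b) = just (code (next c a b) , out c a b , true ∷ true ∷ [])

  react : Fin 3 → Vec Symbol 2 → Maybe (Fin 3 × Symbol × Vec Bool 2)
  react zero          (a ∷ b ∷ []) = reactTo false a b
  react (suc zero)    (a ∷ b ∷ []) = reactTo true a b
  react (suc (suc _)) _            = nothing

  react-code : ∀ c a b → react (code c) (a ∷ b ∷ []) ≡ reactTo c a b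
  react-code false a b = refl
  react-code true  a b = refl

  transducer : Transducer 2
  transducer = record { states = 2 ; reversed = false ; react = react }

  steps : Str → Str → ℕ
  steps []      []      = 1
  steps (_ ∷ x) []      = suc (steps x [])
  steps []      (_ ∷ y) = suc (steps [] y)
  steps (_ ∷ x) (_ ∷ y) = suc (steps x y)

  steps≤ : ∀ x y → steps x y ℕ.≤ suc (length x ℕ.+ length y)
  steps≤ []      []      = ℕₚ.≤-refl
  steps≤ (_ ∷ x) []      = ℕ.s≤s (steps≤ x [])
  steps≤ []      (_ ∷ y) = ℕ.s≤s (steps≤ [] y)
  steps≤ (_ ∷ x) (_ ∷ y) = ℕ.s≤s (ℕₚ.m≤n⇒m≤1+n (ℕₚ.≤-trans (steps≤ x y)
    (ℕₚ.≤-reflexive (≡.sym (ℕₚ.+-suc (length x) (length y))))))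

  run : ∀ c x y → Run transducer (code c) (x ∷ y ∷ []) (steps x y) (carrying c x y)
  run c []      []      = go (react-code c nothing nothing) (stop refl)
  run c (a ∷ x) []      = go (react-code c (just a) nothing) (run (next c a false) x [])
  run c []      (b ∷ y) = go (react-code c nothing (just b)) (run (next c false b) [] y)
  run c (a ∷ x) (b ∷ y) = go (react-code c (just a) (just b)) (run (next c a b) x y)

  carrying-polynomialTime : PolynomialTime (map₂ (carrying false))
  carrying-polynomialTime = transducer-polynomialTime transducer _ λ { (x ∷ y ∷ []) →
    _ , _ , ℕₚ.≤-trans (steps≤ x y) (ℕ.s≤s (ℕₚ.≤-reflexive (cong (length x ℕ.+_) (≡.sym (ℕₚ.+-identityʳ (length y)))))) ,
    run false x y , refl }

dropFirst : Str → Str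
dropFirst []      = []
dropFirst (_ ∷ x) = x

afterTrue : Str → Str
afterTrue []          = []
afterTrue (true  ∷ x) = x
afterTrue (false ∷ x) = afterTrue x

-- Skips symbols until the given one, or the first one if none is given.

skipper : Maybe Bool → Transducer 1
skipper until = record { states = 1 ; reversed = false ; react = react }
  where
  after : Bool → Fin 2
  after b = if Maybe.maybe′ (λ u → if u then b else not b) true until then suc zero else zero
  react : Fin 2 → Vec Symbol 1 → Maybe (Fin 2 × Symbol × Vec Bool 1)
  react zero       (h ∷ []) = Maybe.map (λ b → after b , nothing , true ∷ []) h
  react (suc zero) (h ∷ []) = Maybe.map (λ b → suc zero , just b , true ∷ []) h

skipper-copies : ∀ u x → Run (skipper u) (suc zero) (x ∷ []) (length x) x
skipper-copies u []      = stop refl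
skipper-copies u (b ∷ x) = go refl (skipper-copies u x)

dropFirst-polynomialTime : PolynomialTime (map₁ dropFirst)
dropFirst-polynomialTime = transducer-polynomialTime (skipper nothing) _ λ { (x ∷ []) →
  _ , _ , ℕₚ.m≤n⇒m≤1+n (ℕₚ.m≤m+n (length x) 0) , run x , refl }
  where
  run : ∀ x → Run (skipper nothing) zero (x ∷ []) (length x) (dropFirst x)
  run []      = stop refl
  run (b ∷ x) = go refl (skipper-copies nothing x)

afterTrue-polynomialTime : PolynomialTime (map₁ afterTrue)
afterTrue-polynomialTime = transducer-polynomialTime (skipper (just true)) _ λ { (x ∷ []) →
  _ , _ , ℕₚ.m≤n⇒m≤1+n (ℕₚ.m≤m+n (length x) 0) , run x , refl }
  where
  run : ∀ x → Run (skipper (just true)) zero (x ∷ []) (length x) (afterTrue x)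
  run []          = stop refl
  run (true  ∷ x) = go refl (skipper-copies (just true) x)
  run (false ∷ x) = go refl (run x)

-- The leading zeros of the first argument count the symbols of the second one
-- to be taken or dropped.

takeZeros dropZeros : Str → Str → Str
takeZeros (false ∷ z) (b ∷ y) = b ∷ takeZeros z y
takeZeros _           _       = []
dropZeros (false ∷ z) (b ∷ y) = dropZeros z y
dropZeros _           y       = y

taker dropper : Transducer 2
taker = record { states = 0 ; reversed = false ; react = λ _ → react }
  where
  react : Vec Symbol 2 → Maybe (Fin 1 × Symbol × Vec Bool 2)
  react (just false ∷ just b  ∷ []) = just (zero , just b , true ∷ true ∷ [])
  react (just false ∷ nothing ∷ []) = nothing
  react (just true  ∷ _       ∷ []) = nothing
  react (nothing    ∷ _       ∷ []) = nothing
dropper = record { states = 0 ; reversed = false ; react = λ _ → react }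
  where
  react : Vec Symbol 2 → Maybe (Fin 1 × Symbol × Vec Bool 2)
  react (_          ∷ nothing ∷ []) = nothing
  react (just false ∷ just b  ∷ []) = just (zero , nothing , true ∷ true ∷ [])
  react (just true  ∷ just b  ∷ []) = just (zero , just b , false ∷ true ∷ [])
  react (nothing    ∷ just b  ∷ []) = just (zero , just b , false ∷ true ∷ [])

takeZeros-polynomialTime : PolynomialTime (map₂ takeZeros)
takeZeros-polynomialTime = transducer-polynomialTime taker _ λ { (z ∷ y ∷ []) →
  _ , _ , ℕₚ.m≤n⇒m≤1+n (ℕₚ.≤-trans (short z y) (length≤size (z ∷ y ∷ []) (suc zero))) , run z y , refl }
  where
  short : ∀ z y → length (takeZeros z y) ℕ.≤ length y
  short []          y       = ℕ.z≤n
  short (true  ∷ z) y       = ℕ.z≤n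
  short (false ∷ z) []      = ℕ.z≤n
  short (false ∷ z) (b ∷ y) = ℕ.s≤s (short z y)
  run : ∀ z y → Run taker zero (z ∷ y ∷ []) (length (takeZeros z y)) (takeZeros z y)
  run []          y       = stop refl
  run (true  ∷ z) y       = stop refl
  run (false ∷ z) []      = stop refl
  run (false ∷ z) (b ∷ y) = go refl (run z y)

dropZeros-polynomialTime : PolynomialTime (map₂ dropZeros)
dropZeros-polynomialTime = transducer-polynomialTime dropper _ λ { (z ∷ y ∷ []) →
  _ , _ , ℕₚ.m≤n⇒m≤1+n (length≤size (z ∷ y ∷ []) (suc zero)) , run z y , refl }
  where
  run : ∀ z y → Run dropper zero (z ∷ y ∷ []) (length y) (dropZeros z y)
  run []          []      = stop refl
  run (true  ∷ z) []      = stop refl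
  run (false ∷ z) []      = stop refl
  run []          (b ∷ y) = go refl (run [] y)
  run (true  ∷ z) (b ∷ y) = go refl (run (true ∷ z) y)
  run (false ∷ z) (b ∷ y) = go refl (run z y)

-- Binary arithmetic

module N = ℕSolver.+-*-Solver

bit : Bool → ℕ
bit b = if b then 1 else 0

bit≤1 : ∀ b → bit b ℕ.≤ 1
bit≤1 false = ℕ.z≤n
bit≤1 true  = ℕₚ.≤-refl

-- Least significant bit first.

val : Str → ℕ
val []      = 0
val (b ∷ x) = bit b ℕ.+ 2 ℕ.* val x

numeral-reverse : ∀ x → numeral (reverse x) ≡ val x
numeral-reverse []      = refl
numeral-reverse (b ∷ x) = ≡.trans (cong numeral (Listₚ.unfold-reverse b x))
  (≡.trans (Listₚ.foldl-∷ʳ _ 0 b (reverse x))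
    (≡.trans (ℕₚ.+-comm (2 ℕ.* numeral (reverse x)) (bit b)) (cong (λ n → bit b ℕ.+ 2 ℕ.* n) (numeral-reverse x))))

val-reverse : ∀ x → val (reverse x) ≡ numeral x
val-reverse x = ≡.trans (≡.sym (numeral-reverse (reverse x))) (cong numeral (Listₚ.reverse-involutive x))

module Adding = Carrying
  (λ c a b → (a ∧ b) ∨ (c ∧ (a ∨ b))) (λ c a b → just (c xor (a xor b))) (λ c → if c then just true else nothing)

plus : Str → Str → Str
plus = Adding.carrying false

full-adder : ∀ c a b → bit (c xor (a xor b)) ℕ.+ 2 ℕ.* bit ((a ∧ b) ∨ (c ∧ (a ∨ b))) ≡ bit c ℕ.+ bit a ℕ.+ bit b
full-adder false false false = refl
full-adder false false true  = refl
full-adder false true  false = refl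
full-adder false true  true  = refl
full-adder true  false false = refl
full-adder true  false true  = refl
full-adder true  true  false = refl
full-adder true  true  true  = refl

adding-step : ∀ c a b X Y →
  bit (c xor (a xor b)) ℕ.+ 2 ℕ.* (bit ((a ∧ b) ∨ (c ∧ (a ∨ b))) ℕ.+ (X ℕ.+ Y)) ≡
  bit c ℕ.+ ((bit a ℕ.+ 2 ℕ.* X) ℕ.+ (bit b ℕ.+ 2 ℕ.* Y))
adding-step c a b X Y = ≡.trans
  (N.solve 4 (λ s m x y → s N.:+ N.con 2 N.:* (m N.:+ (x N.:+ y)) N.:= (s N.:+ N.con 2 N.:* m) N.:+ N.con 2 N.:* (x N.:+ y)) refl
    (bit (c xor (a xor b))) (bit ((a ∧ b) ∨ (c ∧ (a ∨ b)))) X Y)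
  (≡.trans (cong (ℕ._+ 2 ℕ.* (X ℕ.+ Y)) (full-adder c a b))
    (N.solve 5 (λ c a b x y → c N.:+ a N.:+ b N.:+ N.con 2 N.:* (x N.:+ y) N.:= c N.:+ ((a N.:+ N.con 2 N.:* x) N.:+ (b N.:+ N.con 2 N.:* y))) refl
      (bit c) (bit a) (bit b) X Y))

val-adding : ∀ c x y → val (Adding.carrying c x y) ≡ bit c ℕ.+ (val x ℕ.+ val y)
val-adding false []      []      = refl
val-adding true  []      []      = refl
val-adding c     (a ∷ x) []      = ≡.trans (cong (λ n → bit (c xor (a xor false)) ℕ.+ 2 ℕ.* n) (val-adding _ x [])) (adding-step c a false (val x) 0)
val-adding c     []      (b ∷ y) = ≡.trans (cong (λ n → bit (c xor (false xor b)) ℕ.+ 2 ℕ.* n) (val-adding _ [] y)) (adding-step c false b 0 (val y))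
val-adding c     (a ∷ x) (b ∷ y) = ≡.trans (cong (λ n → bit (c xor (a xor b)) ℕ.+ 2 ℕ.* n) (val-adding _ x y)) (adding-step c a b (val x) (val y))

val-plus : ∀ x y → val (plus x y) ≡ val x ℕ.+ val y
val-plus = val-adding false

length-adding : ∀ c x y → length (Adding.carrying c x y) ℕ.≤ suc (length x ℕ.⊔ length y)
length-adding false []      []      = ℕ.z≤n
length-adding true  []      []      = ℕₚ.≤-refl
length-adding c     (a ∷ x) []      = ℕ.s≤s (subst (λ n → length (Adding.carrying ((a ∧ false) ∨ (c ∧ (a ∨ false))) x []) ℕ.≤ suc n) (ℕₚ.⊔-identityʳ (length x)) (length-adding _ x []))
length-adding c     []      (b ∷ y) = ℕ.s≤s (length-adding _ [] y)
length-adding c     (a ∷ x) (b ∷ y) = ℕ.s≤s (length-adding _ x y)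

borrow : Bool → Bool → Bool → Bool
borrow c a b = (b ∧ c) ∨ (not a ∧ (b ∨ c))

module Subtracting = Carrying borrow (λ c a b → just (c xor (a xor b))) (λ _ → nothing)
module Comparing   = Carrying borrow (λ _ _ _ → nothing) (λ c → if c then just true else nothing)

-- An underflow shows only after the last digit, when a single pass has already written its output.
-- A separate pass therefore computes just the final borrow.
monus : Str → Str → Str
monus x y = choose (Comparing.carrying false x y) [] (Subtracting.carrying false x y)

full-subtractor : ∀ c a b → bit a ℕ.+ 2 ℕ.* bit (borrow c a b) ≡ bit b ℕ.+ bit c ℕ.+ bit (c xor (a xor b))
full-subtractor false false false = refl
full-subtractor false false true  = refl
full-subtractor false true  false = refl
full-subtractor false true  true  = refl
full-subtractor true  false false = refl
full-subtractor true  false true  = refl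
full-subtractor true  true  false = refl
full-subtractor true  true  true  = refl

-- c is the incoming borrow, x the outgoing one and z the difference of the digits.

data Difference (c : Bool) (m n : ℕ) (x : Str) (z : Str) : Set where
  underflow : isTrue (current x) ≡ true → m ℕ.< n ℕ.+ bit c → Difference c m n x z
  exact     : isTrue (current x) ≡ false → m ≡ n ℕ.+ bit c ℕ.+ val z → Difference c m n x z

difference-step : ∀ c a b {X Y x z} → Difference (borrow c a b) X Y x z →
  Difference c (bit a ℕ.+ 2 ℕ.* X) (bit b ℕ.+ 2 ℕ.* Y) x ((c xor (a xor b)) ∷ z)
difference-step c a b {X} {Y} {z = z} (exact e h) = exact e (≡.trans (cong (λ n → bit a ℕ.+ 2 ℕ.* n) h)
  (≡.trans (N.solve 4 (λ a y m z → a N.:+ N.con 2 N.:* (y N.:+ m N.:+ z) N.:= (a N.:+ N.con 2 N.:* m) N.:+ N.con 2 N.:* (y N.:+ z)) refl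
      (bit a) Y (bit (borrow c a b)) (val z))
    (≡.trans (cong (ℕ._+ 2 ℕ.* (Y ℕ.+ val z)) (full-subtractor c a b))
      (N.solve 5 (λ b c s y z → b N.:+ c N.:+ s N.:+ N.con 2 N.:* (y N.:+ z) N.:= b N.:+ N.con 2 N.:* y N.:+ c N.:+ (s N.:+ N.con 2 N.:* z)) refl
        (bit b) (bit c) (bit (c xor (a xor b))) Y (val z)))))
difference-step c a b {X} {Y} (underflow e h) = underflow e
  -- Doubling `X + 1 ≤ Y + bit (borrow c a b)` gains 2, which exceeds the difference digit by at
  -- least 1; this 1 is cancelled at the end.
  (ℕₚ.+-cancelʳ-≤ 1 _ _ (ℕₚ.≤-trans (ℕₚ.≤-reflexive (N.solve 2 (λ a x → N.con 1 N.:+ (a N.:+ N.con 2 N.:* x) N.:+ N.con 1 N.:= a N.:+ N.con 2 N.:* (N.con 1 N.:+ x)) refl (bit a) X))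
    (ℕₚ.≤-trans (ℕₚ.+-monoʳ-≤ (bit a) (ℕₚ.*-monoʳ-≤ 2 h))
      (ℕₚ.≤-trans (ℕₚ.≤-reflexive (≡.trans
          (N.solve 3 (λ a y m → a N.:+ N.con 2 N.:* (y N.:+ m) N.:= (a N.:+ N.con 2 N.:* m) N.:+ N.con 2 N.:* y) refl (bit a) Y (bit (borrow c a b)))
          (cong (ℕ._+ 2 ℕ.* Y) (full-subtractor c a b))))
        (ℕₚ.≤-trans (ℕₚ.+-monoˡ-≤ (2 ℕ.* Y) (ℕₚ.+-monoʳ-≤ (bit b ℕ.+ bit c) (bit≤1 (c xor (a xor b)))))
          (ℕₚ.≤-reflexive (N.solve 3 (λ b c y → b N.:+ c N.:+ N.con 1 N.:+ N.con 2 N.:* y N.:= b N.:+ N.con 2 N.:* y N.:+ c N.:+ N.con 1) refl (bit b) (bit c) Y)))))))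

difference : ∀ c x y → Difference c (val x) (val y) (Comparing.carrying c x y) (Subtracting.carrying c x y)
difference false []      []      = exact refl refl
difference true  []      []      = underflow refl (ℕ.s≤s ℕ.z≤n)
difference c     (a ∷ x) []      = difference-step c a false (difference _ x [])
difference c     []      (b ∷ y) = difference-step c false b (difference _ [] y)
difference c     (a ∷ x) (b ∷ y) = difference-step c a b (difference _ x y)

val-monus : ∀ x y → val (monus x y) ≡ val x ℕ.∸ val y
val-monus x y with difference false x y
... | underflow e h rewrite e = ≡.sym (ℕₚ.m≤n⇒m∸n≡0 (ℕₚ.<⇒≤ (subst (val x ℕ.<_) (ℕₚ.+-identityʳ (val y)) h)))
... | exact e h rewrite e = ≡.sym (≡.trans (cong (ℕ._∸ val y) (≡.trans h (cong (ℕ._+ val (Subtracting.carrying false x y)) (ℕₚ.+-identityʳ (val y)))))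
  (ℕₚ.m+n∸m≡n (val y) _))

times : Str → Str → Str
times x []      = []
times x (b ∷ y) = plus (if b then x else []) (false ∷ times x y)

val-times : ∀ x y → val (times x y) ≡ val x ℕ.* val y
val-times x []      = ≡.sym (ℕₚ.*-zeroʳ (val x))
val-times x (b ∷ y) = ≡.trans (val-plus (if b then x else []) (false ∷ times x y))
  (≡.trans (cong₂ (λ m n → m ℕ.+ 2 ℕ.* n) (partial b) (val-times x y))
    (N.solve 3 (λ b x y → b N.:* x N.:+ N.con 2 N.:* (x N.:* y) N.:= x N.:* (b N.:+ N.con 2 N.:* y)) refl (bit b) (val x) (val y)))
  where
  partial : ∀ b → val (if b then x else []) ≡ bit b ℕ.* val x
  partial false = refl
  partial true  = ≡.sym (ℕₚ.*-identityˡ (val x))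

-- Each digit of `y` adds one symbol by the shift and at most one by a carry. The bound has the form
-- of a concatenation, which limited recursion can use.
length-times : ∀ x y → length (times x y) ℕ.≤ length x ℕ.+ (length y ℕ.+ length y)
length-times x []      = ℕ.z≤n
length-times x (b ∷ y) = ℕₚ.≤-trans (length-adding false (if b then x else []) (false ∷ times x y))
  (ℕₚ.≤-trans (ℕ.s≤s (ℕₚ.⊔-lub (ℕₚ.≤-trans (partial b) (ℕₚ.m≤n⇒m≤1+n (ℕₚ.m≤m+n (length x) _))) (ℕ.s≤s (length-times x y))))
    (ℕₚ.≤-reflexive (N.solve 2 (λ x y → N.con 1 N.:+ (N.con 1 N.:+ (x N.:+ (y N.:+ y))) N.:= x N.:+ (N.con 1 N.:+ y N.:+ (N.con 1 N.:+ y))) refl (length x) (length y))))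
  where
  partial : ∀ b → length (if b then x else []) ℕ.≤ length x
  partial false = ℕ.z≤n
  partial true  = ℕₚ.≤-refl

-- Arithmetic by basic feasible functionals

module _ {ℓ} {Δ : Class ℓ} where

  -- `expansion` produces the arity `l + 0`, which does not reduce to `l`; hence the detour through
  -- an arbitrary equation between arities.
  expanded : ∀ {k l} {G : Functional 0 l} → BFF Δ G → BFF Δ {k} {l} (λ _ x → G [] x)
  expanded {k} {l} {G} G∈ = at (ℕₚ.+-identityʳ l) _ λ h x → cong (G []) (drop-[] x)
    where
    at : ∀ {m} (e : l ℕ.+ 0 ≡ m) (F : Functional k m) → (∀ h x → F h (subst (Vec Str) e (x Vec.++ [])) ≡ G [] x) → BFF Δ F
    at refl F eq = expansion {k = 0} {k} {l} {0} G∈ λ { [] h x [] → eq h x }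
    drop-[] : ∀ (x : Vec Str l) → subst (Vec Str) (ℕₚ.+-identityʳ l) (x Vec.++ []) ≡ x
    drop-[] x = ≡.trans (Vecₚ.subst-is-cast (ℕₚ.+-identityʳ l) (x Vec.++ [])) (Vecₚ.++-identityʳ-eqFree x)

  module _ {k l : ℕ} where

    op₀ : ∀ {f : Str} → PolynomialTime {0} (λ _ → f) → BFF Δ {k} {l} (λ _ _ → f)
    op₀ p = composition {G = λ ()} (expanded (polytime p)) (λ ()) (λ _ _ → refl)

    op₁ : ∀ {f} {G : Functional k l} → PolynomialTime (map₁ f) → BFF Δ G → BFF Δ {k} {l} (λ h x → f (G h x))
    op₁ {G = G} p G∈ = composition {G = λ _ → G} (expanded (polytime p)) (λ _ → G∈) (λ _ _ → refl)

    apply₂ : ∀ {F : Functional k 2} {G₁ G₂ : Functional k l} → BFF Δ F → BFF Δ G₁ → BFF Δ G₂ →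
      BFF Δ {k} {l} (λ h x → F h (G₁ h x ∷ G₂ h x ∷ []))
    apply₂ {F} {G₁} {G₂} F∈ G₁∈ G₂∈ = composition {H = F} {G = Vec.lookup (G₁ ∷ G₂ ∷ [])} F∈
      (λ { zero → G₁∈ ; (suc zero) → G₂∈ }) (λ _ _ → refl)

    apply₃ : ∀ {F : Functional k 3} {G₁ G₂ G₃ : Functional k l} → BFF Δ F → BFF Δ G₁ → BFF Δ G₂ → BFF Δ G₃ →
      BFF Δ {k} {l} (λ h x → F h (G₁ h x ∷ G₂ h x ∷ G₃ h x ∷ []))
    apply₃ {F} {G₁} {G₂} {G₃} F∈ G₁∈ G₂∈ G₃∈ = composition {H = F} {G = Vec.lookup (G₁ ∷ G₂ ∷ G₃ ∷ [])} F∈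
      (λ { zero → G₁∈ ; (suc zero) → G₂∈ ; (suc (suc zero)) → G₃∈ }) (λ _ _ → refl)

    op₂ : ∀ {f} {G₁ G₂ : Functional k l} → PolynomialTime (map₂ f) → BFF Δ G₁ → BFF Δ G₂ →
      BFF Δ {k} {l} (λ h x → f (G₁ h x) (G₂ h x))
    op₂ p = apply₂ (expanded (polytime p))

    op₃ : ∀ {f} {G₁ G₂ G₃ : Functional k l} → PolynomialTime (map₃ f) → BFF Δ G₁ → BFF Δ G₂ → BFF Δ G₃ →
      BFF Δ {k} {l} (λ h x → f (G₁ h x) (G₂ h x) (G₃ h x))
    op₃ p = apply₃ (expanded (polytime p))

    project : ∀ i → BFF Δ {k} {l} (λ _ x → Vec.lookup x i)
    project i = expanded (polytime (projection-polynomialTime i))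

    constant : ∀ s → BFF Δ {k} {l} (λ _ _ → s)
    constant []      = op₁ dropFirst-polynomialTime (op₀ (bit-polynomialTime false))
    constant (b ∷ s) = op₂ append-polynomialTime (op₀ (bit-polynomialTime b)) (constant s)

    append : ∀ {G₁ G₂ : Functional k l} → BFF Δ G₁ → BFF Δ G₂ → BFF Δ {k} {l} (λ h x → G₁ h x ++ G₂ h x)
    append = op₂ append-polynomialTime

    prepend : ∀ {G : Functional k l} s → BFF Δ G → BFF Δ {k} {l} (λ h x → s ++ G h x)
    prepend s = append (constant s)

    select : ∀ {G₁ G₂ G₃ : Functional k l} → BFF Δ G₁ → BFF Δ G₂ → BFF Δ G₃ →
      BFF Δ {k} {l} (λ h x → choose (G₁ h x) (G₂ h x) (G₃ h x))
    select = op₃ choose-polynomialTime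

    add : ∀ {G₁ G₂ : Functional k l} → BFF Δ G₁ → BFF Δ G₂ → BFF Δ {k} {l} (λ h x → plus (G₁ h x) (G₂ h x))
    add = op₂ Adding.carrying-polynomialTime

    subtract : ∀ {G₁ G₂ : Functional k l} → BFF Δ G₁ → BFF Δ G₂ → BFF Δ {k} {l} (λ h x → monus (G₁ h x) (G₂ h x))
    subtract G₁∈ G₂∈ = select (op₂ Comparing.carrying-polynomialTime G₁∈ G₂∈) (constant [])
      (op₂ Subtracting.carrying-polynomialTime G₁∈ G₂∈)

  -- Recursion on notation peels off the last symbol, while `times` recurses on the first one; this
  -- is why the second argument is reversed.
  times-reverse : BFF Δ {0} {2} (λ _ → map₂ λ x w → times x (reverse w))
  times-reverse = limited-recursion {k = 0} {l = 1}
    {G = λ _ _ → []}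
    -- The first symbol of the reversed string is the bit that this step of the recursion adds.
    {H = λ _ z → plus (choose (reverse (Vec.lookup z (suc zero))) (Vec.lookup z zero) []) (false ∷ Vec.lookup z (suc (suc zero)))}
    {K = λ _ z → Vec.lookup z zero ++ (Vec.lookup z (suc zero) ++ Vec.lookup z (suc zero))}
    (constant [])
    (add (select (op₁ reverse-polynomialTime (project (suc zero))) (project zero) (constant []))
         (prepend (false ∷ []) (project (suc (suc zero)))))
    (append (project zero) (append (project (suc zero)) (project (suc zero))))
    (λ { _ (x ∷ []) → refl })
    (λ { _ (x ∷ []) w b → recursive x w b })
    (λ { _ (x ∷ []) w → bounded x w })
    where
    recursive : ∀ x w b → times x (reverse (w ∷ʳ b)) ≡ plus (choose (reverse (w ∷ʳ b)) x []) (false ∷ times x (reverse w))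
    recursive x w b rewrite Listₚ.reverse-++ w (b ∷ []) = refl
    bounded : ∀ x w → length (times x (reverse w)) ℕ.≤ length (x ++ (w ++ w))
    bounded x w = ℕₚ.≤-trans (length-times x (reverse w)) (ℕₚ.≤-reflexive (≡.sym (≡.trans (Listₚ.length-++ x)
      (cong (length x ℕ.+_) (≡.trans (Listₚ.length-++ w) (cong (λ n → n ℕ.+ n) (≡.sym (Listₚ.length-reverse w))))))))

  multiply : ∀ {k l} {G₁ G₂ : Functional k l} → BFF Δ G₁ → BFF Δ G₂ → BFF Δ {k} {l} (λ h x → times (G₁ h x) (G₂ h x))
  multiply {k} {l} {G₁} {G₂} G₁∈ G₂∈ = composition {G = λ { zero → G₁ ; (suc zero) → λ h x → reverse (G₂ h x) }}
    (expanded times-reverse) (λ { zero → G₁∈ ; (suc zero) → op₁ reverse-polynomialTime G₂∈ })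
    (λ h x → cong (times (G₁ h x)) (≡.sym (Listₚ.reverse-involutive (G₂ h x))))

-- Fractions

fromℕ-+ : ∀ m n → fromℕ (m ℕ.+ n) ≡ fromℕ m ℚ.+ fromℕ n
fromℕ-+ zero    n = ≡.sym (ℚₚ.+-identityˡ (fromℕ n))
fromℕ-+ (suc m) n = ≡.trans (cong (1ℚ ℚ.+_) (fromℕ-+ m n)) (≡.sym (ℚₚ.+-assoc 1ℚ (fromℕ m) (fromℕ n)))

fromℕ-* : ∀ m n → fromℕ (m ℕ.* n) ≡ fromℕ m ℚ.* fromℕ n
fromℕ-* zero    n = ≡.sym (ℚₚ.*-zeroˡ (fromℕ n))
fromℕ-* (suc m) n = ≡.trans (fromℕ-+ n (m ℕ.* n)) (≡.trans (cong (fromℕ n ℚ.+_) (fromℕ-* m n))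
  (Q.solve 2 (λ m n → n Q.:+ m Q.:* n Q.:= (Q.con 1ℚ Q.:+ m) Q.:* n) refl (fromℕ m) (fromℕ n)))

0≤fromℕ : ∀ n → 0ℚ ℚ.≤ fromℕ n
0≤fromℕ zero    = ℚₚ.≤-refl
0≤fromℕ (suc n) = nonNeg-+ (ℚₚ.nonNegative⁻¹ 1ℚ) (0≤fromℕ n)

1≤fromℕ : ∀ n → .{{ℕ.NonZero n}} → 1ℚ ℚ.≤ fromℕ n
1≤fromℕ (suc n) = ≤-by-diff (fromℕ n) (0≤fromℕ n) refl

fromℕ-positive : ∀ n → .{{ℕ.NonZero n}} → ℚ.Positive (fromℕ n)
fromℕ-positive n = ℚ.positive (ℚₚ.<-≤-trans (ℚₚ.positive⁻¹ 1ℚ) (1≤fromℕ n))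

fromℕ-∸ : ∀ m n → fromℕ (m ℕ.∸ n) ≡ 0ℚ ℚ.⊔ (fromℕ m ℚ.- fromℕ n)
fromℕ-∸ m zero = ≡.sym (≡.trans (ℚₚ.p≤q⇒p⊔q≡q (subst (0ℚ ℚ.≤_) (≡.sym (ℚₚ.+-identityʳ (fromℕ m))) (0≤fromℕ m)))
  (ℚₚ.+-identityʳ (fromℕ m)))
fromℕ-∸ zero (suc n) = ≡.sym (ℚₚ.p≥q⇒p⊔q≡p (subst (ℚ._≤ 0ℚ) (≡.sym (ℚₚ.+-identityˡ (ℚ.- fromℕ (suc n))))
  (ℚₚ.neg-antimono-≤ (0≤fromℕ (suc n)))))
fromℕ-∸ (suc m) (suc n) = ≡.trans (fromℕ-∸ m n) (cong (0ℚ ℚ.⊔_)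
  (Q.solve 2 (λ m n → m Q.:- n Q.:= (Q.con 1ℚ Q.:+ m) Q.:- (Q.con 1ℚ Q.:+ n)) refl (fromℕ m) (fromℕ n)))

fromℕ-mono : ∀ {m n} → m ℕ.≤ n → fromℕ m ℚ.≤ fromℕ n
fromℕ-mono {m} {n} h = ≤-by-diff (fromℕ (n ℕ.∸ m)) (0≤fromℕ (n ℕ.∸ m))
  (≡.trans (cong fromℕ (≡.sym (ℕₚ.m+[n∸m]≡n h))) (fromℕ-+ m (n ℕ.∸ m)))

-- The additional 1 accommodates the error of an approximation at precision 0, so the length of a
-- rough numerator bounds the real number itself.
fromℕ-val≤ : ∀ x → fromℕ (val x) ℚ.+ 1ℚ ℚ.≤ 2^+ length x
fromℕ-val≤ []      = ℚₚ.≤-reflexive (ℚₚ.+-identityˡ 1ℚ)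
fromℕ-val≤ (b ∷ x) = ℚₚ.≤-trans
  (ℚₚ.+-monoˡ-≤ 1ℚ (ℚₚ.≤-trans (fromℕ-mono (ℕₚ.+-monoˡ-≤ (2 ℕ.* val x) (bit≤1 b)))
    (ℚₚ.≤-reflexive (≡.trans (fromℕ-+ 1 (2 ℕ.* val x)) (cong₂ ℚ._+_ (ℚₚ.+-identityʳ 1ℚ) (fromℕ-* 2 (val x)))))))
  (subst (ℚ._≤ (2^+ length x) ℚ.+ (2^+ length x))
    (Q.solve 1 (λ v → (v Q.:+ Q.con 1ℚ) Q.:+ (v Q.:+ Q.con 1ℚ) Q.:= (Q.con 1ℚ Q.:+ Q.con (fromℕ 2) Q.:* v) Q.:+ Q.con 1ℚ) refl (fromℕ (val x)))
    (ℚₚ.+-mono-≤ (fromℕ-val≤ x) (fromℕ-val≤ x)))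

val-power : ∀ n → fromℕ (val (replicate n false ++ true ∷ [])) ≡ 2^+ n
val-power zero    = ℚₚ.+-identityʳ 1ℚ
val-power (suc n) = ≡.trans (cong fromℕ (cong (v ℕ.+_) (ℕₚ.+-identityʳ v)))
  (≡.trans (fromℕ-+ v v) (cong₂ ℚ._+_ (val-power n) (val-power n)))
  where
  v : ℕ
  v = val (replicate n false ++ true ∷ [])

-- Cross-multiplied and not in lowest terms: arithmetic on such fractions takes only sums, products
-- and truncated differences of numerals, never a gcd.
record Ratio (q : ℚ) (n d : ℕ) : Set where
  field
    nonZero : ℕ.NonZero d
    equal   : q ℚ.* fromℕ d ≡ fromℕ n

  positive : ℚ.Positive (fromℕ d)
  positive = fromℕ-positive d {{nonZero}}

  numerator≤ : q ℚ.≤ fromℕ n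
  numerator≤ = ℚₚ.*-cancelʳ-≤-pos (fromℕ d) {{positive}} (ℚₚ.≤-trans (ℚₚ.≤-reflexive equal)
    (subst (ℚ._≤ fromℕ n ℚ.* fromℕ d) (ℚₚ.*-identityʳ (fromℕ n))
      (ℚₚ.*-monoˡ-≤-nonNeg (fromℕ n) {{ℚ.nonNegative (0≤fromℕ n)}} (1≤fromℕ d {{nonZero}}))))

  nonNegative : 0ℚ ℚ.≤ q
  nonNegative = ℚₚ.*-cancelʳ-≤-pos (fromℕ d) {{positive}}
    (subst₂ ℚ._≤_ (≡.sym (ℚₚ.*-zeroˡ (fromℕ d))) (≡.sym equal) (0≤fromℕ n))

open Ratio

ratio-unique : ∀ {p q n d} → Ratio p n d → Ratio q n d → p ≡ q
ratio-unique {p} {q} {n} {d} h h′ = ℚₚ.≤-antisym (le (≡.trans (equal h) (≡.sym (equal h′)))) (le (≡.trans (equal h′) (≡.sym (equal h))))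
  where
  le : ∀ {p q} → p ℚ.* fromℕ d ≡ q ℚ.* fromℕ d → p ℚ.≤ q
  le e = ℚₚ.*-cancelʳ-≤-pos (fromℕ d) {{positive h}} (ℚₚ.≤-reflexive e)

ratio-/ : ∀ n d {{_ : ℕ.NonZero d}} → Ratio ((ℤ.+ n) ℚ./ d) n d
ratio-/ n (suc d) = record { nonZero = _ ; equal = ℚₚ.toℚᵘ-injective
  (ℚᵘₚ.≃-trans (ℚₚ.toℚᵘ-homo-* ((ℤ.+ n) ℚ./ suc d) (fromℕ (suc d)))
    (ℚᵘₚ.≃-trans (ℚᵘₚ.*-cong (ℚₚ.toℚᵘ-fromℚᵘ (ℚᵘ.mkℚᵘ (ℤ.+ n) d)) (fromℕᵘ (suc d)))
      (ℚᵘₚ.≃-trans (ℚᵘ.*≡* (≡.trans (ℤₚ.*-assoc (ℤ.+ n) (ℤ.+ suc d) (ℤ.+ 1))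
          (cong (ℤ.+ n ℤ.*_) (≡.trans (ℤₚ.*-identityʳ (ℤ.+ suc d)) (≡.sym (cong (λ k → ℤ.+ suc k) (ℕₚ.*-identityʳ d)))))))
        (ℚᵘₚ.≃-sym (fromℕᵘ n))))) }

ratio-+ : ∀ {p q m d n e} → Ratio p m d → Ratio q n e → Ratio (p ℚ.+ q) (m ℕ.* e ℕ.+ n ℕ.* d) (d ℕ.* e)
ratio-+ {p} {q} {m} {d} {n} {e} h h′ = record
  { nonZero = ℕₚ.m*n≢0 d e {{nonZero h}} {{nonZero h′}}
  ; equal = ≡.trans (cong ((p ℚ.+ q) ℚ.*_) (fromℕ-* d e))
      (≡.trans (Q.solve 4 (λ p q d e → (p Q.:+ q) Q.:* (d Q.:* e) Q.:= (p Q.:* d) Q.:* e Q.:+ (q Q.:* e) Q.:* d) refl p q (fromℕ d) (fromℕ e))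
        (≡.trans (cong₂ (λ u v → u ℚ.* fromℕ e ℚ.+ v ℚ.* fromℕ d) (equal h) (equal h′))
          (≡.sym (≡.trans (fromℕ-+ (m ℕ.* e) (n ℕ.* d)) (cong₂ ℚ._+_ (fromℕ-* m e) (fromℕ-* n d)))))) }

⊔-distrib-positive : ∀ p {r} → 0ℚ ℚ.≤ r → (0ℚ ℚ.⊔ p) ℚ.* r ≡ 0ℚ ℚ.⊔ (p ℚ.* r)
⊔-distrib-positive p {r} 0≤r = ≡.trans (ℚₚ.*-distribʳ-⊔-nonNeg r {{ℚ.nonNegative 0≤r}} 0ℚ p)
  (cong (ℚ._⊔ (p ℚ.* r)) (ℚₚ.*-zeroˡ r))

ratio-∸ : ∀ {p q m d n e} → Ratio p m d → Ratio q n e → Ratio (0ℚ ℚ.⊔ (p ℚ.- q)) (m ℕ.* e ℕ.∸ n ℕ.* d) (d ℕ.* e)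
ratio-∸ {p} {q} {m} {d} {n} {e} h h′ = record
  { nonZero = ℕₚ.m*n≢0 d e {{nonZero h}} {{nonZero h′}}
  ; equal = ≡.trans (⊔-distrib-positive (p ℚ.- q) (0≤fromℕ (d ℕ.* e)))
      (≡.trans (cong (0ℚ ℚ.⊔_) (≡.trans (cong ((p ℚ.- q) ℚ.*_) (fromℕ-* d e))
        (≡.trans (Q.solve 4 (λ p q d e → (p Q.:- q) Q.:* (d Q.:* e) Q.:= (p Q.:* d) Q.:* e Q.:- (q Q.:* e) Q.:* d) refl p q (fromℕ d) (fromℕ e))
          (cong₂ (λ u v → u ℚ.* fromℕ e ℚ.- v ℚ.* fromℕ d) (equal h) (equal h′)))))
        (≡.sym (≡.trans (fromℕ-∸ (m ℕ.* e) (n ℕ.* d)) (cong (0ℚ ℚ.⊔_) (cong₂ ℚ._-_ (fromℕ-* m e) (fromℕ-* n d)))))) }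

ratio-* : ∀ {p q m d n e} → Ratio p m d → Ratio q n e → Ratio (p ℚ.* q) (m ℕ.* n) (d ℕ.* e)
ratio-* {p} {q} {m} {d} {n} {e} h h′ = record
  { nonZero = ℕₚ.m*n≢0 d e {{nonZero h}} {{nonZero h′}}
  ; equal = ≡.trans (cong ((p ℚ.* q) ℚ.*_) (fromℕ-* d e))
      (≡.trans (Q.solve 4 (λ p q d e → (p Q.:* q) Q.:* (d Q.:* e) Q.:= (p Q.:* d) Q.:* (q Q.:* e)) refl p q (fromℕ d) (fromℕ e))
        (≡.trans (cong₂ ℚ._*_ (equal h) (equal h′)) (≡.sym (fromℕ-* m n)))) }

ratio-recip : ∀ {p m d} (0<p : 0ℚ ℚ.< p) → Ratio p m d → Ratio (recip p 0<p) d m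
ratio-recip {p} {zero} {d} 0<p h = ⊥-elim (ℚₚ.<-irrefl (≡.sym p≡0) 0<p)
  where
  p≡0 : p ≡ 0ℚ
  p≡0 = ℚₚ.≤-antisym (numerator≤ h) (nonNegative h)
ratio-recip {p} {suc m} {d} 0<p h = record
  { nonZero = _
  ; equal = ≡.trans (cong (recip p 0<p ℚ.*_) (≡.sym (equal h)))
      (≡.trans (Q.solve 3 (λ p r d → r Q.:* (p Q.:* d) Q.:= (p Q.:* r) Q.:* d) refl p (recip p 0<p) (fromℕ d))
        (≡.trans (cong (ℚ._* fromℕ d) (*-recip p 0<p)) (ℚₚ.*-identityˡ (fromℕ d)))) }

-- The numerator, clamped at zero, and the denominator of the rational denoted by a string.

numeratorOf denominatorOf : Str → Str
numeratorOf   x = choose x [] (reverse (takeZeros (dropFirst x) (afterTrue (dropFirst x))))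
denominatorOf x = reverse (dropZeros (dropFirst x) (afterTrue (dropFirst x)))

afterTrue-pair : ∀ n y → afterTrue (replicate n false ++ true ∷ y) ≡ y
afterTrue-pair zero    y = refl
afterTrue-pair (suc n) y = afterTrue-pair n y

takeZeros-pair : ∀ x {y z} → takeZeros (replicate (length x) false ++ true ∷ z) (x ++ y) ≡ x
takeZeros-pair []      = refl
takeZeros-pair (b ∷ x) = cong (b ∷_) (takeZeros-pair x)

dropZeros-pair : ∀ x {y z} → dropZeros (replicate (length x) false ++ true ∷ z) (x ++ y) ≡ y
dropZeros-pair []      = refl
dropZeros-pair (b ∷ x) = dropZeros-pair x

first-of-pair : ∀ x y → takeZeros ⟨ x , y ⟩ (afterTrue ⟨ x , y ⟩) ≡ x
first-of-pair x y = ≡.trans (cong (takeZeros ⟨ x , y ⟩) (afterTrue-pair (length x) (x ++ y))) (takeZeros-pair x)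

second-of-pair : ∀ x y → dropZeros ⟨ x , y ⟩ (afterTrue ⟨ x , y ⟩) ≡ y
second-of-pair x y = ≡.trans (cong (dropZeros ⟨ x , y ⟩) (afterTrue-pair (length x) (x ++ y))) (dropZeros-pair x)

denotes⇒ratio : ∀ {x q} → Denotes x q → Ratio (0ℚ ℚ.⊔ q) (val (numeratorOf x)) (val (denominatorOf x))
denotes⇒ratio record { negative = s ; num = num ; den = den ; den-≢0 = den≢0 ; form = refl ; value = refl } =
  subst₂ (Ratio _) (≡.sym (val-num s)) (≡.sym val-den) (signed s)
  where
  instance
    den-nonZero : ℕ.NonZero (numeral den)
    den-nonZero = den≢0
  val-den : val (denominatorOf (s ∷ ⟨ num , den ⟩)) ≡ numeral den
  val-den = ≡.trans (cong (λ y → val (reverse y)) (second-of-pair num den)) (val-reverse den)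
  magnitudeOf : Bool → ℕ
  magnitudeOf s = if s then 0 else numeral num
  val-num : ∀ s → val (numeratorOf (s ∷ ⟨ num , den ⟩)) ≡ magnitudeOf s
  val-num true  = refl
  val-num false = ≡.trans (cong (λ y → val (reverse y)) (first-of-pair num den)) (val-reverse num)
  positive-part : ∀ n {m} → Ratio ((ℤ.+ n) ℚ./ numeral den) m (numeral den) → Ratio (0ℚ ℚ.⊔ ((ℤ.+ n) ℚ./ numeral den)) m (numeral den)
  positive-part n r = subst (λ q → Ratio q _ (numeral den)) (≡.sym (ℚₚ.p≤q⇒p⊔q≡q (nonNegative r))) r
  negative-part : ∀ n → Ratio (0ℚ ℚ.⊔ ((ℤ.- (ℤ.+ n)) ℚ./ numeral den)) 0 (numeral den)
  -- The sign bit may accompany a zero numerator.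
  negative-part zero    = positive-part 0 (ratio-/ 0 (numeral den))
  negative-part (suc n) = subst (λ q → Ratio q 0 (numeral den))
    (≡.sym (ℚₚ.p≥q⇒p⊔q≡p (ℚₚ.neg-antimono-≤ (nonNegative (ratio-/ (suc n) (numeral den))))))
    (record { nonZero = den≢0 ; equal = ℚₚ.*-zeroˡ (fromℕ (numeral den)) })
  signed : ∀ s → Ratio (0ℚ ℚ.⊔ (((if s then Sign.- else Sign.+) ℤ.◃ numeral num) ℚ./ numeral den)) (magnitudeOf s) (numeral den)
  signed true  rewrite ℤₚ.-◃n≡-n (numeral num) = negative-part (numeral num)
  signed false rewrite ℤₚ.+◃n≡+n (numeral num) = positive-part (numeral num) (ratio-/ (numeral num) (numeral den))

ratio⇒denotes : ∀ {q x y} → Ratio q (val x) (val y) → Denotes (false ∷ ⟨ reverse x , reverse y ⟩) q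
ratio⇒denotes {q} {x} {y} h = record
  { negative = false ; num = reverse x ; den = reverse y ; den-≢0 = nonZero h′ ; form = refl
  ; value = ≡.trans (ratio-unique h′ (ratio-/ (numeral (reverse x)) (numeral (reverse y)) {{nonZero h′}}))
      (cong (λ z → (z ℚ./ numeral (reverse y)) {{nonZero h′}}) (≡.sym (ℤₚ.+◃n≡+n (numeral (reverse x))))) }
  where
  h′ : Ratio q (numeral (reverse x)) (numeral (reverse y))
  h′ = subst₂ (Ratio q) (≡.sym (numeral-reverse x)) (≡.sym (numeral-reverse y)) h

-- Functionals that approximate real numbers

ι-cancel-≤ : ∀ {p q} → ι p ≤ ι q → p ℚ.≤ q
ι-cancel-≤ {p} {q} h = ≤-limit-* p q 2ℚ λ k →
  subst₂ (λ u v → u ℚ.≤ v ℚ.+ 2ℚ ℚ.* (2^- k)) (seq-ι p k) (seq-ι q k) (≤⇒bound h k)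

unary-++ : ∀ m n → unary m ++ unary n ≡ unary (m ℕ.+ n)
unary-++ zero    n = refl
unary-++ (suc m) n = cong (true ∷_) (unary-++ m n)

length-unary : ∀ n → length (unary n) ≡ n
length-unary n = Listₚ.length-replicate n

power : Str → Str
power x = repeat false x ++ true ∷ []

val-power-unary : ∀ i → fromℕ (val (power (unary i))) ≡ 2^+ i
val-power-unary i = ≡.trans (cong (λ n → fromℕ (val (replicate n false ++ true ∷ []))) (length-unary i)) (val-power i)

fromℕ≢0 : ∀ n → 0ℚ ℚ.< fromℕ n → ℕ.NonZero n
fromℕ≢0 zero    h = ⊥-elim (ℚₚ.<-irrefl refl h)
fromℕ≢0 (suc n) h = _

ratio-2^+ : ∀ i → Ratio (2^+ i) (val (power (unary i))) 1
ratio-2^+ i = record { nonZero = _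
  ; equal = ≡.trans (≡.trans (cong ((2^+ i) ℚ.*_) (ℚₚ.+-identityʳ 1ℚ)) (ℚₚ.*-identityʳ (2^+ i))) (≡.sym (val-power-unary i)) }

ratio-2^- : ∀ i → Ratio (2^- i) 1 (val (power (unary i)))
ratio-2^- i = record
  { nonZero = fromℕ≢0 _ (subst (0ℚ ℚ.<_) (≡.sym (val-power-unary i)) (ℚₚ.<-≤-trans (ℚₚ.positive⁻¹ 1ℚ) (2^+≥1 i)))
  ; equal = ≡.trans (cong ((2^- i) ℚ.*_) (val-power-unary i))
      (≡.trans (ℚₚ.*-comm (2^- i) (2^+ i)) (≡.trans (2^+*2^- i) (≡.sym (ℚₚ.+-identityʳ 1ℚ)))) }

near-self : ∀ q r → Near q r (ι q)
near-self q r = ≤-trans (≈⇒≤ (≈-trans (∣∣-cong (+-inverseʳ (ι q))) (∣∣-of-nonneg ≤-refl))) (0≤ι2^- r)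

ratio-plus : ∀ {p q} a b c d → Ratio p (val a) (val b) → Ratio q (val c) (val d) →
  Ratio (p ℚ.+ q) (val (plus (times a d) (times c b))) (val (times b d))
ratio-plus {p} {q} a b c d h h′ = subst₂ (Ratio (p ℚ.+ q))
  (≡.sym (≡.trans (val-plus (times a d) (times c b)) (cong₂ ℕ._+_ (val-times a d) (val-times c b))))
  (≡.sym (val-times b d)) (ratio-+ h h′)

ratio-monus : ∀ {p q} a b c d → Ratio p (val a) (val b) → Ratio q (val c) (val d) →
  Ratio (0ℚ ℚ.⊔ (p ℚ.- q)) (val (monus (times a d) (times c b))) (val (times b d))
ratio-monus {p} {q} a b c d h h′ = subst₂ (Ratio (0ℚ ℚ.⊔ (p ℚ.- q)))
  (≡.sym (≡.trans (val-monus (times a d) (times c b)) (cong₂ ℕ._∸_ (val-times a d) (val-times c b))))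
  (≡.sym (val-times b d)) (ratio-∸ h h′)

ratio-times : ∀ {p q} a b c d → Ratio p (val a) (val b) → Ratio q (val c) (val d) →
  Ratio (p ℚ.* q) (val (times a c)) (val (times b d))
ratio-times {p} {q} a b c d h h′ = subst₂ (Ratio (p ℚ.* q))
  (≡.sym (val-times a c)) (≡.sym (val-times b d)) (ratio-* h h′)

module Approximation {ℓ} (Δ : Class ℓ) (ν : ProbabilityMeasure) where

  -- The arguments of num and den are the index i, the precision r and the string t.

  record Approximable (E : Martingale ν → ℕ → Str → ℝ) : Set ℓ where
    field
      num den : Functional 1 3
      num∈    : BFF Δ num
      den∈    : BFF Δ den
      fraction : ∀ d (c : Computation (capital d)) g → g Presents c → ∀ i r t →
        ∃ λ q → Ratio q (val (num (g ∷ []) (unary i ∷ unary r ∷ t ∷ []))) (val (den (g ∷ []) (unary i ∷ unary r ∷ t ∷ []))) ×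
                Near q r (E d i t)

  open Approximable

  numerator denominator : ∀ {E} → Approximable E → (Str → Str) → ℕ → ℕ → Str → Str
  numerator   A g i r t = num A (g ∷ []) (unary i ∷ unary r ∷ t ∷ [])
  denominator A g i r t = den A (g ∷ []) (unary i ∷ unary r ∷ t ∷ [])

  index precision string : Functional 1 3
  index     _ x = Vec.lookup x zero
  precision _ x = Vec.lookup x (suc zero)
  string    _ x = Vec.lookup x (suc (suc zero))

  index∈ : BFF Δ index
  index∈ = project zero

  precision∈ : BFF Δ precision
  precision∈ = project (suc zero)

  string∈ : BFF Δ string
  string∈ = project (suc (suc zero))

  _at_,_ : Functional 1 3 → Functional 1 3 → Functional 1 3 → Functional 1 3
  (F at R , T) h x = F h (index h x ∷ R h x ∷ T h x ∷ [])

  at∈ : ∀ {F R T} → BFF Δ F → BFF Δ R → BFF Δ T → BFF Δ (F at R , T)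
  at∈ F∈ R∈ T∈ = apply₃ F∈ index∈ R∈ T∈

  -- Unsigned fractions at every precision force a nonnegative limit. This supplies the sign
  -- condition of `near-*` without carrying it along.
  approximable-nonneg : ∀ {E} → Approximable E → ∀ d (c : Computation (capital d)) g → g Presents c → ∀ i t → 0r ≤ E d i t
  approximable-nonneg A d c g gc i t = ≤-limitᵣ λ k →
    let (q , ratio , near) = fraction A d c g gc i k t
    in ≤-trans (ι-mono (nonNegative ratio)) (near⇒≥ {q} {k} near)

  approximable-exact : ∀ {n d : Str → Str} (q : ℕ → ℚ) → BFF Δ {1} {1} (λ _ x → n (Vec.lookup x zero)) → BFF Δ {1} {1} (λ _ x → d (Vec.lookup x zero)) →
    (∀ i → Ratio (q i) (val (n (unary i))) (val (d (unary i)))) → Approximable (λ _ i _ → ι (q i))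
  approximable-exact {n} {d} q n∈ d∈ ratio = record
    { num = λ h x → n (index h x) ; den = λ h x → d (index h x)
    ; num∈ = composition {G = λ _ → index} n∈ (λ _ → index∈) (λ _ _ → refl)
    ; den∈ = composition {G = λ _ → index} d∈ (λ _ → index∈) (λ _ _ → refl)
    ; fraction = λ _ _ _ _ i r _ → q i , ratio i , near-self (q i) r }

  power∈ : BFF Δ {1} {1} (λ _ x → power (Vec.lookup x zero))
  power∈ = append (op₁ (repeat-polynomialTime false) (project zero)) (constant (true ∷ []))

  approximable-2^+ : Approximable (λ _ i _ → ι (2^+ i))
  approximable-2^+ = approximable-exact {power} {λ _ → true ∷ []} 2^+_ power∈ (constant (true ∷ [])) ratio-2^+

  approximable-2^- : Approximable (λ _ i _ → ι (2^- i))
  approximable-2^- = approximable-exact {λ _ → true ∷ []} {power} 2^-_ (constant (true ∷ [])) power∈ ratio-2^-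

  approximable-1 : Approximable (λ _ _ _ → 1r)
  approximable-1 = approximable-exact {λ _ → true ∷ []} {λ _ → true ∷ []} (λ _ → 1ℚ) (constant (true ∷ [])) (constant (true ∷ []))
    λ _ → record { nonZero = _ ; equal = ℚₚ.*-identityˡ (fromℕ 1) }

  approximable-0 : Approximable (λ _ _ _ → 0r)
  approximable-0 = approximable-exact {λ _ → []} {λ _ → true ∷ []} (λ _ → 0ℚ) (constant []) (constant (true ∷ []))
    λ _ → record { nonZero = _ ; equal = ℚₚ.*-zeroˡ (fromℕ 1) }

  approximable-+ : ∀ {E F} → Approximable E → Approximable F → Approximable (λ d i t → E d i t + F d i t)
  approximable-+ A B = record
    { num = λ h x → plus (times ((num A at finer , string) h x) ((den B at finer , string) h x))
                         (times ((num B at finer , string) h x) ((den A at finer , string) h x))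
    ; den = λ h x → times ((den A at finer , string) h x) ((den B at finer , string) h x)
    ; num∈ = add (multiply (at∈ (num∈ A) finer∈ string∈) (at∈ (den∈ B) finer∈ string∈))
                 (multiply (at∈ (num∈ B) finer∈ string∈) (at∈ (den∈ A) finer∈ string∈))
    ; den∈ = multiply (at∈ (den∈ A) finer∈ string∈) (at∈ (den∈ B) finer∈ string∈)
    ; fraction = λ d c g gc i r t →
        let (p , ratio , near) = fraction A d c g gc i (suc r) t
            (q , ratio′ , near′) = fraction B d c g gc i (suc r) t
        in p ℚ.+ q ,
           ratio-plus (numerator A g i (suc r) t) (denominator A g i (suc r) t) (numerator B g i (suc r) t) (denominator B g i (suc r) t) ratio ratio′ ,
           near-+ {p} {q} {r} near near′ }
    where
    finer : Functional 1 3
    finer h x = true ∷ precision h x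
    finer∈ : BFF Δ finer
    finer∈ = prepend (true ∷ []) precision∈

  approximable-∸ : ∀ {E F} → Approximable E → Approximable F → Approximable (λ d i t → pos (E d i t - F d i t))
  approximable-∸ A B = record
    { num = λ h x → monus (times ((num A at finer , string) h x) ((den B at finer , string) h x))
                          (times ((num B at finer , string) h x) ((den A at finer , string) h x))
    ; den = λ h x → times ((den A at finer , string) h x) ((den B at finer , string) h x)
    ; num∈ = subtract (multiply (at∈ (num∈ A) finer∈ string∈) (at∈ (den∈ B) finer∈ string∈))
                      (multiply (at∈ (num∈ B) finer∈ string∈) (at∈ (den∈ A) finer∈ string∈))
    ; den∈ = multiply (at∈ (den∈ A) finer∈ string∈) (at∈ (den∈ B) finer∈ string∈)
    ; fraction = λ d c g gc i r t →
        let (p , ratio , near) = fraction A d c g gc i (suc r) t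
            (q , ratio′ , near′) = fraction B d c g gc i (suc r) t
        in 0ℚ ℚ.⊔ (p ℚ.- q) ,
           ratio-monus (numerator A g i (suc r) t) (denominator A g i (suc r) t) (numerator B g i (suc r) t) (denominator B g i (suc r) t) ratio ratio′ ,
           near-∸ {p} {q} {r} near near′ }
    where
    finer : Functional 1 3
    finer h x = true ∷ precision h x
    finer∈ : BFF Δ finer
    finer∈ = prepend (true ∷ []) precision∈

  -- The lengths of the numerators at precision 0 bound the factors.

  approximable-* : ∀ {E F} → Approximable E → Approximable F → Approximable (λ d i t → E d i t * F d i t)
  approximable-* {E} {F} A B = record
    { num = λ h x → times ((num A at finer , string) h x) ((num B at finer , string) h x)
    ; den = λ h x → times ((den A at finer , string) h x) ((den B at finer , string) h x)
    ; num∈ = multiply (at∈ (num∈ A) finer∈ string∈) (at∈ (num∈ B) finer∈ string∈)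
    ; den∈ = multiply (at∈ (den∈ A) finer∈ string∈) (at∈ (den∈ B) finer∈ string∈)
    ; fraction = product }
    where
    rough : Functional 1 3 → Functional 1 3
    rough G = G at (λ _ _ → []) , string
    finer : Functional 1 3
    finer h x = true ∷ true ∷ (repeat true (rough (num A) h x) ++ (repeat true (rough (num B) h x) ++ precision h x))
    rough∈ : ∀ {G} → BFF Δ G → BFF Δ (λ h x → repeat true (rough G h x))
    rough∈ G∈ = op₁ (repeat-polynomialTime true) (at∈ G∈ (constant []) string∈)
    finer∈ : BFF Δ finer
    finer∈ = prepend (true ∷ true ∷ []) (append (rough∈ (num∈ A)) (append (rough∈ (num∈ B)) precision∈))
    product : ∀ d (c : Computation (capital d)) g → g Presents c → ∀ i r t → _
    product d c g gc i r t = p ℚ.* q ,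
      ratio-times ((num A at finer , string) (g ∷ []) x) ((den A at finer , string) (g ∷ []) x)
        ((num B at finer , string) (g ∷ []) x) ((den B at finer , string) (g ∷ []) x) ratio ratio′ ,
      near-* {p} {q} {2^- R} {bound} {r} (approximable-nonneg A d c g gc i t) (nonNegative ratio′) (0≤2^- R)
        (≤-trans (E≤ A) (ι-mono (≤-bound L))) q≤ scale near near′
      where
      x : Vec Str 3
      x = unary i ∷ unary r ∷ t ∷ []
      lengthOf : ∀ {E} → Approximable E → ℕ
      lengthOf A = length (rough (num A) (g ∷ []) x)
      L M R : ℕ
      L = lengthOf A
      M = lengthOf B
      -- The factors are at most `2^L` and `2^M`, and the approximation `q` is within 1 of the
      -- second, so `2^(1+L+M)` bounds what `near-*` needs. Twice this bound is `2^(2+L+M)`, the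
      -- precision that a product loses.
      R = 2 ℕ.+ (L ℕ.+ (M ℕ.+ r))
      bound : ℚ
      bound = 2^+ suc (L ℕ.+ M)
      finer≡ : finer (g ∷ []) x ≡ unary R
      finer≡ = cong (λ y → true ∷ true ∷ y) (≡.trans (cong (unary L ++_) (unary-++ M r)) (unary-++ L (M ℕ.+ r)))
      Fraction : ∀ {E} → Approximable E → Set
      Fraction {E} A = ∃ λ q → Ratio q (val ((num A at finer , string) (g ∷ []) x)) (val ((den A at finer , string) (g ∷ []) x)) × Near q R (E d i t)
      fraction-finer : ∀ {E} (A : Approximable E) → Fraction A
      fraction-finer {E} A = subst (λ y → ∃ λ q → Ratio q (val (num A (g ∷ []) (unary i ∷ y ∷ t ∷ [])))
          (val (den A (g ∷ []) (unary i ∷ y ∷ t ∷ []))) × Near q R (E d i t))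
        (≡.sym finer≡) (fraction A d c g gc i R t)
      p q : ℚ
      p = proj₁ (fraction-finer A)
      q = proj₁ (fraction-finer B)
      ratio : Ratio p (val ((num A at finer , string) (g ∷ []) x)) (val ((den A at finer , string) (g ∷ []) x))
      ratio = proj₁ (proj₂ (fraction-finer A))
      ratio′ : Ratio q (val ((num B at finer , string) (g ∷ []) x)) (val ((den B at finer , string) (g ∷ []) x))
      ratio′ = proj₁ (proj₂ (fraction-finer B))
      near : Near p R (E d i t)
      near = proj₂ (proj₂ (fraction-finer A))
      near′ : Near q R (F d i t)
      near′ = proj₂ (proj₂ (fraction-finer B))
      E≤ : ∀ {E} (A : Approximable E) → E d i t ≤ ι (2^+ lengthOf A)
      E≤ A = let (q₀ , ratio₀ , near₀) = fraction A d c g gc i 0 t in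
        ≤-trans (near⇒≤ {q₀} {0} near₀) (≤-trans (≈⇒≤ (≈-sym (ι-+ q₀ 1ℚ)))
          (ι-mono (ℚₚ.≤-trans (ℚₚ.+-monoˡ-≤ 1ℚ (numerator≤ ratio₀)) (fromℕ-val≤ (rough (num A) (g ∷ []) x)))))
      ≤-bound : ∀ m → 2^+ m ℚ.≤ 2^+ suc (m ℕ.+ M)
      ≤-bound m = subst (λ n → 2^+ m ℚ.≤ 2^+ n) (cong suc (ℕₚ.+-comm M m)) (2^+-mono m (suc M))
      q≤ : ι q ≤ ι bound
      q≤ = ≤-trans (near⇒≥ {q} {R} near′) (≤-trans (+-mono (E≤ B) (ι-mono (ℚₚ.≤-trans (2^-≤1 R) (2^+≥1 M))))
        (≤-trans (≈⇒≤ (≈-sym (ι-+ (2^+ M) (2^+ M)))) (ι-mono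
          (subst (λ n → 2^+ suc M ℚ.≤ 2^+ n) (ℕₚ.+-suc L M) (2^+-mono (suc M) L)))))
      scale : (bound ℚ.+ bound) ℚ.* (2^- R) ℚ.≤ 2^- r
      scale = subst (λ n → (bound ℚ.+ bound) ℚ.* (2^- n) ℚ.≤ 2^- r)
        (cong (λ n → 2 ℕ.+ n) (ℕₚ.+-assoc L M r)) (*2^-≤ (bound ℚ.+ bound) (2 ℕ.+ (L ℕ.+ M)) r ℚₚ.≤-refl)

  -- Inverting a fraction swaps its parts. At precision above `l` the approximation is still at
  -- least `2^-(l+1)`, so the new denominator is nonzero; the errors grow by at most
  -- `2^(l+1) · 2^l`. As `l` is fixed, the extra precision is a constant string.
  approximable-inv : ∀ {x} l → ι (2^- l) ≤ x → Approximable (λ _ _ _ → x) → Approximable (λ _ _ _ → inv l x)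
  approximable-inv {x} l x≥ A = record
    { num = den A at finer , string
    ; den = num A at finer , string
    ; num∈ = at∈ (den∈ A) finer∈ string∈
    ; den∈ = at∈ (num∈ A) finer∈ string∈
    ; fraction = reciprocalFraction }
    where
    finer : Functional 1 3
    finer h y = unary (suc l) ++ (unary l ++ precision h y)
    finer∈ : BFF Δ finer
    finer∈ = prepend (unary (suc l)) (prepend (unary l) precision∈)
    reciprocalFraction : ∀ d (c : Computation (capital d)) g → g Presents c → ∀ i r t → _
    reciprocalFraction d c g gc i r t =
      subst (λ y → ∃ λ q → Ratio q (val (den A (g ∷ []) (unary i ∷ y ∷ t ∷ []))) (val (num A (g ∷ []) (unary i ∷ y ∷ t ∷ []))) × Near q r (inv l x))
        (≡.sym (≡.trans (cong (unary (suc l) ++_) (unary-++ l r)) (unary-++ (suc l) (l ℕ.+ r))))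
        (recip p 0<p , ratio-recip 0<p ratio ,
          near-inv {p} {recip p 0<p} {l} {r} {x} (*-recip p 0<p) (*-inv l x x≥) (0≤recip p 0<p) (recip-bound (suc l) 0<p p≥) (0≤inv l x) x≥ near)
      where
      R : ℕ
      R = suc l ℕ.+ (l ℕ.+ r)
      f : ∃ λ q → Ratio q (val (num A (g ∷ []) (unary i ∷ unary R ∷ t ∷ []))) (val (den A (g ∷ []) (unary i ∷ unary R ∷ t ∷ []))) × Near q R x
      f = fraction A d c g gc i R t
      p : ℚ
      p = proj₁ f
      ratio : Ratio p (val (num A (g ∷ []) (unary i ∷ unary R ∷ t ∷ []))) (val (den A (g ∷ []) (unary i ∷ unary R ∷ t ∷ [])))
      ratio = proj₁ (proj₂ f)
      near : Near p R x
      near = proj₂ (proj₂ f)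
      p≥ : 2^- suc l ℚ.≤ p
      p≥ = subst₂ ℚ._≤_
        (Q.solve 1 (λ e → e Q.:- Q.con ½ Q.:* e Q.:= Q.con ½ Q.:* e) refl (2^- l))
        (Q.solve 2 (λ p e → (p Q.:+ e) Q.:- e Q.:= p) refl p (2^- suc l))
        (ℚₚ.+-monoˡ-≤ (ℚ.- (2^- suc l)) (ι-cancel-≤ (≤-trans x≥ (≤-trans (near⇒≤ {p} {R} near)
          (≤-trans (+-monoˡ (ι-mono (2^-anti (l ℕ.+ r) (suc l)))) (≈⇒≤ (≈-sym (ι-+ p (2^- suc l)))))))))
      0<p : 0ℚ ℚ.< p
      0<p = ℚₚ.<-≤-trans (2^-pos (suc l)) p≥

  approximable-at : ∀ {E} → Approximable E → ∀ s → Approximable (λ d i _ → E d i s)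
  approximable-at A s = record
    { num = num A at precision , (λ _ _ → s)
    ; den = den A at precision , (λ _ _ → s)
    ; num∈ = at∈ (num∈ A) precision∈ (constant s)
    ; den∈ = at∈ (den∈ A) precision∈ (constant s)
    ; fraction = λ d c g gc i r _ → fraction A d c g gc i r s }

  branch : (F G H : Functional 1 3) → Functional 1 3
  -- The outer test separates the empty string, the inner one reads the first symbol.
  branch F G H h x = choose (repeat true (string h x))
    (choose (string h x) ((H at precision , rest) h x) ((G at precision , rest) h x)) ((F at precision , string) h x)
    where
    rest : Functional 1 3
    rest h x = dropFirst (string h x)

  branch∈ : ∀ {F G H} → BFF Δ F → BFF Δ G → BFF Δ H → BFF Δ (branch F G H)
  branch∈ F∈ G∈ H∈ = select (op₁ (repeat-polynomialTime true) string∈)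
    (select string∈ (at∈ H∈ precision∈ rest∈) (at∈ G∈ precision∈ rest∈)) (at∈ F∈ precision∈ string∈)
    where
    rest∈ : BFF Δ (λ h x → dropFirst (string h x))
    rest∈ = op₁ dropFirst-polynomialTime string∈

  approximable-branch : ∀ {E} → Approximable (λ d i _ → E d i []) → Approximable (λ d i t → E d i (false ∷ t)) →
    Approximable (λ d i t → E d i (true ∷ t)) → Approximable E
  approximable-branch A B C = record
    { num = branch (num A) (num B) (num C)
    ; den = branch (den A) (den B) (den C)
    ; num∈ = branch∈ (num∈ A) (num∈ B) (num∈ C)
    ; den∈ = branch∈ (den∈ A) (den∈ B) (den∈ C)
    ; fraction = λ { d c g gc i r []          → fraction A d c g gc i r []
                   ; d c g gc i r (false ∷ t) → fraction B d c g gc i r t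
                   ; d c g gc i r (true ∷ t)  → fraction C d c g gc i r t } }

  denoted : ∀ {x q y} r → 0r ≤ y → Denotes x q → q isWithin2^- r of y →
    ∃ λ q → Ratio q (val (numeratorOf x)) (val (denominatorOf x)) × Near q r y
  denoted {q = q} {y} r 0≤y den within = 0ℚ ℚ.⊔ q , denotes⇒ratio den , near-pos {q} {r} 0≤y (fold-within {q} {r} {y} within)

  numerator∈ : ∀ {G} → BFF Δ {1} {3} G → BFF Δ (λ h x → numeratorOf (G h x))
  numerator∈ G∈ = select G∈ (constant []) (op₁ reverse-polynomialTime
    (op₂ takeZeros-polynomialTime (op₁ dropFirst-polynomialTime G∈) (op₁ afterTrue-polynomialTime (op₁ dropFirst-polynomialTime G∈))))

  denominator∈ : ∀ {G} → BFF Δ {1} {3} G → BFF Δ (λ h x → denominatorOf (G h x))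
  denominator∈ G∈ = op₁ reverse-polynomialTime
    (op₂ dropZeros-polynomialTime (op₁ dropFirst-polynomialTime G∈) (op₁ afterTrue-polynomialTime (op₁ dropFirst-polynomialTime G∈)))

  approximable-capital : ∀ s → Approximable (λ d _ t → capital d (s ++ t))
  approximable-capital s = record
    { num = λ h x → numeratorOf (query h x)
    ; den = λ h x → denominatorOf (query h x)
    ; num∈ = numerator∈ query∈
    ; den∈ = denominator∈ query∈
    ; fraction = λ d c g gc i r t → denoted r (capital-nonneg ν d (s ++ t)) (gc r (s ++ t)) (accurate c r (s ++ t)) }
    where
    query : Functional 1 3
    -- `repeat false` of a unary precision is already the length prefix of the pair, so the query is
    -- a concatenation.
    query h x = Ap h (⟨ precision h x , s ++ string h x ⟩ ∷ [])
    query∈ : BFF Δ query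
    query∈ = composition {H = Ap} {G = λ _ h x → ⟨ precision h x , s ++ string h x ⟩} ap
      (λ _ → append (op₁ (repeat-polynomialTime false) precision∈) (prepend (true ∷ []) (append precision∈ (prepend s string∈))))
      (λ _ _ → refl)

  approximable-prob : Computable Δ (prob ν) → ∀ s → Approximable (λ _ _ _ → prob ν s)
  approximable-prob (c , F , F∈ , denotes) s = record
    { num = λ h x → numeratorOf (query h x)
    ; den = λ h x → denominatorOf (query h x)
    ; num∈ = numerator∈ query∈
    ; den∈ = denominator∈ query∈
    ; fraction = λ _ _ _ _ i r _ → denoted r (prob-nonneg ν s) (denotes r s) (accurate c r s) }
    where
    query : Functional 1 3
    query h x = F [] (precision h x ∷ s ∷ [])
    query∈ : BFF Δ query
    query∈ = apply₂ (expanded (base F∈)) precision∈ (constant s)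

  approximable-gate : ∀ β {E} → Approximable E → Approximable (λ d i t → gate β (E d i t))
  approximable-gate true  A = A
  approximable-gate false A = approximable-0

  approximable⇒computable : ∀ {Ψ : ℕ → Martingale ν → Martingale ν} → IsResourceBound Δ →
    Approximable (λ d i t → capital (Ψ i d) t) → OperatorComputable Δ Ψ
  approximable⇒computable closed A =
    -- The sign bit is constant as a `Ratio` is nonnegative; denoted numerals start with the most
    -- significant bit.
    (λ h x → false ∷ ⟨ reverse (num A h x) , reverse (den A h x) ⟩) ,
    Equivalence.to closed (prepend (false ∷ []) (append (op₁ (repeat-polynomialTime false) num′∈)
      (prepend (true ∷ []) (append num′∈ (op₁ reverse-polynomialTime (den∈ A)))))) ,
    λ d c _ g gc i r t → let (q , ratio , near) = fraction A d c g gc i r t in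
      q , ratio⇒denotes {q} {numerator A g i r t} {denominator A g i r t} ratio , unfold-within {q} {r} near
    where
    num′∈ : BFF Δ (λ h x → reverse (num A h x))
    num′∈ = op₁ reverse-polynomialTime (num∈ A)

-- Computability of the splitting operator

module _ {ℓ} {Δ : Class ℓ} {ν : ProbabilityMeasure} where

  open Approximation Δ ν

  approximable-stopped : ∀ {E} → Approximable E → Approximable (λ d i t → stopped i (E d i t))
  approximable-stopped A = approximable-∸ approximable-1 (approximable-* approximable-2^+ (approximable-∸ approximable-1 A))

  approximable-kept : ∀ {E} → Approximable E → Approximable (λ d i t → kept i (E d i t))
  approximable-kept A = approximable-∸ approximable-1 (approximable-stopped A)

  -- The recursion on the fixed `w` takes place while the functional is assembled, leaving nested
  -- case distinctions on the input string. Quantifying over the prefix `s` keeps the hypotheses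
  -- applicable below each child.
  approximable-splitOff : ∀ σ w {δ : Martingale ν → Str → ℝ} {n ρ : Str → ℝ} {a b : Martingale ν → ℕ → ℝ} →
    (∀ s → Approximable (λ d _ t → δ d (s ++ t))) → (∀ s → Approximable (λ _ _ _ → n s)) →
    (∀ s → Approximable (λ _ _ _ → ρ s)) → Approximable (λ d i _ → a d i) → Approximable (λ d i _ → b d i) →
    Approximable (λ d i t → splitOff i σ (δ d) n ρ w (a d i) (b d i) t)
  approximable-splitOff σ [] D N R A B = approximable-gate σ (approximable-+ A (approximable-* B (D [])))
  approximable-splitOff σ (c ∷ w) {δ} {n} {ρ} {a} {b} D N R A B = approximable-branch root (child c false) (child c true)
    where
    a′ b′ : Martingale ν → ℕ → ℝ
    a′ d i = next-a i (a d i) (b d i) (δ d [])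
    b′ d i = next-b i (b d i) (δ d [])
    δ₀ : Approximable (λ d _ _ → δ d [])
    δ₀ = approximable-at (D []) []
    A′ : Approximable (λ d i _ → a′ d i)
    A′ = approximable-+ A (approximable-* B (approximable-* (approximable-stopped δ₀) δ₀))
    B′ : Approximable (λ d i _ → b′ d i)
    B′ = approximable-* B (approximable-kept δ₀)
    on-path : ∀ c → Approximable (λ d i t → splitOff i σ (δ d ↓ c) (n ↓ c) (ρ ↓ c) w (a′ d i) (b′ d i) t)
    on-path c = approximable-splitOff σ w (λ s → D (c ∷ s)) (λ s → N (c ∷ s)) (λ s → R (c ∷ s)) A′ B′
    off-path : ∀ e → Approximable (λ d i t → gate (not σ) (a′ d i + b′ d i * δ d (e ∷ t)))
    off-path e = approximable-gate (not σ) (approximable-+ A′ (approximable-* B′ (D (e ∷ []))))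
    -- With both bits concrete, `same c e` computes and each clause is literally on or off the path.
    child : ∀ c e → Approximable (λ d i t → splitOff i σ (δ d) n ρ (c ∷ w) (a d i) (b d i) (e ∷ t))
    child false false = on-path false
    child false true  = off-path true
    child true  false = off-path false
    child true  true  = on-path true
    root : Approximable (λ d i _ → splitOff i σ (δ d) n ρ (c ∷ w) (a d i) (b d i) [])
    root = approximable-* (R []) (approximable-+
      (approximable-* (N (c ∷ [])) (approximable-at (on-path c) []))
      (approximable-* (N (not c ∷ [])) (approximable-at (off-path (not c)) [])))

  approximable-reciprocal : ∀ {x} c → Approximable (λ _ _ _ → x) → Approximable (λ _ _ _ → reciprocalOf {x} c)
  approximable-reciprocal (inj₁ _)       X = approximable-0
  approximable-reciprocal (inj₂ (l , h)) X = approximable-inv l (fold-≤ h) X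

theorem9 : ∀ {ℓ} (Δ : Class ℓ) → IsResourceBound Δ →
    (ν : ProbabilityMeasure) → IsΔProbabilityMeasure Δ ν →
    (w : Str) → Measurable Δ ν (Cylinder w) × MeasureIs Δ ν (Cylinder w) (prob ν w)
theorem9 Δ closed ν ν-Δ w = record
    { splitting     = cylinderSplitting ν zero-or-≥ w
    ; Φ⁺-computable = computable true
    ; Φ⁻-computable = computable false }
  , measure-of-cylinder ν Δ w
  where
  open Approximation Δ ν
  zero-or-≥ : ∀ t → prob ν t ≈ᵣ 0ᵣ ⊎ (∃ λ l → fromℚ (2^- l) ≤ᵣ prob ν t)
  zero-or-≥ t = Sum.map₂ (IsΔProbabilityMeasure.l ν-Δ (length t) ,_) (IsΔProbabilityMeasure.zero-or-≥ ν-Δ t)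
  N : ∀ s → Approximable (λ _ _ _ → prob ν s)
  N = approximable-prob (IsΔProbabilityMeasure.computable ν-Δ)
  computable : ∀ σ → OperatorComputable Δ (splitMartingale ν zero-or-≥ σ w)
  computable σ = approximable⇒computable {Ψ = splitMartingale ν zero-or-≥ σ w} closed
    (approximable-splitOff σ w approximable-capital N (λ s → approximable-reciprocal (zero-or-≥ s) (N s)) approximable-2^- approximable-1)
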